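{- Let $\mathcal{A}$ be a ribbon combinatory algebra. Then its internal PROB $\mathcal{I}_{\mathcal{A}}$ is a ribbon category (with braid $\boldsymbol{\sigma}$ and twist $\boldsymbol{\theta}$), and $\mathcal{A}$ is isomorphic, as a ribbon combinatory algebra, to the ribbon combinatory algebra arising from a reflexive object of the ribbon category $\mathcal{I}_{\mathcal{A}}$ (namely the object $1$, with a suitable choice of left dual and isomorphism $\varphi$).
   Context: Applicative structure: a set with a left-associative binary application $a\,b$. For elements $\mathbf{B},\mathbf{I}$ write $a\circ b:=\mathbf{B}\,a\,b$, $a^0:=\mathbf{I}$, $a^{n+1}:=a\circ a^n$. A ribbon combinatory algebra is an applicative structure with elements $\mathbf{B},\mathbf{C}^+,\mathbf{C}^-,\mathbf{I},\boldsymbol{\theta}^+,\boldsymbol{\theta}^-,\mathbf{Tr}$ such that for all $a,b,c$ (each $\star$ ranging independently over $\{+,-\}$; $\pm/\mp$ linked, required for both choices): $\mathbf{B}\,a\,b\,c=a\,(b\,c)$; $\mathbf{C}^\star\,a\,b\,c=a\,c\,b$; $\mathbf{I}\,a=a$; $\mathbf{C}^+\,a\,b=\mathbf{C}^-\,a\,b$; $\mathbf{B}\,\mathbf{I}=\mathbf{I}$; $\mathbf{C}^\star\,\mathbf{B}\,\mathbf{I}=\mathbf{B}\,\mathbf{I}$; $(\mathbf{C}^\star\,\mathbf{B}\,\mathbf{B})\circ(\mathbf{B}\circ\mathbf{B})=(\mathbf{B}\,\mathbf{B})\circ\mathbf{B}$; $\mathbf{C}^\pm\circ\mathbf{C}^\mp=\mathbf{B}\,(\mathbf{B}\,\mathbf{I})$;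 $(\mathbf{C}^\star\,\mathbf{B}\,\mathbf{C}^\pm)\circ(\mathbf{B}\circ\mathbf{B})=(\mathbf{B}\,\mathbf{C}^\pm)\circ(\mathbf{B}\circ\mathbf{B})$; $(\mathbf{B}\,\mathbf{C}^\pm)\circ(\mathbf{C}^\pm\circ(\mathbf{B}\,\mathbf{C}^\pm))=\mathbf{C}^\pm\circ((\mathbf{B}\,\mathbf{C}^\pm)\circ\mathbf{C}^\pm)$; $(\mathbf{B}\,\mathbf{B})\circ\mathbf{C}^\pm=\mathbf{C}^\pm\circ((\mathbf{B}\,\mathbf{C}^\pm)\circ\mathbf{B})$; $(\mathbf{B}\,\boldsymbol{\theta}^\pm)\circ\mathbf{B}=(\mathbf{C}^\star\,\mathbf{B}\,\boldsymbol{\theta}^\pm)\circ\mathbf{B}$; $\boldsymbol{\theta}^\pm\circ\boldsymbol{\theta}^\mp=\mathbf{B}\,\mathbf{I}$; $\mathbf{C}^\star\,\boldsymbol{\theta}^\star\,a=\mathbf{C}^\star\,\mathbf{I}\,a$; $\mathbf{B}\circ\boldsymbol{\theta}^\pm=\boldsymbol{\theta}^\pm\circ(\mathbf{C}^\pm\circ(\boldsymbol{\theta}^\pm\circ(\mathbf{C}^\pm\circ\mathbf{B})))$; $(\mathbf{C}^\star\,\mathbf{B}\,\mathbf{Tr})\circ\mathbf{B}=(\mathbf{B}\,\mathbf{Tr})\circ\mathbf{B}^2$; $(\mathbf{B}\,\mathbf{Tr})\circ((\mathbf{C}^\star\,\mathbf{B}\,\mathbf{B})\circ\mathbf{B})=\mathbf{B}\circ\mathbf{Tr}$;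 $\mathbf{Tr}\,\mathbf{C}^\pm=\boldsymbol{\theta}^\pm$; $\mathbf{Tr}^2\circ((\mathbf{C}^\star\,\mathbf{B}\,\mathbf{C}^-)\circ(\mathbf{B}\,\mathbf{C}^+))=\mathbf{Tr}^2$. An isomorphism of ribbon combinatory algebras is a bijection preserving application and the seven constants. Internal PROB: write $a^\bullet:=\mathbf{C}^+\,\mathbf{I}\,a$; $a$ has arity $m\to n$ if $a^\bullet\circ\mathbf{B}^{m+1}=(\mathbf{B}\,a)\circ\mathbf{B}^n$. $\mathcal{I}_{\mathcal{A}}$ has objects the natural numbers, $\mathcal{I}_{\mathcal{A}}(m,n)$ the elements of arity $m\to n$, composite of $a:l\to m$, $b:m\to n$ equal to $a\circ b$ (diagrammatic order), identities $\mathbf{I}$, tensor $m+n$ on objects with unit $0$, and for $a:m\to n$, $b:m'\to n'$, $a+b:=a\circ(\mathbf{B}^n\,b)$ (so $l+a=\mathbf{B}^l\,a$, $a+l=a$). Braid: $\boldsymbol{\sigma}_{0,1}=\mathbf{I}$, $\boldsymbol{\sigma}_{m+1,1}=(\mathbf{B}\,\boldsymbol{\sigma}_{m,1})\circ\mathbf{C}^+$, $\boldsymbol{\sigma}_{m,0}=\mathbf{I}$, $\boldsymbol{\sigma}_{m,n+1}=\boldsymbol{\sigma}_{m,1}\circ(\mathbf{B}\,\boldsymbol{\sigma}_{m,n})$. Twist: $\boldsymbol{\theta}_0=\mathbf{I}$, $\boldsymbol{\theta}_1=\boldsymbol{\theta}^+$, $\boldsymbol{\theta}_{m+1}=\boldsymbol{\theta}^+\circ(\boldsymbol{\sigma}_{1,m}\circ(\boldsymbol{\theta}_m\circ\boldsymbol{\sigma}_{m,1}))$.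 Ribbon category: a (strict) braided monoidal category with braid $\sigma$, natural twist isomorphism $\theta$ with $\theta_{X\otimes Y}=\sigma_{X,Y};(\theta_Y\otimes\theta_X);\sigma_{Y,X}$, every object $X$ having a left dual $X^*$ with unit $\eta_X:I\to X\otimes X^*$ and counit $\varepsilon_X:X^*\otimes X\to I$ satisfying the snake equations, and $(\theta_X)^*=\theta_{X^*}$; composition $f;g$ is diagrammatic. Its trace is $\mathrm{Tr}^X_{U,V}(f)=(U\otimes\eta_X);(f\otimes X^*);(V\otimes(\sigma_{X,X^*};(X^*\otimes\theta_X);\varepsilon_X))$ for $f:U\otimes X\to V\otimes X$. A reflexive object is an object $A$ with an isomorphism $\varphi:A\otimes A^*\to A$. Set $\mathbf{app}:=(\varphi^{ -1}\otimes A);(A\otimes\varepsilon_A):A\otimes A\to A$, $\mathbf{lam}:=(A\otimes\eta_A);(A\otimes A\otimes\theta_{A^*}^{ -1});(A\otimes\sigma^{ -1}_{A^*,A});(\varphi\otimes A):A\to A\otimes A$; $\mathbf{app}_0=\mathrm{id}_A$, $\mathbf{app}_{n+1}=(\mathbf{app}\otimes A^{\otimes n});\mathbf{app}_n$; $\mathbf{lam}_0=\mathrm{id}_A$, $\mathbf{lam}_{m+1}=\mathbf{lam}_m;(\mathbf{lam}\otimes A^{\otimes m})$; for $f:A^{\otimes m}\to A^{\otimes n}$, $F(f):=\mathrm{Tr}^A_{I,A}(\mathbf{lam}_m;(\mathbf{lam}\otimes f);(A\otimes\mathbf{app}_n)):I\to A$. The ribbon combinatory algebra arising from $(A,\varphi)$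 is the set of morphisms $I\to A$ with application $a\,b=(a\otimes b);\mathbf{app}$ and constants $\mathbf{B}=F(\mathbf{app})$, $\mathbf{C}^\pm=F(\sigma^{\pm1}_{A,A})$, $\mathbf{I}=F(\mathrm{id}_I)$, $\boldsymbol{\theta}^\pm=F(\theta_A^{\pm1})$, $\mathbf{Tr}=F(\mathbf{lam})$. -}

module Defs where

open import Data.Nat using (ℕ; zero; suc; _+_)
open import Data.Nat.Properties using (+-assoc; +-identityʳ)
open import Data.Product using (Σ; _×_; _,_; proj₁; proj₂; ∃)
open import Data.Sign using (Sign; +; -; opposite)
open import Relation.Binary.PropositionalEquality
  using (_≡_; refl; sym; trans; cong; subst; subst₂)
open import Relation.Binary.Structures using (IsEquivalence)

-- Applicative structures with the seven constants of a ribbon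
-- combinatory algebra.  The constants C⁺, C⁻ are encoded as  C +, C -
-- and θ⁺, θ⁻ as  θ +, θ -  (a function out of the two signs).

record RCAData : Set₁ where
  infixl 9 _·_
  field
    Carrier : Set
    _·_     : Carrier → Carrier → Carrier
    B       : Carrier
    C       : Sign → Carrier
    I       : Carrier
    θ       : Sign → Carrier
    Tr      : Carrier

module RCANotation (D : RCAData) where
  open RCAData D public
  infixr 8 _∘_
  _∘_ : Carrier → Carrier → Carrier
  a ∘ b = B · a · b
  _^_ : Carrier → ℕ → Carrier
  a ^ zero  = I
  a ^ suc n = a ∘ (a ^ n)

-- The axioms of a ribbon combinatory algebra (carrier a set, i.e. the
-- equality is propositional equality).  ⋆ ranges over Sign (variables
-- s, t) and ± / ∓ is  s / opposite s.
record IsRCA (D : RCAData) : Set where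
  open RCANotation D
  field
    B-ax     : ∀ a b c → B · a · b · c ≡ a · (b · c)
    C-ax     : ∀ s a b c → C s · a · b · c ≡ a · c · b
    I-ax     : ∀ a → I · a ≡ a
    C⁺≡C⁻    : ∀ a b → C + · a · b ≡ C - · a · b
    BI       : B · I ≡ I
    CBI      : ∀ s → C s · B · I ≡ B · I
    CBB      : ∀ s → (C s · B · B) ∘ (B ∘ B) ≡ (B · B) ∘ B
    CC       : ∀ s → C s ∘ C (opposite s) ≡ B · (B · I)
    CBC      : ∀ t s → (C t · B · C s) ∘ (B ∘ B) ≡ (B · C s) ∘ (B ∘ B)
    YB       : ∀ s → (B · C s) ∘ (C s ∘ (B · C s)) ≡ C s ∘ ((B · C s) ∘ C s)
    BBC      : ∀ s → (B · B) ∘ C s ≡ C s ∘ ((B · C s) ∘ B)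
    Bθ       : ∀ t s → (B · θ s) ∘ B ≡ (C t · B · θ s) ∘ B
    θθ       : ∀ s → θ s ∘ θ (opposite s) ≡ B · I
    Cθ       : ∀ s t a → C s · θ t · a ≡ C s · I · a
    Bθ-twist : ∀ s → B ∘ θ s ≡ θ s ∘ (C s ∘ (θ s ∘ (C s ∘ B)))
    CBTr     : ∀ s → (C s · B · Tr) ∘ B ≡ (B · Tr) ∘ (B ^ 2)
    BTr      : ∀ s → (B · Tr) ∘ ((C s · B · B) ∘ B) ≡ B ∘ Tr
    TrC      : ∀ s → Tr · C s ≡ θ s
    Tr²      : ∀ s → (Tr ^ 2) ∘ ((C s · B · C -) ∘ (B · C +)) ≡ Tr ^ 2

record RCA : Set₁ where
  field
    raw   : RCAData
    isRCA : IsRCA raw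
  open RCANotation raw public

module InternalPROB (𝒜 : RCA) where
  open RCA 𝒜

  _• : Carrier → Carrier
  a • = C + · I · a

  HasArity : ℕ → ℕ → Carrier → Set
  HasArity m n a = (a •) ∘ (B ^ suc m) ≡ (B · a) ∘ (B ^ n)

  record Hom (m n : ℕ) : Set where
    constructor ⟨_,_⟩
    field
      elt   : Carrier
      arity : HasArity m n elt
  open Hom public

  _≈_ : ∀ {m n} → Hom m n → Hom m n → Set
  f ≈ g = elt f ≡ elt g

  σ₁ : ℕ → Carrier
  σ₁ zero    = I
  σ₁ (suc m) = (B · σ₁ m) ∘ C +

  σ : ℕ → ℕ → Carrier
  σ m zero          = I
  σ m (suc zero)    = σ₁ m
  σ m (suc (suc n)) = σ₁ m ∘ (B · σ m (suc n))

  θₘ : ℕ → Carrier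
  θₘ zero          = I
  θₘ (suc zero)    = θ +
  θₘ (suc (suc m)) = θ + ∘ (σ 1 (suc m) ∘ (θₘ (suc m) ∘ σ (suc m) 1))

-- Strict monoidal categories with hom-setoids.  Objects, homs, the
-- hom-equality, the unit object and the tensor of objects are
-- parameters; composition (diagrammatic), identities and the tensor of
-- morphisms are fields.  Strictness: the associativity and unit laws
-- hold for objects (as equations in Obj) and for morphisms (up to the
-- transport  cast  along those object equations).

module _ {Obj : Set} (Hom : Obj → Obj → Set) where
  cast : ∀ {a a' b b'} → a ≡ a' → b ≡ b' → Hom a b → Hom a' b'
  cast p q f = subst₂ Hom p q f

record StrictMonoidalCategory
    (Obj : Set) (Hom : Obj → Obj → Set)
    (_≈_ : ∀ {a b} → Hom a b → Hom a b → Set)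
    (𝟙 : Obj) (_⊗_ : Obj → Obj → Obj) : Set where
  infixr 9 _⨾_
  infixr 10 _⊗₁_
  field
    ≈-equiv : ∀ {a b} → IsEquivalence (_≈_ {a} {b})
    _⨾_     : ∀ {a b c} → Hom a b → Hom b c → Hom a c
    id      : ∀ {a} → Hom a a
    ⨾-cong  : ∀ {a b c} {f f' : Hom a b} {g g' : Hom b c} →
              f ≈ f' → g ≈ g' → (f ⨾ g) ≈ (f' ⨾ g')
    ⨾-assoc : ∀ {a b c d} (f : Hom a b) (g : Hom b c) (h : Hom c d) →
              ((f ⨾ g) ⨾ h) ≈ (f ⨾ (g ⨾ h))
    id-⨾    : ∀ {a b} (f : Hom a b) → (id ⨾ f) ≈ f
    ⨾-id    : ∀ {a b} (f : Hom a b) → (f ⨾ id) ≈ f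
    _⊗₁_    : ∀ {a b c d} → Hom a b → Hom c d → Hom (a ⊗ c) (b ⊗ d)
    ⊗-cong  : ∀ {a b c d} {f f' : Hom a b} {g g' : Hom c d} →
              f ≈ f' → g ≈ g' → (f ⊗₁ g) ≈ (f' ⊗₁ g')
    ⊗-id    : ∀ {a b} → (id {a} ⊗₁ id {b}) ≈ id
    ⊗-⨾     : ∀ {a b c a' b' c'} (f : Hom a b) (g : Hom b c)
                (f' : Hom a' b') (g' : Hom b' c') →
              ((f ⨾ g) ⊗₁ (f' ⨾ g')) ≈ ((f ⊗₁ f') ⨾ (g ⊗₁ g'))
    assoc₀  : ∀ a b c → (a ⊗ b) ⊗ c ≡ a ⊗ (b ⊗ c)
    unitˡ₀  : ∀ a → 𝟙 ⊗ a ≡ a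
    unitʳ₀  : ∀ a → a ⊗ 𝟙 ≡ a
    assoc₁  : ∀ {a b c a' b' c'} (f : Hom a a') (g : Hom b b') (h : Hom c c') →
              cast Hom (assoc₀ a b c) (assoc₀ a' b' c') ((f ⊗₁ g) ⊗₁ h)
                ≈ (f ⊗₁ (g ⊗₁ h))
    unitˡ₁  : ∀ {a b} (f : Hom a b) →
              cast Hom (unitˡ₀ a) (unitˡ₀ b) (id {𝟙} ⊗₁ f) ≈ f
    unitʳ₁  : ∀ {a b} (f : Hom a b) →
              cast Hom (unitʳ₀ a) (unitʳ₀ b) (f ⊗₁ id {𝟙}) ≈ f

module _ {Obj : Set} {Hom : Obj → Obj → Set}
         {_≈_ : ∀ {a b} → Hom a b → Hom a b → Set}
         {𝟙 : Obj} {_⊗_ : Obj → Obj → Obj}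
         (M : StrictMonoidalCategory Obj Hom _≈_ 𝟙 _⊗_)
         (dual : Obj → Obj)
         (η : ∀ a → Hom 𝟙 (a ⊗ dual a))
         (ε : ∀ a → Hom (dual a ⊗ a) 𝟙) where
  open StrictMonoidalCategory M
  transpose : ∀ {a b} → Hom a b → Hom (dual b) (dual a)
  transpose {a} {b} f =
    cast Hom (unitʳ₀ (dual b)) (unitˡ₀ (dual a))
      ((id {dual b} ⊗₁ η a)
       ⨾ (id {dual b} ⊗₁ (f ⊗₁ id {dual a}))
       ⨾ cast Hom (assoc₀ (dual b) b (dual a)) refl (ε b ⊗₁ id {dual a}))

record RibbonStructure
    {Obj : Set} {Hom : Obj → Obj → Set}
    {_≈_ : ∀ {a b} → Hom a b → Hom a b → Set}
    {𝟙 : Obj} {_⊗_ : Obj → Obj → Obj}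
    (M : StrictMonoidalCategory Obj Hom _≈_ 𝟙 _⊗_) : Set where
  open StrictMonoidalCategory M
  field
    σ       : ∀ a b → Hom (a ⊗ b) (b ⊗ a)
    σ⁻¹     : ∀ a b → Hom (b ⊗ a) (a ⊗ b)
    σ-σ⁻¹   : ∀ a b → (σ a b ⨾ σ⁻¹ a b) ≈ id
    σ⁻¹-σ   : ∀ a b → (σ⁻¹ a b ⨾ σ a b) ≈ id
    σ-nat   : ∀ {a b c d} (f : Hom a c) (g : Hom b d) →
              ((f ⊗₁ g) ⨾ σ c d) ≈ (σ a b ⨾ (g ⊗₁ f))
    hexagon₁ : ∀ a b c →
              cast Hom (assoc₀ a b c) (sym (assoc₀ c a b)) (σ (a ⊗ b) c)
                ≈ ((id {a} ⊗₁ σ b c)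
                   ⨾ cast Hom (assoc₀ a c b) refl (σ a c ⊗₁ id {b}))
    hexagon₂ : ∀ a b c →
              cast Hom (sym (assoc₀ a b c)) (assoc₀ b c a) (σ a (b ⊗ c))
                ≈ ((σ a b ⊗₁ id {c})
                   ⨾ cast Hom (sym (assoc₀ b a c)) refl (id {b} ⊗₁ σ a c))
    θ       : ∀ a → Hom a a
    θ⁻¹     : ∀ a → Hom a a
    θ-θ⁻¹   : ∀ a → (θ a ⨾ θ⁻¹ a) ≈ id
    θ⁻¹-θ   : ∀ a → (θ⁻¹ a ⨾ θ a) ≈ id
    θ-nat   : ∀ {a b} (f : Hom a b) → (f ⨾ θ b) ≈ (θ a ⨾ f)
    θ-⊗     : ∀ a b → θ (a ⊗ b) ≈ (σ a b ⨾ (θ b ⊗₁ θ a) ⨾ σ b a)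
    dual    : Obj → Obj
    η       : ∀ a → Hom 𝟙 (a ⊗ dual a)
    ε       : ∀ a → Hom (dual a ⊗ a) 𝟙
    snake₁  : ∀ a →
              cast Hom (unitˡ₀ a) (unitʳ₀ a)
                ((η a ⊗₁ id {a})
                 ⨾ cast Hom (sym (assoc₀ a (dual a) a)) refl (id {a} ⊗₁ ε a))
                ≈ id
    snake₂  : ∀ a →
              cast Hom (unitʳ₀ (dual a)) (unitˡ₀ (dual a))
                ((id {dual a} ⊗₁ η a)
                 ⨾ cast Hom (assoc₀ (dual a) a (dual a)) refl
                     (ε a ⊗₁ id {dual a}))
                ≈ id
    θ-dual  : ∀ a → transpose M dual η ε (θ a) ≈ θ (dual a)

module ReflexiveObject
    {Obj : Set} {Hom : Obj → Obj → Set}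
    {_≈_ : ∀ {a b} → Hom a b → Hom a b → Set}
    {𝟙 : Obj} {_⊗_ : Obj → Obj → Obj}
    (M : StrictMonoidalCategory Obj Hom _≈_ 𝟙 _⊗_)
    (R : RibbonStructure M)
    (A : Obj) (φ : Hom (A ⊗ RibbonStructure.dual R A) A)
    (φ⁻¹ : Hom A (A ⊗ RibbonStructure.dual R A)) where
  open StrictMonoidalCategory M
  open RibbonStructure R

  trace : ∀ U V X → Hom (U ⊗ X) (V ⊗ X) → Hom U V
  trace U V X f =
    cast Hom (unitʳ₀ U) (unitʳ₀ V)
      ((id {U} ⊗₁ η X)
       ⨾ cast Hom (assoc₀ U X (dual X)) (assoc₀ V X (dual X))
           (f ⊗₁ id {dual X})
       ⨾ (id {V} ⊗₁ (σ X (dual X) ⨾ (id {dual X} ⊗₁ θ X) ⨾ ε X)))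

  A* : Obj
  A* = dual A

  app : Hom (A ⊗ A) A
  app = cast Hom refl (unitʳ₀ A)
          ((φ⁻¹ ⊗₁ id {A})
           ⨾ cast Hom (sym (assoc₀ A A* A)) refl (id {A} ⊗₁ ε A))

  lam : Hom A (A ⊗ A)
  lam = cast Hom (unitʳ₀ A) refl
          ((id {A} ⊗₁ η A)
           ⨾ (id {A} ⊗₁ (id {A} ⊗₁ θ⁻¹ A*))
           ⨾ (id {A} ⊗₁ σ⁻¹ A* A)
           ⨾ cast Hom (assoc₀ A A* A) refl (φ ⊗₁ id {A}))

  pow : ℕ → Obj
  pow zero    = 𝟙
  pow (suc n) = A ⊗ pow n

  appₙ : ∀ n → Hom (A ⊗ pow n) A
  appₙ zero    = cast Hom (sym (unitʳ₀ A)) refl (id {A})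
  appₙ (suc n) = cast Hom (assoc₀ A A (pow n)) refl (app ⊗₁ id {pow n}) ⨾ appₙ n

  lamₙ : ∀ m → Hom A (A ⊗ pow m)
  lamₙ zero    = cast Hom refl (sym (unitʳ₀ A)) (id {A})
  lamₙ (suc m) = lamₙ m ⨾ cast Hom refl (assoc₀ A A (pow m)) (lam ⊗₁ id {pow m})

  F : ∀ m n → Hom (pow m) (pow n) → Hom 𝟙 A
  F m n f =
    trace 𝟙 A A
      (cast Hom (sym (unitˡ₀ A)) refl
        (lamₙ m
         ⨾ cast Hom refl (assoc₀ A A (pow n)) (lam ⊗₁ f)
         ⨾ (id {A} ⊗₁ appₙ n)))

  pow1 : pow 1 ≡ A
  pow1 = unitʳ₀ A

  pow2 : pow 2 ≡ A ⊗ A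
  pow2 = cong (A ⊗_) (unitʳ₀ A)

  σ± : Sign → Hom (A ⊗ A) (A ⊗ A)
  σ± + = σ A A
  σ± - = σ⁻¹ A A

  θ± : Sign → Hom A A
  θ± + = θ A
  θ± - = θ⁻¹ A

  -- the arising ribbon combinatory algebra: morphisms 𝟙 → A with
  -- a b = (a ⊗ b);app  and the constants below; equality is _≈_.
  arising : RCAData
  arising = record
    { Carrier = Hom 𝟙 A
    ; _·_ = λ a b → cast Hom (unitˡ₀ 𝟙) refl (a ⊗₁ b) ⨾ app
    ; B   = F 2 1 (cast Hom (sym pow2) (sym pow1) app)
    ; C   = λ s → F 2 2 (cast Hom (sym pow2) (sym pow2) (σ± s))
    ; I   = F 0 0 (id {𝟙})
    ; θ   = λ s → F 1 1 (cast Hom (sym pow1) (sym pow1) (θ± s))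
    ; Tr  = F 1 2 (cast Hom (sym pow1) (sym pow2) lam)
    }

record RCAIso (𝒜 : RCA) (D : RCAData)
    (_≈_ : RCAData.Carrier D → RCAData.Carrier D → Set) : Set where
  private
    module S = RCA 𝒜
    module T = RCAData D
  field
    to         : S.Carrier → T.Carrier
    injective  : ∀ a b → to a ≈ to b → a ≡ b
    surjective : ∀ y → Σ S.Carrier (λ a → to a ≈ y)
    pres-·     : ∀ a b → to (a S.· b) ≈ (to a T.· to b)
    pres-B     : to S.B ≈ T.B
    pres-C     : ∀ s → to (S.C s) ≈ T.C s
    pres-I     : to S.I ≈ T.I
    pres-θ     : ∀ s → to (S.θ s) ≈ T.θ s
    pres-Tr    : to S.Tr ≈ T.Tr

{-# OPTIONS --safe #-}
module Submission where

-- A word of elements reads as a diagram, strands counted from the left; `S` leaves the first strand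
-- alone. The two roles of `Tr` are tied by `S (Tr · f) = Tr ∘ S f ∘ B`, which is beta in trace
-- form: an abstraction that meets an application becomes a closed strand. Eta is no axiom and has
-- to be derived. The obstacle is the lack of extensionality: an equation between elements does not
-- follow from its instances at arguments. Its substitute is evaluation at `I`. An element of arity
-- m → 1 is determined by `p · I`, and `B · I = I`, so copies of `B` may be appended at will. They
-- supply the application that beta needs, and what is left is a closed diagram without `Tr` and
-- `B`, to be resolved by braid and twist laws. Each closed crossing leaves a twist, which is why
-- the signs have to be tracked. The reflexive isomorphism is not guessed: `app = B` forces its
-- inverse to be `B` with the argument bent by η, and `lam = Tr` forces it to be `Tr` with the bound
-- strand bent by ε.

-- Composition makes the carrier a monoid and S a = B · a an endomorphism, and
-- an arity a : m → n internalises the interchange of a with every shifted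
-- element, so the naturality of braid and twist is read off the arity
-- equation of a.  Axiomatically Tr is both the abstraction map 1 → 2 and an
-- operation closing the first strand of a map; it satisfies an eta rule for
-- the application map B : 2 → 1.  If A ⊗ A* ≅ A then A is an object of
-- endomorphisms, hence self-dual under the trace form tr (x ∘ y).  This form
-- and its copairing are written with Tr and B, the eta rule gives the snake
-- equations, and the closing operation becomes the trace of the duality.  An
-- element y corresponds to y • : 0 → 1, with inverse f ↦ f · I.

open import Defs
open import Data.Nat using (ℕ; zero; suc; _+_)
open import Data.Nat.Properties using (+-comm; +-suc; +-assoc; +-identityʳ)
open import Data.Sign using (Sign; opposite) renaming (+ to ⊕; - to ⊖)
open import Data.List using (List; []; _∷_; _++_; map)
open import Data.Product using (Σ; _×_; _,_)
open import Data.Unit using (⊤)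
open import Relation.Binary.PropositionalEquality
  using (_≡_; refl; sym; trans; cong; cong₂; subst; module ≡-Reasoning)

module Theory (𝒜 : RCA) where
  open RCA 𝒜
  open IsRCA isRCA
  open InternalPROB 𝒜 using (_•; Hom; ⟨_,_⟩; elt; _≈_)
    renaming (σ to σᴰ; σ₁ to σ₁ᴰ; θₘ to θᴰ)
  open ≡-Reasoning

  -- The composition monoid and its endomorphism `S`

  S : Carrier → Carrier
  S a = B · a

  app-eq : ∀ {x y} → x ≡ y → ∀ c → x · c ≡ y · c
  app-eq e c = cong (_· c) e

  -- Multiplicativity of `S` with its second argument abstracted. It is the axiom `CBB` evaluated at
  -- `a`, so it is available before associativity, which is then obtained from it.
  B-S : ∀ a → B ∘ S a ≡ S (S a) ∘ B
  B-S a = sym (begin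
    S (S a) ∘ B                        ≡⟨ C-ax ⊕ B B (S (S a)) ⟨
    C ⊕ · B · B · S (S a)              ≡⟨ cong (C ⊕ · B · B ·_) (B-ax B B a) ⟨
    C ⊕ · B · B · ((B ∘ B) · a)        ≡⟨ B-ax (C ⊕ · B · B) (B ∘ B) a ⟨
    ((C ⊕ · B · B) ∘ (B ∘ B)) · a      ≡⟨ app-eq (CBB ⊕) a ⟩
    ((B · B) ∘ B) · a                  ≡⟨ B-ax (B · B) B a ⟩
    B ∘ S a                            ∎)

  S-∘ : ∀ a b → S (a ∘ b) ≡ S a ∘ S b
  S-∘ a b = begin
    S (S a · b)        ≡⟨ B-ax B (S a) b ⟨
    (B ∘ S a) · b      ≡⟨ app-eq (B-S a) b ⟩
    (S (S a) ∘ B) · b  ≡⟨ B-ax (S (S a)) B b ⟩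
    S a ∘ S b          ∎

  ∘-assoc : ∀ a b c → (a ∘ b) ∘ c ≡ a ∘ (b ∘ c)
  ∘-assoc a b c = trans (app-eq (S-∘ a b) c) (B-ax (S a) (S b) c)

  ∘-identityˡ : ∀ a → I ∘ a ≡ a
  ∘-identityˡ a = trans (app-eq BI a) (I-ax a)

  ∘-identityʳ : ∀ a → a ∘ I ≡ a
  ∘-identityʳ a = begin
    a ∘ I              ≡⟨ C-ax ⊕ B I a ⟨
    C ⊕ · B · I · a    ≡⟨ app-eq (CBI ⊕) a ⟩
    I ∘ a              ≡⟨ ∘-identityˡ a ⟩
    a                  ∎

  S-I : S I ≡ I
  S-I = BI

  -- Words evaluate to right-nested composites, so that a local rewrite of a
  -- concrete word needs no associativity step.
  ⟦_⟧ : List Carrier → Carrier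
  ⟦ [] ⟧         = I
  ⟦ x ∷ [] ⟧     = x
  ⟦ x ∷ y ∷ w ⟧  = x ∘ ⟦ y ∷ w ⟧

  infix 4 _≋_
  -- A wrapper around the equation, since `v` and `w` could not be inferred from the evaluated
  -- composites.
  record _≋_ (v w : List Carrier) : Set where
    constructor ⌊_⌋
    field value : ⟦ v ⟧ ≡ ⟦ w ⟧
  open _≋_ public

  ⟦⟧-∷ : ∀ x w → ⟦ x ∷ w ⟧ ≡ x ∘ ⟦ w ⟧
  ⟦⟧-∷ x []      = sym (∘-identityʳ x)
  ⟦⟧-∷ x (y ∷ w) = refl

  ⟦⟧-++ : ∀ v w → ⟦ v ++ w ⟧ ≡ ⟦ v ⟧ ∘ ⟦ w ⟧
  ⟦⟧-++ []      w = sym (∘-identityˡ ⟦ w ⟧)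
  ⟦⟧-++ (x ∷ v) w = begin
    ⟦ x ∷ v ++ w ⟧       ≡⟨ ⟦⟧-∷ x (v ++ w) ⟩
    x ∘ ⟦ v ++ w ⟧       ≡⟨ cong (x ∘_) (⟦⟧-++ v w) ⟩
    x ∘ ⟦ v ⟧ ∘ ⟦ w ⟧    ≡⟨ ∘-assoc x ⟦ v ⟧ ⟦ w ⟧ ⟨
    (x ∘ ⟦ v ⟧) ∘ ⟦ w ⟧  ≡⟨ cong (_∘ ⟦ w ⟧) (⟦⟧-∷ x v) ⟨
    ⟦ x ∷ v ⟧ ∘ ⟦ w ⟧    ∎

  ⟦⟧-map : ∀ w → ⟦ map S w ⟧ ≡ S ⟦ w ⟧
  ⟦⟧-map []      = sym S-I
  ⟦⟧-map (x ∷ w) = begin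
    ⟦ S x ∷ map S w ⟧     ≡⟨ ⟦⟧-∷ (S x) (map S w) ⟩
    S x ∘ ⟦ map S w ⟧     ≡⟨ cong (S x ∘_) (⟦⟧-map w) ⟩
    S x ∘ S ⟦ w ⟧         ≡⟨ S-∘ x ⟦ w ⟧ ⟨
    S (x ∘ ⟦ w ⟧)         ≡⟨ cong S (⟦⟧-∷ x w) ⟨
    S ⟦ x ∷ w ⟧           ∎

  ≋-sym : ∀ {v w} → v ≋ w → w ≋ v
  ≋-sym ⌊ e ⌋ = ⌊ sym e ⌋

  -- Tuples rather than vectors: their eta law lets unification solve the
  -- prefix from its length alone.
  Prefix : ℕ → Set
  Prefix zero    = ⊤
  Prefix (suc k) = Carrier × Prefix k

  prepend : ∀ k → Prefix k → List Carrier → List Carrier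
  prepend zero    _       w = w
  prepend (suc k) (x , p) w = x ∷ prepend k p w

  -- The number `k` counts the letters in front of the rewritten factor. An empty `v` inserts a
  -- word, an empty `w` deletes one.
  at : ∀ k {p : Prefix k} {v w u} → v ≋ w →
       prepend k p (v ++ u) ≋ prepend k p (w ++ u)
  at zero {v = v} {w} {u} ⌊ e ⌋ = ⌊ begin
    ⟦ v ++ u ⟧     ≡⟨ ⟦⟧-++ v u ⟩
    ⟦ v ⟧ ∘ ⟦ u ⟧  ≡⟨ cong (_∘ ⟦ u ⟧) e ⟩
    ⟦ w ⟧ ∘ ⟦ u ⟧  ≡⟨ ⟦⟧-++ w u ⟨
    ⟦ w ++ u ⟧     ∎ ⌋
  at (suc k) {x , p} {v} {w} {u} e = ⌊ begin
    ⟦ x ∷ prepend k p (v ++ u) ⟧  ≡⟨ ⟦⟧-∷ x (prepend k p (v ++ u)) ⟩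
    x ∘ ⟦ prepend k p (v ++ u) ⟧  ≡⟨ cong (x ∘_) (value (at k {p} e)) ⟩
    x ∘ ⟦ prepend k p (w ++ u) ⟧  ≡⟨ ⟦⟧-∷ x (prepend k p (w ++ u)) ⟨
    ⟦ x ∷ prepend k p (w ++ u) ⟧  ∎ ⌋

  ⇑ : ∀ {v w} → v ≋ w → map S v ≋ map S w
  ⇑ {v} {w} ⌊ e ⌋ = ⌊ trans (⟦⟧-map v) (trans (cong S e) (sym (⟦⟧-map w))) ⌋

  infixr 2 _≋⟨_⟩_ _≋⟨_⟨_
  infix  3 _■

  _≋⟨_⟩_ : ∀ u {v w} → u ≋ v → v ≋ w → u ≋ w
  u ≋⟨ ⌊ p ⌋ ⟩ ⌊ q ⌋ = ⌊ trans p q ⌋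

  _≋⟨_⟨_ : ∀ u {v w} → v ≋ u → v ≋ w → u ≋ w
  u ≋⟨ ⌊ p ⌋ ⟨ ⌊ q ⌋ = ⌊ trans (sym p) q ⌋

  _■ : ∀ w → w ≋ w
  w ■ = ⌊ refl ⌋

  ∘-fuse : ∀ {a b} → a ∷ b ∷ [] ≋ a ∘ b ∷ []
  ∘-fuse = ⌊ refl ⌋

  S-fuse : ∀ {a b} → S a ∷ S b ∷ [] ≋ S (a ∘ b) ∷ []
  S-fuse = ⌊ sym (S-∘ _ _) ⌋

  I-drop : I ∷ [] ≋ []
  I-drop = ⌊ refl ⌋

  S-I-drop : S I ∷ [] ≋ []
  S-I-drop = ⌊ S-I ⌋

  atom : ∀ {a b} → a ≡ b → a ∷ [] ≋ b ∷ []
  atom = ⌊_⌋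

  -- Laws of the constants as rewriting rules on words

  B-S′ : ∀ {a} → B ∷ S a ∷ [] ≋ S (S a) ∷ B ∷ []
  B-S′ = ⌊ B-S _ ⌋

  -- A closed axiom evaluated at `a` becomes a commutation law: a crossing occupies two strands, so
  -- it commutes with whatever acts to their right. The laws for `θ` and `Tr` below arise in the
  -- same way.
  C-S² : ∀ s {a} → C s ∷ S (S a) ∷ [] ≋ S (S a) ∷ C s ∷ []
  C-S² s {a} = ⌊ (begin
    C s ∘ S (S a)                        ≡⟨ cong (C s ∘_) (B-ax B B a) ⟨
    S (C s) · ((B ∘ B) · a)              ≡⟨ B-ax (S (C s)) (B ∘ B) a ⟨
    (S (C s) ∘ (B ∘ B)) · a              ≡⟨ app-eq (CBC ⊕ s) a ⟨
    ((C ⊕ · B · C s) ∘ (B ∘ B)) · a      ≡⟨ B-ax (C ⊕ · B · C s) (B ∘ B) a ⟩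
    C ⊕ · B · C s · ((B ∘ B) · a)        ≡⟨ C-ax ⊕ B (C s) _ ⟩
    ((B ∘ B) · a) ∘ C s                  ≡⟨ cong (_∘ C s) (B-ax B B a) ⟩
    S (S a) ∘ C s                        ∎) ⌋

  θ-S : ∀ s {a} → θ s ∷ S a ∷ [] ≋ S a ∷ θ s ∷ []
  θ-S s {a} = ⌊ (begin
    θ s ∘ S a                     ≡⟨ B-ax (S (θ s)) B a ⟨
    (S (θ s) ∘ B) · a             ≡⟨ app-eq (Bθ ⊕ s) a ⟩
    ((C ⊕ · B · θ s) ∘ B) · a     ≡⟨ B-ax (C ⊕ · B · θ s) B a ⟩
    C ⊕ · B · θ s · S a           ≡⟨ C-ax ⊕ B (θ s) (S a) ⟩
    S a ∘ θ s                     ∎) ⌋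

  Tr-S : ∀ {a} → Tr ∷ S (S a) ∷ [] ≋ S a ∷ Tr ∷ []
  Tr-S {a} = ⌊ (begin
    Tr ∘ S (S a)                  ≡⟨ cong (λ x → Tr ∘ S (x · a)) (∘-identityʳ B) ⟨
    Tr ∘ S ((B ^ 1) · a)          ≡⟨ cong (Tr ∘_) (B-ax B (B ^ 1) a) ⟨
    Tr ∘ ((B ^ 2) · a)            ≡⟨ B-ax (S Tr) (B ^ 2) a ⟨
    (S Tr ∘ (B ^ 2)) · a          ≡⟨ app-eq (CBTr ⊕) a ⟨
    ((C ⊕ · B · Tr) ∘ B) · a      ≡⟨ B-ax (C ⊕ · B · Tr) B a ⟩
    C ⊕ · B · Tr · S a            ≡⟨ C-ax ⊕ B Tr (S a) ⟩
    S a ∘ Tr                      ∎) ⌋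

  C-inverse : ∀ s → C s ∷ C (opposite s) ∷ [] ≋ []
  C-inverse s = ⌊ trans (CC s) (trans (cong S S-I) S-I) ⌋

  C-inverse′ : ∀ s → C (opposite s) ∷ C s ∷ [] ≋ []
  C-inverse′ ⊕ = C-inverse ⊖
  C-inverse′ ⊖ = C-inverse ⊕

  θ-inverse : ∀ s → θ s ∷ θ (opposite s) ∷ [] ≋ []
  θ-inverse s = ⌊ trans (θθ s) S-I ⌋

  θ-inverse′ : ∀ s → θ (opposite s) ∷ θ s ∷ [] ≋ []
  θ-inverse′ ⊕ = θ-inverse ⊖
  θ-inverse′ ⊖ = θ-inverse ⊕

  YB′ : ∀ s → S (C s) ∷ C s ∷ S (C s) ∷ [] ≋ C s ∷ S (C s) ∷ C s ∷ []
  YB′ s = ⌊ YB s ⌋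

  SB-C : ∀ s → S B ∷ C s ∷ [] ≋ C s ∷ S (C s) ∷ B ∷ []
  SB-C s = ⌊ BBC s ⌋

  -- Braid relations with mixed signs

  module _ (s : Sign) where

    private
      s̄ = opposite s

    YB-left : C s̄ ∷ S (C s) ∷ C s ∷ [] ≋ S (C s) ∷ C s ∷ S (C s̄) ∷ []
    YB-left =
      C s̄ ∷ S (C s) ∷ C s ∷ []                           ≋⟨ at 3 (⇑ (C-inverse s)) ⟨
      C s̄ ∷ S (C s) ∷ C s ∷ S (C s) ∷ S (C s̄) ∷ []       ≋⟨ at 1 (YB′ s) ⟩
      C s̄ ∷ C s ∷ S (C s) ∷ C s ∷ S (C s̄) ∷ []           ≋⟨ at 0 (C-inverse′ s) ⟩
      S (C s) ∷ C s ∷ S (C s̄) ∷ []                       ■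

    YB-right : C s ∷ S (C s) ∷ C s̄ ∷ [] ≋ S (C s̄) ∷ C s ∷ S (C s) ∷ []
    YB-right =
      C s ∷ S (C s) ∷ C s̄ ∷ []                           ≋⟨ at 0 (⇑ (C-inverse′ s)) ⟨
      S (C s̄) ∷ S (C s) ∷ C s ∷ S (C s) ∷ C s̄ ∷ []       ≋⟨ at 1 (YB′ s) ⟩
      S (C s̄) ∷ C s ∷ S (C s) ∷ C s ∷ C s̄ ∷ []           ≋⟨ at 3 (C-inverse s) ⟩
      S (C s̄) ∷ C s ∷ S (C s) ∷ []                       ■

    SC-B : S (C s̄) ∷ B ∷ [] ≋ C s ∷ S B ∷ C s̄ ∷ []
    SC-B =
      S (C s̄) ∷ B ∷ []                                   ≋⟨ at 0 (C-inverse s) ⟨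
      C s ∷ C s̄ ∷ S (C s̄) ∷ B ∷ []                       ≋⟨ at 1 (SB-C s̄) ⟨
      C s ∷ S B ∷ C s̄ ∷ []                               ■

    B-C : B ∷ C s ∷ [] ≋ S (C s) ∷ C s ∷ S B ∷ []
    B-C =
      B ∷ C s ∷ []                                       ≋⟨ at 0 (⇑ (C-inverse s)) ⟨
      S (C s) ∷ S (C s̄) ∷ B ∷ C s ∷ []                   ≋⟨ at 1 SC-B ⟩
      S (C s) ∷ C s ∷ S B ∷ C s̄ ∷ C s ∷ []               ≋⟨ at 3 (C-inverse′ s) ⟩
      S (C s) ∷ C s ∷ S B ∷ []                           ■

    C-SB : C s ∷ S B ∷ [] ≋ S (C s̄) ∷ B ∷ C s ∷ []
    C-SB =
      C s ∷ S B ∷ []                                     ≋⟨ at 2 (C-inverse′ s) ⟨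
      C s ∷ S B ∷ C s̄ ∷ C s ∷ []                         ≋⟨ at 0 SC-B ⟨
      S (C s̄) ∷ B ∷ C s ∷ []                             ■

  -- Elements as points `y •`

  C-sign : ∀ s t x y → C s · x · y ≡ C t · x · y
  C-sign ⊕ ⊕ x y = refl
  C-sign ⊕ ⊖ x y = C⁺≡C⁻ x y
  C-sign ⊖ ⊕ x y = sym (C⁺≡C⁻ x y)
  C-sign ⊖ ⊖ x y = refl

  B∘C· : ∀ s x → B ∘ (C s · x) ≡ C s · (C s ∘ S x)
  B∘C· s x = begin
    B ∘ (C s · x)                       ≡⟨ B-ax (S B) (C s) x ⟨
    (S B ∘ C s) · x                     ≡⟨ app-eq (BBC s) x ⟩
    (C s ∘ S (C s) ∘ B) · x             ≡⟨ B-ax (C s) (S (C s) ∘ B) x ⟩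
    C s · ((S (C s) ∘ B) · x)           ≡⟨ cong (C s ·_) (B-ax (S (C s)) B x) ⟩
    C s · (C s ∘ S x)                   ∎

  C··-∘ : ∀ s x y z → (C s · x · y) ∘ z ≡ C s · (x ∘ z) · y
  C··-∘ s x y z = begin
    (C s · x · y) ∘ z                   ≡⟨ app-eq (B-ax B (C s · x) y) z ⟨
    (B ∘ (C s · x)) · y · z             ≡⟨ cong (λ w → w · y · z) (B∘C· s x) ⟩
    C s · (C s ∘ S x) · y · z           ≡⟨ C-ax s (C s ∘ S x) y z ⟩
    (C s ∘ S x) · z · y                 ≡⟨ cong (_· y) (B-ax (C s) (S x) z) ⟩
    C s · (x ∘ z) · y                   ∎

  S∘C· : ∀ s b x → S b ∘ (C s · x) ≡ C s · (S b ∘ x)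
  S∘C· s b x = begin
    S b ∘ (C s · x)                     ≡⟨ B-ax (S (S b)) (C s) x ⟨
    (S (S b) ∘ C s) · x                 ≡⟨ app-eq (value (C-S² s)) x ⟨
    (C s ∘ S (S b)) · x                 ≡⟨ B-ax (C s) (S (S b)) x ⟩
    C s · (S b ∘ x)                     ∎

  ∘C·· : ∀ s b x y → b ∘ (C s · x · y) ≡ C s · (S b ∘ x) · y
  ∘C·· s b x y = trans (sym (B-ax (S b) (C s · x) y)) (app-eq (S∘C· s b x) y)

  •-∘ : ∀ s y z → y • ∘ z ≡ C s · z · y
  •-∘ s y z = begin
    (C ⊕ · I · y) ∘ z       ≡⟨ C··-∘ ⊕ I y z ⟩
    C ⊕ · (I ∘ z) · y       ≡⟨ cong (λ w → C ⊕ · w · y) (∘-identityˡ z) ⟩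
    C ⊕ · z · y             ≡⟨ C-sign ⊕ s z y ⟩
    C s · z · y             ∎

  •-· : ∀ y z → y • · z ≡ z · y
  •-· y z = trans (C-ax ⊕ I y z) (app-eq (I-ax z) y)

  •-S : ∀ {y b} → y • ∷ S b ∷ [] ≋ b ∷ y • ∷ []
  •-S {y} {b} = ⌊ (begin
    y • ∘ S b               ≡⟨ •-∘ ⊕ y (S b) ⟩
    C ⊕ · S b · y           ≡⟨ cong (λ w → C ⊕ · w · y) (∘-identityʳ (S b)) ⟨
    C ⊕ · (S b ∘ I) · y     ≡⟨ ∘C·· ⊕ b I y ⟨
    b ∘ (C ⊕ · I · y)       ∎) ⌋

  -- A strand that begins at a point slides out of a crossing of either sign; the sign is lost
  -- because `C⁺` and `C⁻` agree on two arguments.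
  •-C : ∀ s {y} → y • ∷ C s ∷ [] ≋ S (y •) ∷ []
  •-C s {y} = ⌊ (begin
    y • ∘ C s                     ≡⟨ •-∘ s y (C s) ⟩
    C s · C s · y                 ≡⟨ cong (λ w → C s · w · y) (∘-identityʳ (C s)) ⟨
    C s · (C s ∘ I) · y           ≡⟨ cong (λ w → C s · (C s ∘ w) · y) S-I ⟨
    C s · (C s ∘ S I) · y         ≡⟨ app-eq (B∘C· s I) y ⟨
    (B ∘ (C s · I)) · y           ≡⟨ B-ax B (C s · I) y ⟩
    S (C s · I · y)               ≡⟨ cong S (C-sign s ⊕ I y) ⟩
    S (y •)                       ∎) ⌋

  -- A point enters on the left of the strands already present, so the argument `z` has to be
  -- inserted before the function `y`.
  •-distrib-· : ∀ {y z} → (y · z) • ∷ [] ≋ z • ∷ y • ∷ B ∷ []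
  •-distrib-· {y} {z} = ⌊ (begin
    C ⊕ · I · (y · z)                            ≡⟨ B-ax (C ⊕ · I) y z ⟨
    (S (C ⊕ · I) · y) · z                        ≡⟨ cong (λ w → w · y · z) (B-ax B (C ⊕) I) ⟨
    (B ∘ C ⊕) · I · y · z                        ≡⟨ cong (λ w → w · I · y · z) (value (B-C ⊕)) ⟩
    (S (C ⊕) ∘ C ⊕ ∘ S B) · I · y · z            ≡⟨ cong (λ w → w · y · z) (B-ax (S (C ⊕)) (C ⊕ ∘ S B) I) ⟩
    (C ⊕ ∘ ((C ⊕ ∘ S B) · I)) · y · z            ≡⟨ cong (λ w → (C ⊕ ∘ w) · y · z) (B-ax (C ⊕) (S B) I) ⟩
    (C ⊕ ∘ (C ⊕ · (B ∘ I))) · y · z              ≡⟨ cong (λ w → (C ⊕ ∘ (C ⊕ · w)) · y · z) (∘-identityʳ B) ⟩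
    (C ⊕ ∘ (C ⊕ · B)) · y · z                    ≡⟨ cong (_· z) (B-ax (C ⊕) (C ⊕ · B) y) ⟩
    C ⊕ · (C ⊕ · B · y) · z                      ≡⟨ •-∘ ⊕ z (C ⊕ · B · y) ⟨
    z • ∘ (C ⊕ · B · y)                          ≡⟨ cong (z • ∘_) (•-∘ ⊕ y B) ⟨
    z • ∘ y • ∘ B                                ∎) ⌋

  -- Elements with an arity

  shift : ℕ → Carrier → Carrier
  shift zero    a = a
  shift (suc n) a = S (shift n a)

  B^-· : ∀ n a → (B ^ n) · a ≡ shift n a
  B^-· zero    a = I-ax a
  B^-· (suc n) a = trans (B-ax B (B ^ n) a) (cong S (B^-· n a))

  shift-I : ∀ n → shift n I ≡ I
  shift-I zero    = refl
  shift-I (suc n) = trans (cong S (shift-I n)) S-I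

  shift-∘ : ∀ n a b → shift n (a ∘ b) ≡ shift n a ∘ shift n b
  shift-∘ zero    a b = refl
  shift-∘ (suc n) a b = trans (cong S (shift-∘ n a b)) (S-∘ _ _)

  ⇑[_] : ∀ n {v w} → v ≋ w → map (shift n) v ≋ map (shift n) w
  ⇑[ n ] {v} {w} ⌊ e ⌋ = ⌊ trans (⟦⟧-shift v) (trans (cong (shift n) e) (sym (⟦⟧-shift w))) ⌋
    where
    ⟦⟧-shift : ∀ w → ⟦ map (shift n) w ⟧ ≡ shift n ⟦ w ⟧
    ⟦⟧-shift []      = sym (shift-I n)
    ⟦⟧-shift (x ∷ w) = begin
      ⟦ shift n x ∷ map (shift n) w ⟧      ≡⟨ ⟦⟧-∷ (shift n x) (map (shift n) w) ⟩
      shift n x ∘ ⟦ map (shift n) w ⟧      ≡⟨ cong (shift n x ∘_) (⟦⟧-shift w) ⟩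
      shift n x ∘ shift n ⟦ w ⟧            ≡⟨ shift-∘ n x ⟦ w ⟧ ⟨
      shift n (x ∘ ⟦ w ⟧)                  ≡⟨ cong (shift n) (⟦⟧-∷ x w) ⟨
      shift n ⟦ x ∷ w ⟧                    ∎

  shift-+ : ∀ m n a → shift (m + n) a ≡ shift m (shift n a)
  shift-+ zero    n a = refl
  shift-+ (suc m) n a = cong S (shift-+ m n a)

  B^-I : ∀ n → (B ^ n) · I ≡ I
  B^-I n = trans (B^-· n I) (shift-I n)

  ^-+ : ∀ a m n → a ^ (m + n) ≡ (a ^ m) ∘ (a ^ n)
  ^-+ a zero    n = sym (∘-identityˡ (a ^ n))
  ^-+ a (suc m) n = trans (cong (a ∘_) (^-+ a m n)) (sym (∘-assoc a (a ^ m) (a ^ n)))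

  infix 4 _∶_⇒_
  -- The proposition `HasArity` as an equation of words; the two sides evaluate definitionally to
  -- those of `HasArity`.
  record _∶_⇒_ (a : Carrier) (m n : ℕ) : Set where
    constructor ⌈_⌉
    field equation : a • ∷ B ∷ B ^ m ∷ [] ≋ S a ∷ B ^ n ∷ []
  open _∶_⇒_ public

  interchange : ∀ {a m n} → a ∶ m ⇒ n → ∀ b → a ∷ shift n b ∷ [] ≋ shift m b ∷ a ∷ []
  interchange {a} {m} {n} ⌈ ⌊ e ⌋ ⌉ b = ⌊ (begin
    a ∘ shift n b                  ≡⟨ cong (a ∘_) (B^-· n b) ⟨
    a ∘ ((B ^ n) · b)              ≡⟨ B-ax (S a) (B ^ n) b ⟨
    (S a ∘ (B ^ n)) · b            ≡⟨ app-eq e b ⟨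
    (a • ∘ (B ^ suc m)) · b        ≡⟨ B-ax (a •) (B ^ suc m) b ⟩
    a • · ((B ^ suc m) · b)        ≡⟨ •-· a _ ⟩
    (B ^ suc m) · b · a            ≡⟨ cong (_· a) (B^-· (suc m) b) ⟩
    shift m b ∘ a                  ∎) ⌋

  I•-B : I • ∷ B ∷ [] ≋ []
  I•-B = ⌊ trans (•-∘ ⊕ I B) (trans (CBI ⊕) S-I) ⌋

  •-B : ∀ s y → y • ∷ B ∷ [] ≋ C s · B · y ∷ []
  •-B s y = ⌊ •-∘ s y B ⌋

  I-arity : ∀ n → I ∶ n ⇒ n
  I-arity n = ⌈
    (I • ∷ B ∷ B ^ n ∷ []     ≋⟨ at 0 I•-B ⟩
     B ^ n ∷ []               ≋⟨ at 0 S-I-drop ⟨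
     S I ∷ B ^ n ∷ []         ■) ⌉

  B•-BBB : B • ∷ B ∷ B ∷ B ∷ [] ≋ S B ∷ B ∷ []
  B•-BBB =
    B • ∷ B ∷ B ∷ B ∷ []                ≋⟨ at 0 (•-B ⊕ B) ⟩
    C ⊕ · B · B ∷ B ∷ B ∷ []            ≋⟨ ⌊ CBB ⊕ ⌋ ⟩
    S B ∷ B ∷ []                        ■

  C•-BBB : ∀ s → C s • ∷ B ∷ B ∷ B ∷ [] ≋ S (C s) ∷ B ∷ B ∷ []
  C•-BBB s =
    C s • ∷ B ∷ B ∷ B ∷ []              ≋⟨ at 0 (•-B ⊕ (C s)) ⟩
    C ⊕ · B · C s ∷ B ∷ B ∷ []          ≋⟨ ⌊ CBC ⊕ s ⌋ ⟩
    S (C s) ∷ B ∷ B ∷ []                ■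

  S• : ∀ {a} → S a • ∷ [] ≋ a • ∷ B • ∷ B ∷ []
  S• = •-distrib-·

  -- The point of `a ∘ b` is built by application from those of `b`, `a` and `B`. The arity equation
  -- of `B` removes its point, after which those of `a` and `b` apply in turn.
  ∘-arity : ∀ {a b l m n} → a ∶ l ⇒ m → b ∶ m ⇒ n → a ∘ b ∶ l ⇒ n
  ∘-arity {a} {b} {l} {m} {n} ⌈ p ⌉ ⌈ q ⌉ = ⌈
    ((a ∘ b) • ∷ B ∷ B ^ l ∷ []                        ≋⟨ at 0 •-distrib-· ⟩
     b • ∷ S a • ∷ B ∷ B ∷ B ^ l ∷ []                  ≋⟨ at 1 S• ⟩
     b • ∷ a • ∷ B • ∷ B ∷ B ∷ B ∷ B ^ l ∷ []          ≋⟨ at 2 B•-BBB ⟩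
     b • ∷ a • ∷ S B ∷ B ∷ B ^ l ∷ []                  ≋⟨ at 1 •-S ⟩
     b • ∷ B ∷ a • ∷ B ∷ B ^ l ∷ []                    ≋⟨ at 2 p ⟩
     b • ∷ B ∷ S a ∷ B ^ m ∷ []                        ≋⟨ at 1 B-S′ ⟩
     b • ∷ S (S a) ∷ B ∷ B ^ m ∷ []                    ≋⟨ at 0 •-S ⟩
     S a ∷ b • ∷ B ∷ B ^ m ∷ []                        ≋⟨ at 1 q ⟩
     S a ∷ S b ∷ B ^ n ∷ []                            ≋⟨ at 0 S-fuse ⟩
     S (a ∘ b) ∷ B ^ n ∷ []                            ■) ⌉

  S-arity : ∀ {a m n} → a ∶ m ⇒ n → S a ∶ suc m ⇒ suc n
  S-arity {a} {m} {n} ⌈ p ⌉ = ⌈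
    (S a • ∷ B ∷ B ^ suc m ∷ []                        ≋⟨ at 0 S• ⟩
     a • ∷ B • ∷ B ∷ B ∷ B ^ suc m ∷ []                ≋⟨ at 4 ∘-fuse ⟨
     a • ∷ B • ∷ B ∷ B ∷ B ∷ B ^ m ∷ []                ≋⟨ at 1 B•-BBB ⟩
     a • ∷ S B ∷ B ∷ B ^ m ∷ []                        ≋⟨ at 0 •-S ⟩
     B ∷ a • ∷ B ∷ B ^ m ∷ []                          ≋⟨ at 1 p ⟩
     B ∷ S a ∷ B ^ n ∷ []                              ≋⟨ at 0 B-S′ ⟩
     S (S a) ∷ B ∷ B ^ n ∷ []                          ≋⟨ at 1 ∘-fuse ⟩
     S (S a) ∷ B ^ suc n ∷ []                          ■) ⌉

  shift-arity : ∀ k {a m n} → a ∶ m ⇒ n → shift k a ∶ k + m ⇒ k + n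
  shift-arity zero    p = p
  shift-arity (suc k) p = S-arity (shift-arity k p)

  weaken : ∀ k {a m n} → a ∶ m ⇒ n → a ∶ m + k ⇒ n + k
  weaken k {a} {m} {n} ⌈ p ⌉ = ⌈
    (a • ∷ B ∷ B ^ (m + k) ∷ []          ≋⟨ at 2 (atom (^-+ B m k)) ⟩
     a • ∷ B ∷ (B ^ m) ∘ (B ^ k) ∷ []    ≋⟨ at 2 ∘-fuse ⟨
     a • ∷ B ∷ B ^ m ∷ B ^ k ∷ []        ≋⟨ at 0 p ⟩
     S a ∷ B ^ n ∷ B ^ k ∷ []            ≋⟨ at 1 ∘-fuse ⟩
     S a ∷ (B ^ n) ∘ (B ^ k) ∷ []        ≋⟨ at 1 (atom (^-+ B n k)) ⟨
     S a ∷ B ^ (n + k) ∷ []              ■) ⌉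

  B² : B ∷ B ∷ [] ≋ B ^ 2 ∷ []
  B² = ⌊ cong (B ∘_) (sym (∘-identityʳ B)) ⌋

  B-arity : B ∶ 2 ⇒ 1
  B-arity = ⌈
    (B • ∷ B ∷ B ^ 2 ∷ []        ≋⟨ at 2 B² ⟨
     B • ∷ B ∷ B ∷ B ∷ []        ≋⟨ B•-BBB ⟩
     S B ∷ B ∷ []                ≋⟨ at 1 (atom (∘-identityʳ B)) ⟨
     S B ∷ B ^ 1 ∷ []            ■) ⌉

  C-arity : ∀ s → C s ∶ 2 ⇒ 2
  C-arity s = ⌈
    (C s • ∷ B ∷ B ^ 2 ∷ []      ≋⟨ at 2 B² ⟨
     C s • ∷ B ∷ B ∷ B ∷ []      ≋⟨ C•-BBB s ⟩
     S (C s) ∷ B ∷ B ∷ []        ≋⟨ at 1 B² ⟩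
     S (C s) ∷ B ^ 2 ∷ []        ■) ⌉

  θ-arity : ∀ s → θ s ∶ 1 ⇒ 1
  θ-arity s = ⌈
    (θ s • ∷ B ∷ B ^ 1 ∷ []      ≋⟨ at 0 (•-B ⊕ (θ s)) ⟩
     C ⊕ · B · θ s ∷ B ^ 1 ∷ []  ≋⟨ at 1 (atom (∘-identityʳ B)) ⟩
     C ⊕ · B · θ s ∷ B ∷ []      ≋⟨ ⌊ Bθ ⊕ s ⌋ ⟨
     S (θ s) ∷ B ∷ []            ≋⟨ at 1 (atom (∘-identityʳ B)) ⟨
     S (θ s) ∷ B ^ 1 ∷ []        ■) ⌉

  Tr•-BB : Tr • ∷ B ∷ B ∷ [] ≋ S Tr ∷ B ∷ B ∷ []
  Tr•-BB =
    Tr • ∷ B ∷ B ∷ []            ≋⟨ at 0 (•-B ⊕ Tr) ⟩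
    C ⊕ · B · Tr ∷ B ∷ []        ≋⟨ ⌊ CBTr ⊕ ⌋ ⟩
    S Tr ∷ B ^ 2 ∷ []            ≋⟨ at 1 B² ⟨
    S Tr ∷ B ∷ B ∷ []            ■

  Tr-arity : Tr ∶ 1 ⇒ 2
  Tr-arity = ⌈
    (Tr • ∷ B ∷ B ^ 1 ∷ []       ≋⟨ at 2 (atom (∘-identityʳ B)) ⟩
     Tr • ∷ B ∷ B ∷ []           ≋⟨ Tr•-BB ⟩
     S Tr ∷ B ∷ B ∷ []           ≋⟨ at 1 B² ⟩
     S Tr ∷ B ^ 2 ∷ []           ■) ⌉

  •-arity : ∀ y → y • ∶ 0 ⇒ 1
  •-arity y = ⌈
    (y • • ∷ B ∷ I ∷ []                               ≋⟨ at 0 •-distrib-· ⟩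
     y • ∷ (C ⊕ · I) • ∷ B ∷ B ∷ I ∷ []               ≋⟨ at 1 •-distrib-· ⟩
     y • ∷ I • ∷ C ⊕ • ∷ B ∷ B ∷ B ∷ I ∷ []           ≋⟨ at 2 (C•-BBB ⊕) ⟩
     y • ∷ I • ∷ S (C ⊕) ∷ B ∷ B ∷ I ∷ []             ≋⟨ at 1 •-S ⟩
     y • ∷ C ⊕ ∷ I • ∷ B ∷ B ∷ I ∷ []                 ≋⟨ at 2 I•-B ⟩
     y • ∷ C ⊕ ∷ B ∷ I ∷ []                           ≋⟨ at 0 (•-C ⊕) ⟩
     S (y •) ∷ B ∷ I ∷ []                             ≋⟨ at 1 ∘-fuse ⟩
     S (y •) ∷ B ^ 1 ∷ []                             ■) ⌉

  -- The operation f ↦ Tr · f closes the leftmost strand of f.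

  ∘-Tr· : ∀ a f → a ∘ Tr · f ≡ Tr · (S a ∘ f)
  ∘-Tr· a f = begin
    a ∘ Tr · f                     ≡⟨ B-ax (S a) Tr f ⟨
    (S a ∘ Tr) · f                 ≡⟨ app-eq (value Tr-S) f ⟨
    (Tr ∘ S (S a)) · f             ≡⟨ B-ax Tr (S (S a)) f ⟩
    Tr · (S a ∘ f)                 ∎

  -- Beta in trace form: the bound strand issued by `Tr` is handled by `f`, and `B` feeds the result
  -- back into it. It is the axiom `BTr` evaluated at `f`.
  S-Tr· : ∀ {f} → S (Tr · f) ∷ [] ≋ Tr ∷ S f ∷ B ∷ []
  S-Tr· {f} = ⌊ (begin
    S (Tr · f)                                   ≡⟨ B-ax B Tr f ⟨
    (B ∘ Tr) · f                                 ≡⟨ app-eq (BTr ⊕) f ⟨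
    (S Tr ∘ (C ⊕ · B · B) ∘ B) · f               ≡⟨ B-ax (S Tr) _ f ⟩
    Tr ∘ (((C ⊕ · B · B) ∘ B) · f)               ≡⟨ cong (Tr ∘_) (B-ax (C ⊕ · B · B) B f) ⟩
    Tr ∘ (C ⊕ · B · B · S f)                     ≡⟨ cong (Tr ∘_) (C-ax ⊕ B B (S f)) ⟩
    Tr ∘ S f ∘ B                                 ∎) ⌋

  Tr·-∘ : ∀ f g → Tr · f ∘ g ≡ Tr · (f ∘ S g)
  Tr·-∘ f g = begin
    S (Tr · f) · g                 ≡⟨ app-eq (value S-Tr·) g ⟩
    (Tr ∘ S f ∘ B) · g             ≡⟨ B-ax Tr (S f ∘ B) g ⟩
    Tr · ((S f ∘ B) · g)           ≡⟨ cong (Tr ·_) (B-ax (S f) B g) ⟩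
    Tr · (f ∘ S g)                 ∎

  Tr·-arity : ∀ {f m n} → f ∶ suc m ⇒ suc n → Tr · f ∶ m ⇒ n
  Tr·-arity {f} {m} {n} ⌈ p ⌉ = ⌈
    ((Tr · f) • ∷ B ∷ B ^ m ∷ []              ≋⟨ at 0 •-distrib-· ⟩
     f • ∷ Tr • ∷ B ∷ B ∷ B ^ m ∷ []          ≋⟨ at 1 Tr•-BB ⟩
     f • ∷ S Tr ∷ B ∷ B ∷ B ^ m ∷ []          ≋⟨ at 0 •-S ⟩
     Tr ∷ f • ∷ B ∷ B ∷ B ^ m ∷ []            ≋⟨ at 3 ∘-fuse ⟩
     Tr ∷ f • ∷ B ∷ B ^ suc m ∷ []            ≋⟨ at 1 p ⟩
     Tr ∷ S f ∷ B ^ suc n ∷ []                ≋⟨ at 2 ∘-fuse ⟨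
     Tr ∷ S f ∷ B ∷ B ^ n ∷ []                ≋⟨ at 0 S-Tr· ⟨
     S (Tr · f) ∷ B ^ n ∷ []                  ■) ⌉

  -- Evaluation at `I` and cancellation

  •-·I : ∀ y → y • · I ≡ y
  •-·I y = trans (•-· y I) (I-ax y)

  ∘B^-·I : ∀ p n → (p ∘ (B ^ n)) · I ≡ p · I
  ∘B^-·I p n = trans (B-ax p (B ^ n) I) (cong (p ·_) (B^-I n))

  -- Evaluation at `I` recovers `p`, because `(B ^ n) · I = I` and `S p · I = p ∘ I`. Both sides of
  -- an arity equation can be compared in this way.
  S-∘B^-cancel : ∀ {p q} n → S p ∘ (B ^ n) ≡ S q ∘ (B ^ n) → p ≡ q
  S-∘B^-cancel {p} {q} n e = begin
    p                     ≡⟨ ∘-identityʳ p ⟨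
    S p · I               ≡⟨ ∘B^-·I (S p) n ⟨
    (S p ∘ (B ^ n)) · I   ≡⟨ app-eq e I ⟩
    (S q ∘ (B ^ n)) · I   ≡⟨ ∘B^-·I (S q) n ⟩
    S q · I               ≡⟨ ∘-identityʳ q ⟩
    q                     ∎

  -- Functional completeness: a map into 1 is the m-fold application of one element, its closed form
  -- `p · I`. It comes from inserting the point `I •` into the arity equation, where `I • ∘ B`
  -- vanishes.
  name : ∀ {p m} → p ∶ m ⇒ 1 → (p · I) • ∷ B ^ m ∷ [] ≋ p ∷ []
  name {p} {m} ⌈ e ⌉ =
    (p · I) • ∷ B ^ m ∷ []            ≋⟨ at 0 •-distrib-· ⟩
    I • ∷ p • ∷ B ∷ B ^ m ∷ []        ≋⟨ at 1 e ⟩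
    I • ∷ S p ∷ B ^ 1 ∷ []            ≋⟨ at 2 (atom (∘-identityʳ B)) ⟩
    I • ∷ S p ∷ B ∷ []                ≋⟨ at 0 •-S ⟩
    p ∷ I • ∷ B ∷ []                  ≋⟨ at 1 I•-B ⟩
    p ∷ []                            ■

  ·I-injective : ∀ {p q m} → p ∶ m ⇒ 1 → q ∶ m ⇒ 1 → p · I ≡ q · I → p ≡ q
  ·I-injective {m = m} p⇒ q⇒ e =
    trans (sym (value (name p⇒))) (trans (cong (λ x → x • ∘ (B ^ m)) e) (value (name q⇒)))

  -- Since `B · I = I`, an appended `B` leaves the closed form unchanged. This gives an abstraction
  -- inside `p` an application to meet.
  ∘B-cancel : ∀ {p q m} → p ∶ m ⇒ 1 → q ∶ m ⇒ 1 → p ∷ B ∷ [] ≋ q ∷ B ∷ [] → p ≡ q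
  ∘B-cancel {p} {q} p⇒ q⇒ ⌊ e ⌋ = ·I-injective p⇒ q⇒ (begin
    p · I          ≡⟨ cong (p ·_) S-I ⟨
    p · (B · I)    ≡⟨ B-ax p B I ⟨
    (p ∘ B) · I    ≡⟨ app-eq e I ⟩
    (q ∘ B) · I    ≡⟨ B-ax q B I ⟩
    q · (B · I)    ≡⟨ cong (q ·_) S-I ⟩
    q · I          ∎)

  •-injective : ∀ {x y} → x • ≡ y • → x ≡ y
  •-injective {x} {y} e = trans (sym (•-·I x)) (trans (app-eq e I) (•-·I y))

  name-• : ∀ {y} → y ∶ 0 ⇒ 1 → (y · I) • ≡ y
  name-• {y} y⇒ = trans (sym (∘-identityʳ ((y · I) •))) (value (name y⇒))

  -- Braid

  C-injective : ∀ s {x y} → C s · x ≡ C s · y → x ≡ y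
  C-injective s {x} {y} e = begin
    x                              ≡⟨ C-cancel x ⟨
    C (opposite s) · (C s · x)     ≡⟨ cong (C (opposite s) ·_) e ⟩
    C (opposite s) · (C s · y)     ≡⟨ C-cancel y ⟩
    y                              ∎
    where
    C-cancel : ∀ z → C (opposite s) · (C s · z) ≡ z
    C-cancel z = trans (sym (B-ax _ (C s) z)) (trans (app-eq (value (C-inverse′ s)) z) (I-ax z))

  -- c s n moves one strand over n, d s n moves n strands over one.
  c d : Sign → ℕ → Carrier
  c s zero    = I
  c s (suc n) = C s ∘ S (c s n)
  d s zero    = I
  d s (suc n) = S (d s n) ∘ C s

  c-arity : ∀ s n → c s n ∶ suc n ⇒ suc n
  c-arity s zero    = I-arity 1
  c-arity s (suc n) = ∘-arity (weaken n (C-arity s)) (S-arity (c-arity s n))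

  d-arity : ∀ s n → d s n ∶ suc n ⇒ suc n
  d-arity s zero    = I-arity 1
  d-arity s (suc n) = ∘-arity (S-arity (d-arity s n)) (weaken n (C-arity s))

  c-d : ∀ s n → c s n ∷ d (opposite s) n ∷ [] ≋ []
  c-d s zero    = ⌊ ∘-identityˡ I ⌋
  c-d s (suc n) = let s̄ = opposite s in
    c s (suc n) ∷ d s̄ (suc n) ∷ []               ≋⟨ at 0 ∘-fuse ⟨
    C s ∷ S (c s n) ∷ d s̄ (suc n) ∷ []           ≋⟨ at 2 ∘-fuse ⟨
    C s ∷ S (c s n) ∷ S (d s̄ n) ∷ C s̄ ∷ []       ≋⟨ at 1 (⇑ (c-d s n)) ⟩
    C s ∷ C s̄ ∷ []                               ≋⟨ C-inverse s ⟩
    []                                           ■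

  c-d′ : ∀ s n → c (opposite s) n ∷ d s n ∷ [] ≋ []
  c-d′ ⊕ = c-d ⊖
  c-d′ ⊖ = c-d ⊕

  d-c : ∀ s n → d s n ∷ c (opposite s) n ∷ [] ≋ []
  d-c s zero    = ⌊ ∘-identityˡ I ⌋
  d-c s (suc n) = let s̄ = opposite s in
    d s (suc n) ∷ c s̄ (suc n) ∷ []               ≋⟨ at 0 ∘-fuse ⟨
    S (d s n) ∷ C s ∷ c s̄ (suc n) ∷ []           ≋⟨ at 2 ∘-fuse ⟨
    S (d s n) ∷ C s ∷ C s̄ ∷ S (c s̄ n) ∷ []       ≋⟨ at 1 (C-inverse s) ⟩
    S (d s n) ∷ S (c s̄ n) ∷ []                   ≋⟨ ⇑ (d-c s n) ⟩
    []                                           ■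

  d-c′ : ∀ s n → d (opposite s) n ∷ c s n ∷ [] ≋ []
  d-c′ ⊕ = d-c ⊖
  d-c′ ⊖ = d-c ⊕

  -- `C s · I` is the map sending y to `y •`. Evaluated at y, the equation says that `y •` followed
  -- by `c s n` is `shift n (y •)`: the point has slid past n strands.
  B^∘CI : ∀ s n → (B ^ n) ∘ (C s · I) ≡ C s · c s n
  B^∘CI s zero    = ∘-identityˡ (C s · I)
  B^∘CI s (suc n) = begin
    (B ∘ (B ^ n)) ∘ (C s · I)      ≡⟨ ∘-assoc B (B ^ n) (C s · I) ⟩
    B ∘ (B ^ n) ∘ (C s · I)        ≡⟨ cong (B ∘_) (B^∘CI s n) ⟩
    B ∘ (C s · c s n)              ≡⟨ B∘C· s (c s n) ⟩
    C s · (C s ∘ S (c s n))        ∎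

  -- Composing the arity equation of a with C s · I abstracts the
  -- interchange of a with an arbitrary y • into an equation about a alone.
  c-natural : ∀ s {a m n} → a ∶ m ⇒ n → S a ∷ c s n ∷ [] ≋ c s m ∷ a ∷ []
  c-natural s {a} {m} {n} ⌈ ⌊ e ⌋ ⌉ = let s̄ = opposite s in ⌊ C-injective s (begin
    C s · (S a ∘ c s n)                       ≡⟨ S∘C· s a (c s n) ⟨
    S a ∘ (C s · c s n)                       ≡⟨ cong (S a ∘_) (B^∘CI s n) ⟨
    S a ∘ (B ^ n) ∘ (C s · I)                 ≡⟨ ∘-assoc (S a) (B ^ n) (C s · I) ⟨
    (S a ∘ (B ^ n)) ∘ (C s · I)               ≡⟨ cong (_∘ (C s · I)) e ⟨
    (a • ∘ (B ^ suc m)) ∘ (C s · I)           ≡⟨ ∘-assoc (a •) (B ^ suc m) (C s · I) ⟩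
    a • ∘ (B ^ suc m) ∘ (C s · I)             ≡⟨ cong (a • ∘_) (B^∘CI s (suc m)) ⟩
    a • ∘ (C s · c s (suc m))                 ≡⟨ •-∘ s̄ a _ ⟩
    C s̄ · (C s · c s (suc m)) · a             ≡⟨ app-eq (B-ax (C s̄) (C s) _) a ⟨
    (C s̄ ∘ C s) · c s (suc m) · a             ≡⟨ cong (λ w → w · c s (suc m) · a) (value (C-inverse′ s)) ⟩
    I · c s (suc m) · a                       ≡⟨ app-eq (I-ax (c s (suc m))) a ⟩
    (C s ∘ S (c s m)) · a                     ≡⟨ B-ax (C s) (S (c s m)) a ⟩
    C s · (c s m ∘ a)                         ∎) ⌋

  d-natural : ∀ s {a m n} → a ∶ m ⇒ n → a ∷ d s n ∷ [] ≋ d s m ∷ S a ∷ []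
  d-natural s {a} {m} {n} a⇒ = let s̄ = opposite s in
    a ∷ d s n ∷ []                            ≋⟨ at 0 (d-c s m) ⟨
    d s m ∷ c s̄ m ∷ a ∷ d s n ∷ []            ≋⟨ at 1 (c-natural s̄ a⇒) ⟨
    d s m ∷ S a ∷ c s̄ n ∷ d s n ∷ []          ≋⟨ at 2 (c-d′ s n) ⟩
    d s m ∷ S a ∷ []                          ■

  br : Sign → ℕ → ℕ → Carrier
  br s m zero    = I
  br s m (suc n) = d s m ∘ S (br s m n)

  br-arity : ∀ s m n → br s m n ∶ n + m ⇒ n + m
  br-arity s m zero    = I-arity m
  br-arity s m (suc n) =
    ∘-arity (subst (λ k → d s m ∶ suc k ⇒ suc k) (+-comm m n) (weaken n (d-arity s m)))
            (S-arity (br-arity s m n))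

  br-0 : ∀ s n → br s 0 n ∷ [] ≋ []
  br-0 s zero    = I-drop
  br-0 s (suc n) =
    br s 0 (suc n) ∷ []            ≋⟨ at 0 ∘-fuse ⟨
    I ∷ S (br s 0 n) ∷ []          ≋⟨ at 0 I-drop ⟩
    S (br s 0 n) ∷ []              ≋⟨ ⇑ (br-0 s n) ⟩
    []                             ■

  -- The definition of `br` peels off one of the n strands at a time; this is the other recursion,
  -- which peels off one of the m.
  br-suc : ∀ s m n → br s (suc m) n ∷ [] ≋ S (br s m n) ∷ c s n ∷ []
  br-suc s m zero    =
    I ∷ []           ≋⟨ at 0 S-I-drop ⟨
    S I ∷ I ∷ []     ■
  br-suc s m (suc n) =
    br s (suc m) (suc n) ∷ []                                    ≋⟨ at 0 ∘-fuse ⟨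
    d s (suc m) ∷ S (br s (suc m) n) ∷ []                        ≋⟨ at 0 ∘-fuse ⟨
    S (d s m) ∷ C s ∷ S (br s (suc m) n) ∷ []                    ≋⟨ at 2 (⇑ (br-suc s m n)) ⟩
    S (d s m) ∷ C s ∷ S (S (br s m n)) ∷ S (c s n) ∷ []          ≋⟨ at 1 (C-S² s) ⟩
    S (d s m) ∷ S (S (br s m n)) ∷ C s ∷ S (c s n) ∷ []          ≋⟨ at 0 S-fuse ⟩
    S (br s m (suc n)) ∷ C s ∷ S (c s n) ∷ []                    ≋⟨ at 1 ∘-fuse ⟩
    S (br s m (suc n)) ∷ c s (suc n) ∷ []                        ■

  br-1ˡ : ∀ s n → br s 1 n ∷ [] ≋ c s n ∷ []
  br-1ˡ s n =
    br s 1 n ∷ []                  ≋⟨ br-suc s 0 n ⟩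
    S (br s 0 n) ∷ c s n ∷ []      ≋⟨ at 0 (⇑ (br-0 s n)) ⟩
    c s n ∷ []                     ■

  br-1ʳ : ∀ s n → br s n 1 ∷ [] ≋ d s n ∷ []
  br-1ʳ s n =
    br s n 1 ∷ []                  ≋⟨ at 0 ∘-fuse ⟨
    d s n ∷ S I ∷ []               ≋⟨ at 1 S-I-drop ⟩
    d s n ∷ []                     ■

  br-+ˡ : ∀ s a b n → br s (a + b) n ∷ [] ≋ shift a (br s b n) ∷ br s a n ∷ []
  br-+ˡ s zero    b n = at 1 (≋-sym (br-0 s n))
  br-+ˡ s (suc a) b n =
    br s (suc a + b) n ∷ []                                  ≋⟨ br-suc s (a + b) n ⟩
    S (br s (a + b) n) ∷ c s n ∷ []                          ≋⟨ at 0 (⇑ (br-+ˡ s a b n)) ⟩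
    S (shift a (br s b n)) ∷ S (br s a n) ∷ c s n ∷ []       ≋⟨ at 1 (br-suc s a n) ⟨
    S (shift a (br s b n)) ∷ br s (suc a) n ∷ []             ■

  br-+ʳ : ∀ s m a b → br s m (a + b) ∷ [] ≋ br s m a ∷ shift a (br s m b) ∷ []
  br-+ʳ s m zero    b = at 0 (≋-sym I-drop)
  br-+ʳ s m (suc a) b =
    br s m (suc a + b) ∷ []                                  ≋⟨ at 0 ∘-fuse ⟨
    d s m ∷ S (br s m (a + b)) ∷ []                          ≋⟨ at 1 (⇑ (br-+ʳ s m a b)) ⟩
    d s m ∷ S (br s m a) ∷ S (shift a (br s m b)) ∷ []       ≋⟨ at 0 ∘-fuse ⟩
    br s m (suc a) ∷ S (shift a (br s m b)) ∷ []             ■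

  br-inverse : ∀ s m n → br s m n ∷ br (opposite s) n m ∷ [] ≋ []
  br-inverse s m zero    =
    I ∷ br (opposite s) 0 m ∷ []         ≋⟨ at 0 I-drop ⟩
    br (opposite s) 0 m ∷ []             ≋⟨ br-0 (opposite s) m ⟩
    []                                   ■
  br-inverse s m (suc n) = let s̄ = opposite s in
    br s m (suc n) ∷ br s̄ (suc n) m ∷ []                     ≋⟨ at 0 ∘-fuse ⟨
    d s m ∷ S (br s m n) ∷ br s̄ (suc n) m ∷ []               ≋⟨ at 2 (br-suc s̄ n m) ⟩
    d s m ∷ S (br s m n) ∷ S (br s̄ n m) ∷ c s̄ m ∷ []         ≋⟨ at 1 (⇑ (br-inverse s m n)) ⟩
    d s m ∷ c s̄ m ∷ []                                       ≋⟨ d-c s m ⟩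
    []                                                       ■

  br-naturalˡ : ∀ s k {a m n} → a ∶ m ⇒ n → a ∷ br s n k ∷ [] ≋ br s m k ∷ shift k a ∷ []
  br-naturalˡ s zero    {a} a⇒ =
    a ∷ I ∷ []       ≋⟨ at 1 I-drop ⟩
    a ∷ []           ≋⟨ at 0 I-drop ⟨
    I ∷ a ∷ []       ■
  br-naturalˡ s (suc k) {a} {m} {n} a⇒ =
    a ∷ br s n (suc k) ∷ []                      ≋⟨ at 1 ∘-fuse ⟨
    a ∷ d s n ∷ S (br s n k) ∷ []                ≋⟨ at 0 (d-natural s a⇒) ⟩
    d s m ∷ S a ∷ S (br s n k) ∷ []              ≋⟨ at 1 (⇑ (br-naturalˡ s k a⇒)) ⟩
    d s m ∷ S (br s m k) ∷ S (shift k a) ∷ []    ≋⟨ at 0 ∘-fuse ⟩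
    br s m (suc k) ∷ S (shift k a) ∷ []          ■

  br-naturalʳ : ∀ s k {a m n} → a ∶ m ⇒ n → shift k a ∷ br s k n ∷ [] ≋ br s k m ∷ a ∷ []
  br-naturalʳ s zero    {a} {m} {n} a⇒ =
    a ∷ br s 0 n ∷ []          ≋⟨ at 1 (br-0 s n) ⟩
    a ∷ []                     ≋⟨ at 0 (br-0 s m) ⟨
    br s 0 m ∷ a ∷ []          ■
  br-naturalʳ s (suc k) {a} {m} {n} a⇒ =
    S (shift k a) ∷ br s (suc k) n ∷ []          ≋⟨ at 1 (br-suc s k n) ⟩
    S (shift k a) ∷ S (br s k n) ∷ c s n ∷ []    ≋⟨ at 0 (⇑ (br-naturalʳ s k a⇒)) ⟩
    S (br s k m) ∷ S a ∷ c s n ∷ []              ≋⟨ at 1 (c-natural s a⇒) ⟩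
    S (br s k m) ∷ c s m ∷ a ∷ []                ≋⟨ at 0 (br-suc s k m) ⟨
    br s (suc k) m ∷ a ∷ []                      ■

  br-d : ∀ s a b → br s a b ∷ shift b (d s a) ∷ [] ≋ br s a (suc b) ∷ []
  br-d s a zero    =
    I ∷ d s a ∷ []                               ≋⟨ at 0 I-drop ⟩
    d s a ∷ []                                   ≋⟨ at 1 S-I-drop ⟨
    d s a ∷ S I ∷ []                             ≋⟨ ∘-fuse ⟩
    br s a 1 ∷ []                                ■
  br-d s a (suc b) =
    br s a (suc b) ∷ S (shift b (d s a)) ∷ []    ≋⟨ at 0 ∘-fuse ⟨
    d s a ∷ S (br s a b) ∷ S (shift b (d s a)) ∷ []  ≋⟨ at 1 (⇑ (br-d s a b)) ⟩
    d s a ∷ S (br s a (suc b)) ∷ []              ≋⟨ ∘-fuse ⟩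
    br s a (suc (suc b)) ∷ []                    ■

  c-br : ∀ s a b → shift b (c s a) ∷ br s b a ∷ [] ≋ br s (suc b) a ∷ []
  c-br s a zero    =
    c s a ∷ br s 0 a ∷ []                        ≋⟨ at 1 (br-0 s a) ⟩
    c s a ∷ []                                   ≋⟨ br-1ˡ s a ⟨
    br s 1 a ∷ []                                ■
  c-br s a (suc b) =
    S (shift b (c s a)) ∷ br s (suc b) a ∷ []            ≋⟨ at 1 (br-suc s b a) ⟩
    S (shift b (c s a)) ∷ S (br s b a) ∷ c s a ∷ []      ≋⟨ at 0 (⇑ (c-br s a b)) ⟩
    S (br s (suc b) a) ∷ c s a ∷ []                      ≋⟨ br-suc s (suc b) a ⟨
    br s (suc (suc b)) a ∷ []                            ■

  c-+ : ∀ s a b → c s (a + b) ∷ [] ≋ c s a ∷ shift a (c s b) ∷ []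
  c-+ s zero    b = at 0 (≋-sym I-drop)
  c-+ s (suc a) b =
    c s (suc a + b) ∷ []                             ≋⟨ ∘-fuse ⟨
    C s ∷ S (c s (a + b)) ∷ []                       ≋⟨ at 1 (⇑ (c-+ s a b)) ⟩
    C s ∷ S (c s a) ∷ S (shift a (c s b)) ∷ []       ≋⟨ at 0 ∘-fuse ⟩
    c s (suc a) ∷ S (shift a (c s b)) ∷ []           ■

  d-+ : ∀ s a b → d s (a + b) ∷ [] ≋ shift a (d s b) ∷ d s a ∷ []
  d-+ s zero    b = at 1 (≋-sym I-drop)
  d-+ s (suc a) b =
    d s (suc a + b) ∷ []                             ≋⟨ ∘-fuse ⟨
    S (d s (a + b)) ∷ C s ∷ []                       ≋⟨ at 0 (⇑ (d-+ s a b)) ⟩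
    S (shift a (d s b)) ∷ S (d s a) ∷ C s ∷ []       ≋⟨ at 1 ∘-fuse ⟩
    S (shift a (d s b)) ∷ d s (suc a) ∷ []           ■

  -- Twist

  tw : Sign → ℕ → Carrier
  tw s zero    = I
  tw s (suc n) = θ s ∘ c s n ∘ tw s n ∘ d s n

  tw-suc : ∀ s n → tw s (suc n) ∷ [] ≋ θ s ∷ c s n ∷ tw s n ∷ d s n ∷ []
  tw-suc s n = ⌊ refl ⌋

  tw-arity : ∀ s n → tw s n ∶ n ⇒ n
  tw-arity s zero    = I-arity 0
  tw-arity s (suc n) =
    ∘-arity (weaken n (θ-arity s)) (∘-arity (c-arity s n)
      (∘-arity (subst (λ k → tw s n ∶ k ⇒ k) (+-comm n 1) (weaken 1 (tw-arity s n)))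
               (d-arity s n)))

  -- Induction on `a`, with the twist unfolded around the first strand. The induction hypothesis
  -- lands between the split halves of `c s (a + b)` and `d s (a + b)`; `pass-c` and `pass-d`
  -- assemble them with its braids into crossings of `suc a` strands. The block moves left over
  -- cancel in pairs, and interchange separates the two twists.
  tw-+ : ∀ s a b → tw s (a + b) ∷ [] ≋ br s a b ∷ tw s b ∷ shift b (tw s a) ∷ br s b a ∷ []
  tw-+ s zero    b =
    tw s b ∷ []                                              ≋⟨ at 0 (br-0 s b) ⟨
    br s 0 b ∷ tw s b ∷ []                                   ≋⟨ at 2 (⇑[ b ] I-drop) ⟨
    br s 0 b ∷ tw s b ∷ shift b I ∷ []                       ≋⟨ at 3 I-drop ⟨
    br s 0 b ∷ tw s b ∷ shift b I ∷ I ∷ []                   ■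
  tw-+ s (suc a) b =
    tw s (suc a + b) ∷ []
      ≋⟨ tw-suc s (a + b) ⟩
    θ s ∷ c s (a + b) ∷ tw s (a + b) ∷ d s (a + b) ∷ []
      ≋⟨ at 1 (c-+ s a b) ⟩
    θ s ∷ c s a ∷ ↑ (c s b) ∷ tw s (a + b) ∷ d s (a + b) ∷ []
      ≋⟨ at 3 (tw-+ s a b) ⟩
    θ s ∷ c s a ∷ ↑ (c s b) ∷ br s a b ∷ tw s b ∷ ⇈ (tw s a) ∷ br s b a ∷ d s (a + b) ∷ []
      ≋⟨ at 7 (d-+ s a b) ⟩
    θ s ∷ c s a ∷ ↑ (c s b) ∷ br s a b ∷ tw s b ∷ ⇈ (tw s a) ∷ br s b a ∷ ↑ (d s b) ∷ d s a ∷ []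
      ≋⟨ at 6 pass-d ⟩
    θ s ∷ c s a ∷ ↑ (c s b) ∷ br s a b ∷ tw s b ∷ ⇈ (tw s a) ∷ ⇈ (d s̄ a) ∷ br s b (suc a) ∷ c s a ∷ d s a ∷ []
      ≋⟨ at 2 pass-c ⟩
    θ s ∷ c s a ∷ d s a ∷ br s (suc a) b ∷ ⇈ (c s̄ a) ∷ tw s b ∷ ⇈ (tw s a) ∷ ⇈ (d s̄ a) ∷ br s b (suc a) ∷ c s a ∷ d s a ∷ []
      ≋⟨ at 2 (br-naturalˡ s b (d-arity s a)) ⟩
    θ s ∷ c s a ∷ br s (suc a) b ∷ ⇈ (d s a) ∷ ⇈ (c s̄ a) ∷ tw s b ∷ ⇈ (tw s a) ∷ ⇈ (d s̄ a) ∷ br s b (suc a) ∷ c s a ∷ d s a ∷ []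
      ≋⟨ at 3 (⇑[ b ] (d-c s a)) ⟩
    θ s ∷ c s a ∷ br s (suc a) b ∷ tw s b ∷ ⇈ (tw s a) ∷ ⇈ (d s̄ a) ∷ br s b (suc a) ∷ c s a ∷ d s a ∷ []
      ≋⟨ at 6 (br-naturalʳ s b (c-arity s a)) ⟨
    θ s ∷ c s a ∷ br s (suc a) b ∷ tw s b ∷ ⇈ (tw s a) ∷ ⇈ (d s̄ a) ∷ ⇈ (c s a) ∷ br s b (suc a) ∷ d s a ∷ []
      ≋⟨ at 5 (⇑[ b ] (d-c′ s a)) ⟩
    θ s ∷ c s a ∷ br s (suc a) b ∷ tw s b ∷ ⇈ (tw s a) ∷ br s b (suc a) ∷ d s a ∷ []
      ≋⟨ at 5 (br-naturalʳ s b (d-arity s a)) ⟨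
    θ s ∷ c s a ∷ br s (suc a) b ∷ tw s b ∷ ⇈ (tw s a) ∷ ⇈ (d s a) ∷ br s b (suc a) ∷ []
      ≋⟨ at 1 (br-naturalˡ s b (c-arity s a)) ⟩
    θ s ∷ br s (suc a) b ∷ ⇈ (c s a) ∷ tw s b ∷ ⇈ (tw s a) ∷ ⇈ (d s a) ∷ br s b (suc a) ∷ []
      ≋⟨ at 0 (br-naturalˡ s b (weaken a (θ-arity s))) ⟩
    br s (suc a) b ∷ ⇈ (θ s) ∷ ⇈ (c s a) ∷ tw s b ∷ ⇈ (tw s a) ∷ ⇈ (d s a) ∷ br s b (suc a) ∷ []
      ≋⟨ at 2 (interchange (tw-arity s b) (c s a)) ⟨
    br s (suc a) b ∷ ⇈ (θ s) ∷ tw s b ∷ ⇈ (c s a) ∷ ⇈ (tw s a) ∷ ⇈ (d s a) ∷ br s b (suc a) ∷ []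
      ≋⟨ at 1 (interchange (tw-arity s b) (θ s)) ⟨
    br s (suc a) b ∷ tw s b ∷ ⇈ (θ s) ∷ ⇈ (c s a) ∷ ⇈ (tw s a) ∷ ⇈ (d s a) ∷ br s b (suc a) ∷ []
      ≋⟨ at 2 (⇑[ b ] (tw-suc s a)) ⟨
    br s (suc a) b ∷ tw s b ∷ ⇈ (tw s (suc a)) ∷ br s b (suc a) ∷ []
      ■
    where
    s̄ = opposite s
    ↑ ⇈ : Carrier → Carrier
    ↑ = shift a
    ⇈ = shift b
    -- By `br-suc` the larger braid appears only when the single-strand move `c s b` stands behind
    -- `S (br s a b)`. The inserted pair `d s a`, `c s̄ a` permits this change of order.
    pass-c : ↑ (c s b) ∷ br s a b ∷ [] ≋ d s a ∷ br s (suc a) b ∷ ⇈ (c s̄ a) ∷ []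
    pass-c =
      ↑ (c s b) ∷ br s a b ∷ []                                ≋⟨ at 2 (⇑[ b ] (d-c s a)) ⟨
      ↑ (c s b) ∷ br s a b ∷ ⇈ (d s a) ∷ ⇈ (c s̄ a) ∷ []        ≋⟨ at 1 (br-d s a b) ⟩
      ↑ (c s b) ∷ br s a (suc b) ∷ ⇈ (c s̄ a) ∷ []              ≋⟨ at 0 (br-naturalʳ s a (c-arity s b)) ⟩
      br s a (suc b) ∷ c s b ∷ ⇈ (c s̄ a) ∷ []                  ≋⟨ at 0 ∘-fuse ⟨
      d s a ∷ S (br s a b) ∷ c s b ∷ ⇈ (c s̄ a) ∷ []            ≋⟨ at 1 (br-suc s a b) ⟨
      d s a ∷ br s (suc a) b ∷ ⇈ (c s̄ a) ∷ []                  ■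
    pass-d : br s b a ∷ ↑ (d s b) ∷ [] ≋ ⇈ (d s̄ a) ∷ br s b (suc a) ∷ c s a ∷ []
    pass-d =
      br s b a ∷ ↑ (d s b) ∷ []                                ≋⟨ at 0 (⇑[ b ] (d-c′ s a)) ⟨
      ⇈ (d s̄ a) ∷ ⇈ (c s a) ∷ br s b a ∷ ↑ (d s b) ∷ []        ≋⟨ at 1 (c-br s a b) ⟩
      ⇈ (d s̄ a) ∷ br s (suc b) a ∷ ↑ (d s b) ∷ []              ≋⟨ at 1 (br-naturalˡ s a (d-arity s b)) ⟨
      ⇈ (d s̄ a) ∷ d s b ∷ br s (suc b) a ∷ []                  ≋⟨ at 2 (br-suc s b a) ⟩
      ⇈ (d s̄ a) ∷ d s b ∷ S (br s b a) ∷ c s a ∷ []            ≋⟨ at 1 ∘-fuse ⟩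
      ⇈ (d s̄ a) ∷ br s b (suc a) ∷ c s a ∷ []                  ■

  tw-1 : ∀ s → tw s 1 ∷ [] ≋ θ s ∷ []
  tw-1 s =
    tw s 1 ∷ []                    ≋⟨ tw-suc s 0 ⟩
    θ s ∷ I ∷ I ∷ I ∷ []           ≋⟨ at 1 I-drop ⟩
    θ s ∷ I ∷ I ∷ []               ≋⟨ at 1 I-drop ⟩
    θ s ∷ I ∷ []                   ≋⟨ at 1 I-drop ⟩
    θ s ∷ []                       ■

  c-1 : ∀ s → c s 1 ∷ [] ≋ C s ∷ []
  c-1 s =
    c s 1 ∷ []                     ≋⟨ ∘-fuse ⟨
    C s ∷ S I ∷ []                 ≋⟨ at 1 S-I-drop ⟩
    C s ∷ []                       ■

  d-1 : ∀ s → d s 1 ∷ [] ≋ C s ∷ []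
  d-1 s =
    d s 1 ∷ []                     ≋⟨ ∘-fuse ⟨
    S I ∷ C s ∷ []                 ≋⟨ at 0 S-I-drop ⟩
    C s ∷ []                       ■

  tw-2 : ∀ s → tw s 2 ∷ [] ≋ θ s ∷ C s ∷ θ s ∷ C s ∷ []
  tw-2 s =
    tw s 2 ∷ []                          ≋⟨ tw-suc s 1 ⟩
    θ s ∷ c s 1 ∷ tw s 1 ∷ d s 1 ∷ []    ≋⟨ at 1 (c-1 s) ⟩
    θ s ∷ C s ∷ tw s 1 ∷ d s 1 ∷ []      ≋⟨ at 2 (tw-1 s) ⟩
    θ s ∷ C s ∷ θ s ∷ d s 1 ∷ []         ≋⟨ at 3 (d-1 s) ⟩
    θ s ∷ C s ∷ θ s ∷ C s ∷ []           ■

  B-θ : ∀ s → B ∷ θ s ∷ [] ≋ θ s ∷ C s ∷ θ s ∷ C s ∷ B ∷ []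
  B-θ s = ⌊ Bθ-twist s ⌋

  -- The axiom `Bθ-twist` is the case `m = 0`. The other m strands are carried past `B` by
  -- naturality of the braid, and `tw-+` puts the twist of all strands together again.
  B-tw : ∀ s m → B ∷ tw s (suc m) ∷ [] ≋ tw s (suc (suc m)) ∷ B ∷ []
  B-tw s m =
    B ∷ tw s (suc m) ∷ []                                    ≋⟨ at 1 (tw-suc s m) ⟩
    B ∷ θ s ∷ c s m ∷ tw s m ∷ d s m ∷ []                    ≋⟨ at 0 (B-θ s) ⟩
    θ s ∷ C s ∷ θ s ∷ C s ∷ B ∷ c s m ∷ tw s m ∷ d s m ∷ []  ≋⟨ at 0 (tw-2 s) ⟨
    tw s 2 ∷ B ∷ c s m ∷ tw s m ∷ d s m ∷ []                 ≋⟨ at 2 (br-1ˡ s m) ⟨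
    tw s 2 ∷ B ∷ br s 1 m ∷ tw s m ∷ d s m ∷ []              ≋⟨ at 1 (br-naturalˡ s m B-arity) ⟩
    tw s 2 ∷ br s 2 m ∷ shift m B ∷ tw s m ∷ d s m ∷ []      ≋⟨ at 2 (interchange (tw-arity s m) B) ⟨
    tw s 2 ∷ br s 2 m ∷ tw s m ∷ shift m B ∷ d s m ∷ []      ≋⟨ at 4 (br-1ʳ s m) ⟨
    tw s 2 ∷ br s 2 m ∷ tw s m ∷ shift m B ∷ br s m 1 ∷ []   ≋⟨ at 3 (br-naturalʳ s m B-arity) ⟩
    tw s 2 ∷ br s 2 m ∷ tw s m ∷ br s m 2 ∷ B ∷ []           ≋⟨ at 0 (br-naturalˡ s m (tw-arity s 2)) ⟩
    br s 2 m ∷ shift m (tw s 2) ∷ tw s m ∷ br s m 2 ∷ B ∷ [] ≋⟨ at 1 (interchange (tw-arity s m) (tw s 2)) ⟨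
    br s 2 m ∷ tw s m ∷ shift m (tw s 2) ∷ br s m 2 ∷ B ∷ [] ≋⟨ at 0 (tw-+ s 2 m) ⟨
    tw s (suc (suc m)) ∷ B ∷ []                              ■

  B^-θ : ∀ s m → B ^ m ∷ θ s ∷ [] ≋ tw s (suc m) ∷ B ^ m ∷ []
  B^-θ s zero =
    I ∷ θ s ∷ []                               ≋⟨ at 0 I-drop ⟩
    θ s ∷ []                                   ≋⟨ tw-1 s ⟨
    tw s 1 ∷ []                                ≋⟨ at 1 I-drop ⟨
    tw s 1 ∷ I ∷ []                            ■
  B^-θ s (suc m) =
    B ^ suc m ∷ θ s ∷ []                       ≋⟨ at 0 ∘-fuse ⟨
    B ∷ B ^ m ∷ θ s ∷ []                       ≋⟨ at 1 (B^-θ s m) ⟩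
    B ∷ tw s (suc m) ∷ B ^ m ∷ []              ≋⟨ at 0 (B-tw s m) ⟩
    tw s (suc (suc m)) ∷ B ∷ B ^ m ∷ []        ≋⟨ at 1 ∘-fuse ⟩
    tw s (suc (suc m)) ∷ B ^ suc m ∷ []        ■

  •-θ : ∀ s {y} → y • ∷ θ s ∷ [] ≋ y • ∷ []
  •-θ s {y} = ⌊ trans (•-∘ ⊕ y (θ s)) (Cθ ⊕ s y) ⌋

  -- A strand that begins at a point loses its own twist by the axiom `Cθ` and slips out of the
  -- braiding around the other k strands.
  •-tw : ∀ s k {y} → y • ∷ tw s (suc k) ∷ [] ≋ tw s k ∷ y • ∷ []
  •-tw s k {y} =
    y • ∷ tw s (suc k) ∷ []                            ≋⟨ at 1 (tw-suc s k) ⟩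
    y • ∷ θ s ∷ c s k ∷ tw s k ∷ d s k ∷ []            ≋⟨ at 0 (•-θ s) ⟩
    y • ∷ c s k ∷ tw s k ∷ d s k ∷ []                  ≋⟨ at 1 (br-1ˡ s k) ⟨
    y • ∷ br s 1 k ∷ tw s k ∷ d s k ∷ []               ≋⟨ at 0 (br-naturalˡ s k (•-arity y)) ⟩
    br s 0 k ∷ shift k (y •) ∷ tw s k ∷ d s k ∷ []     ≋⟨ at 0 (br-0 s k) ⟩
    shift k (y •) ∷ tw s k ∷ d s k ∷ []                ≋⟨ at 0 (interchange (tw-arity s k) (y •)) ⟨
    tw s k ∷ shift k (y •) ∷ d s k ∷ []                ≋⟨ at 2 (br-1ʳ s k) ⟨
    tw s k ∷ shift k (y •) ∷ br s k 1 ∷ []             ≋⟨ at 1 (br-naturalʳ s k (•-arity y)) ⟩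
    tw s k ∷ I ∷ y • ∷ []                              ≋⟨ at 1 I-drop ⟩
    tw s k ∷ y • ∷ []                                  ■

  -- The twist commutes with every piece of the arity equation: with the powers of `B`, and with the
  -- point `a •`, which drops one strand. Hence `central`, which is naturality for `S a` followed by
  -- `B ^ n`. The inserted trivial word completes `S (tw s n)` to `tw s (suc n)`, so that `central`
  -- applies; afterwards the extra strand is unwound and evaluation at `I` removes `S` and `B ^ n`.
  tw-natural : ∀ s {a m n} → a ∶ m ⇒ n → a ∷ tw s n ∷ [] ≋ tw s m ∷ a ∷ []
  tw-natural s {a} {m} {n} a⇒@(⌈ e ⌉) = ⌊ S-∘B^-cancel n (value
    (S (a ∘ tw s n) ∷ B ^ n ∷ []                                                         ≋⟨ at 0 S-fuse ⟨
     S a ∷ S (tw s n) ∷ B ^ n ∷ []                                                       ≋⟨ at 0 (twist-cancel m) ⟨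
     c s̄ m ∷ d s̄ m ∷ θ s̄ ∷ θ s ∷ c s m ∷ d s m ∷ S a ∷ S (tw s n) ∷ B ^ n ∷ []           ≋⟨ at 5 (d-natural s a⇒) ⟨
     c s̄ m ∷ d s̄ m ∷ θ s̄ ∷ θ s ∷ c s m ∷ a ∷ d s n ∷ S (tw s n) ∷ B ^ n ∷ []             ≋⟨ at 4 (c-natural s a⇒) ⟨
     c s̄ m ∷ d s̄ m ∷ θ s̄ ∷ θ s ∷ S a ∷ c s n ∷ d s n ∷ S (tw s n) ∷ B ^ n ∷ []           ≋⟨ at 3 (θ-S s) ⟩
     c s̄ m ∷ d s̄ m ∷ θ s̄ ∷ S a ∷ θ s ∷ c s n ∷ d s n ∷ S (tw s n) ∷ B ^ n ∷ []           ≋⟨ at 6 (d-natural s (tw-arity s n)) ⟨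
     c s̄ m ∷ d s̄ m ∷ θ s̄ ∷ S a ∷ θ s ∷ c s n ∷ tw s n ∷ d s n ∷ B ^ n ∷ []               ≋⟨ at 4 (tw-suc s n) ⟨
     c s̄ m ∷ d s̄ m ∷ θ s̄ ∷ S a ∷ tw s (suc n) ∷ B ^ n ∷ []                               ≋⟨ at 3 central ⟩
     c s̄ m ∷ d s̄ m ∷ θ s̄ ∷ tw s (suc m) ∷ S a ∷ B ^ n ∷ []                               ≋⟨ at 3 (tw-suc s m) ⟩
     c s̄ m ∷ d s̄ m ∷ θ s̄ ∷ θ s ∷ c s m ∷ tw s m ∷ d s m ∷ S a ∷ B ^ n ∷ []               ≋⟨ at 5 (d-natural s (tw-arity s m)) ⟩
     c s̄ m ∷ d s̄ m ∷ θ s̄ ∷ θ s ∷ c s m ∷ d s m ∷ S (tw s m) ∷ S a ∷ B ^ n ∷ []           ≋⟨ at 0 (twist-cancel m) ⟩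
     S (tw s m) ∷ S a ∷ B ^ n ∷ []                                                       ≋⟨ at 0 S-fuse ⟩
     S (tw s m ∘ a) ∷ B ^ n ∷ []                                                         ■)) ⌋
    where
    s̄ = opposite s
    twist-cancel : ∀ m → c s̄ m ∷ d s̄ m ∷ θ s̄ ∷ θ s ∷ c s m ∷ d s m ∷ [] ≋ []
    twist-cancel m =
      c s̄ m ∷ d s̄ m ∷ θ s̄ ∷ θ s ∷ c s m ∷ d s m ∷ []     ≋⟨ at 2 (θ-inverse′ s) ⟩
      c s̄ m ∷ d s̄ m ∷ c s m ∷ d s m ∷ []                 ≋⟨ at 1 (d-c′ s m) ⟩
      c s̄ m ∷ d s m ∷ []                                 ≋⟨ c-d′ s m ⟩
      []                                                 ■
    central : S a ∷ tw s (suc n) ∷ B ^ n ∷ [] ≋ tw s (suc m) ∷ S a ∷ B ^ n ∷ []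
    central =
      S a ∷ tw s (suc n) ∷ B ^ n ∷ []                    ≋⟨ at 1 (B^-θ s n) ⟨
      S a ∷ B ^ n ∷ θ s ∷ []                             ≋⟨ at 0 e ⟨
      a • ∷ B ∷ B ^ m ∷ θ s ∷ []                         ≋⟨ at 2 (B^-θ s m) ⟩
      a • ∷ B ∷ tw s (suc m) ∷ B ^ m ∷ []                ≋⟨ at 1 (B-tw s m) ⟩
      a • ∷ tw s (suc (suc m)) ∷ B ∷ B ^ m ∷ []          ≋⟨ at 0 (•-tw s (suc m)) ⟩
      tw s (suc m) ∷ a • ∷ B ∷ B ^ m ∷ []                ≋⟨ at 1 e ⟩
      tw s (suc m) ∷ S a ∷ B ^ n ∷ []                    ■

  tw-inverse : ∀ s n → tw s n ∷ tw (opposite s) n ∷ [] ≋ []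
  tw-inverse s zero    = ⌊ ∘-identityˡ I ⌋
  tw-inverse s (suc n) = let s̄ = opposite s in
    tw s (suc n) ∷ tw s̄ (suc n) ∷ []                                         ≋⟨ at 1 (tw-suc s̄ n) ⟩
    tw s (suc n) ∷ θ s̄ ∷ c s̄ n ∷ tw s̄ n ∷ d s̄ n ∷ []                         ≋⟨ at 2 (c-natural s̄ (tw-arity s̄ n)) ⟨
    tw s (suc n) ∷ θ s̄ ∷ S (tw s̄ n) ∷ c s̄ n ∷ d s̄ n ∷ []                     ≋⟨ at 0 (tw-natural s (weaken n (θ-arity s̄))) ⟨
    θ s̄ ∷ tw s (suc n) ∷ S (tw s̄ n) ∷ c s̄ n ∷ d s̄ n ∷ []                     ≋⟨ at 1 (tw-suc s n) ⟩
    θ s̄ ∷ θ s ∷ c s n ∷ tw s n ∷ d s n ∷ S (tw s̄ n) ∷ c s̄ n ∷ d s̄ n ∷ []     ≋⟨ at 0 (θ-inverse′ s) ⟩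
    c s n ∷ tw s n ∷ d s n ∷ S (tw s̄ n) ∷ c s̄ n ∷ d s̄ n ∷ []                 ≋⟨ at 2 (d-natural s (tw-arity s̄ n)) ⟨
    c s n ∷ tw s n ∷ tw s̄ n ∷ d s n ∷ c s̄ n ∷ d s̄ n ∷ []                     ≋⟨ at 1 (tw-inverse s n) ⟩
    c s n ∷ d s n ∷ c s̄ n ∷ d s̄ n ∷ []                                       ≋⟨ at 1 (d-c s n) ⟩
    c s n ∷ d s̄ n ∷ []                                                       ≋⟨ c-d s n ⟩
    []                                                                       ■

  -- Naturality of a single crossing with respect to maps of small arity

  c-2 : ∀ s → c s 2 ∷ [] ≋ C s ∷ S (C s) ∷ []
  c-2 s =
    c s 2 ∷ []                       ≋⟨ ∘-fuse ⟨
    C s ∷ S (c s 1) ∷ []             ≋⟨ at 1 (⇑ (c-1 s)) ⟩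
    C s ∷ S (C s) ∷ []               ■

  d-2 : ∀ s → d s 2 ∷ [] ≋ S (C s) ∷ C s ∷ []
  d-2 s =
    d s 2 ∷ []                       ≋⟨ ∘-fuse ⟨
    S (d s 1) ∷ C s ∷ []             ≋⟨ at 0 (⇑ (d-1 s)) ⟩
    S (C s) ∷ C s ∷ []               ■

  module _ (s : Sign) where

    1⇒1-C : ∀ {a} → a ∶ 1 ⇒ 1 → a ∷ C s ∷ [] ≋ C s ∷ S a ∷ []
    1⇒1-C {a} a⇒ =
      a ∷ C s ∷ []                   ≋⟨ at 1 (d-1 s) ⟨
      a ∷ d s 1 ∷ []                 ≋⟨ d-natural s a⇒ ⟩
      d s 1 ∷ S a ∷ []               ≋⟨ at 0 (d-1 s) ⟩
      C s ∷ S a ∷ []                 ■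

    S[1⇒1]-C : ∀ {a} → a ∶ 1 ⇒ 1 → S a ∷ C s ∷ [] ≋ C s ∷ a ∷ []
    S[1⇒1]-C {a} a⇒ =
      S a ∷ C s ∷ []                 ≋⟨ at 1 (c-1 s) ⟨
      S a ∷ c s 1 ∷ []               ≋⟨ c-natural s a⇒ ⟩
      c s 1 ∷ a ∷ []                 ≋⟨ at 0 (c-1 s) ⟩
      C s ∷ a ∷ []                   ■

    C-1⇒2 : ∀ {a} → a ∶ 1 ⇒ 2 → C s ∷ a ∷ [] ≋ S a ∷ C s ∷ S (C s) ∷ []
    C-1⇒2 {a} a⇒ =
      C s ∷ a ∷ []                   ≋⟨ at 0 (c-1 s) ⟨
      c s 1 ∷ a ∷ []                 ≋⟨ c-natural s a⇒ ⟨
      S a ∷ c s 2 ∷ []               ≋⟨ at 1 (c-2 s) ⟩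
      S a ∷ C s ∷ S (C s) ∷ []       ■

    C-S[1⇒2] : ∀ {a} → a ∶ 1 ⇒ 2 → C s ∷ S a ∷ [] ≋ a ∷ S (C s) ∷ C s ∷ []
    C-S[1⇒2] {a} a⇒ =
      C s ∷ S a ∷ []                 ≋⟨ at 0 (d-1 s) ⟨
      d s 1 ∷ S a ∷ []               ≋⟨ d-natural s a⇒ ⟨
      a ∷ d s 2 ∷ []                 ≋⟨ at 1 (d-2 s) ⟩
      a ∷ S (C s) ∷ C s ∷ []         ■

    0⇒2-C : ∀ {a} → a ∶ 0 ⇒ 2 → a ∷ S (C s) ∷ C s ∷ [] ≋ S a ∷ []
    0⇒2-C {a} a⇒ =
      a ∷ S (C s) ∷ C s ∷ []         ≋⟨ at 1 (d-2 s) ⟨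
      a ∷ d s 2 ∷ []                 ≋⟨ d-natural s a⇒ ⟩
      I ∷ S a ∷ []                   ≋⟨ at 0 I-drop ⟩
      S a ∷ []                       ■

    S[0⇒2]-C : ∀ {a} → a ∶ 0 ⇒ 2 → S a ∷ C s ∷ S (C s) ∷ [] ≋ a ∷ []
    S[0⇒2]-C {a} a⇒ =
      S a ∷ C s ∷ S (C s) ∷ []       ≋⟨ at 1 (c-2 s) ⟨
      S a ∷ c s 2 ∷ []               ≋⟨ c-natural s a⇒ ⟩
      I ∷ a ∷ []                     ≋⟨ at 0 I-drop ⟩
      a ∷ []                         ■

    C-2⇒0 : ∀ {a} → a ∶ 2 ⇒ 0 → C s ∷ S (C s) ∷ a ∷ [] ≋ S a ∷ []
    C-2⇒0 {a} a⇒ =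
      C s ∷ S (C s) ∷ a ∷ []         ≋⟨ at 0 (c-2 s) ⟨
      c s 2 ∷ a ∷ []                 ≋⟨ c-natural s a⇒ ⟨
      S a ∷ I ∷ []                   ≋⟨ at 1 I-drop ⟩
      S a ∷ []                       ■

    θ-C : ∀ t → θ t ∷ C s ∷ [] ≋ C s ∷ S (θ t) ∷ []
    θ-C t = 1⇒1-C (θ-arity t)

    Sθ-C : ∀ t → S (θ t) ∷ C s ∷ [] ≋ C s ∷ θ t ∷ []
    Sθ-C t = S[1⇒1]-C (θ-arity t)

    θ-1⇒2 : ∀ {a} → a ∶ 1 ⇒ 2 → θ s ∷ a ∷ [] ≋ a ∷ θ s ∷ C s ∷ θ s ∷ C s ∷ []
    θ-1⇒2 {a} a⇒ =
      θ s ∷ a ∷ []                           ≋⟨ at 0 (tw-1 s) ⟨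
      tw s 1 ∷ a ∷ []                        ≋⟨ tw-natural s a⇒ ⟨
      a ∷ tw s 2 ∷ []                        ≋⟨ at 1 (tw-2 s) ⟩
      a ∷ θ s ∷ C s ∷ θ s ∷ C s ∷ []         ■

  -- Trace

  tr : ∀ {v w} → v ≋ w → Tr · ⟦ v ⟧ ∷ [] ≋ Tr · ⟦ w ⟧ ∷ []
  tr ⌊ e ⌋ = ⌊ cong (Tr ·_) e ⌋

  -- Tightening of the trace: what avoids the closed strand can leave the loop on either side.
  tr-pull : ∀ v w u → Tr · ⟦ map S v ++ w ++ map S u ⟧ ∷ [] ≋ v ++ Tr · ⟦ w ⟧ ∷ u
  tr-pull v w u = ⌊ (begin
    Tr · ⟦ map S v ++ w ++ map S u ⟧               ≡⟨ cong (Tr ·_) (⟦⟧-++ (map S v) (w ++ map S u)) ⟩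
    Tr · (⟦ map S v ⟧ ∘ ⟦ w ++ map S u ⟧)          ≡⟨ cong (λ x → Tr · (x ∘ ⟦ w ++ map S u ⟧)) (⟦⟧-map v) ⟩
    Tr · (S ⟦ v ⟧ ∘ ⟦ w ++ map S u ⟧)              ≡⟨ ∘-Tr· ⟦ v ⟧ ⟦ w ++ map S u ⟧ ⟨
    ⟦ v ⟧ ∘ Tr · ⟦ w ++ map S u ⟧                  ≡⟨ cong (λ x → ⟦ v ⟧ ∘ Tr · x) (⟦⟧-++ w (map S u)) ⟩
    ⟦ v ⟧ ∘ Tr · (⟦ w ⟧ ∘ ⟦ map S u ⟧)             ≡⟨ cong (λ x → ⟦ v ⟧ ∘ Tr · (⟦ w ⟧ ∘ x)) (⟦⟧-map u) ⟩
    ⟦ v ⟧ ∘ Tr · (⟦ w ⟧ ∘ S ⟦ u ⟧)                 ≡⟨ cong (⟦ v ⟧ ∘_) (Tr·-∘ ⟦ w ⟧ ⟦ u ⟧) ⟨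
    ⟦ v ⟧ ∘ Tr · ⟦ w ⟧ ∘ ⟦ u ⟧                     ≡⟨ cong (⟦ v ⟧ ∘_) (⟦⟧-∷ (Tr · ⟦ w ⟧) u) ⟨
    ⟦ v ⟧ ∘ ⟦ Tr · ⟦ w ⟧ ∷ u ⟧                     ≡⟨ ⟦⟧-++ v (Tr · ⟦ w ⟧ ∷ u) ⟨
    ⟦ v ++ Tr · ⟦ w ⟧ ∷ u ⟧                        ∎) ⌋

  tr-loop : ∀ w → Tr ∷ map S w ++ B ∷ [] ≋ S (Tr · ⟦ w ⟧) ∷ []
  tr-loop w = ⌊ (begin
    ⟦ Tr ∷ map S w ++ B ∷ [] ⟧             ≡⟨ ⟦⟧-∷ Tr (map S w ++ B ∷ []) ⟩
    Tr ∘ ⟦ map S w ++ B ∷ [] ⟧             ≡⟨ cong (Tr ∘_) (⟦⟧-++ (map S w) (B ∷ [])) ⟩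
    Tr ∘ ⟦ map S w ⟧ ∘ B                   ≡⟨ cong (λ x → Tr ∘ x ∘ B) (⟦⟧-map w) ⟩
    Tr ∘ S ⟦ w ⟧ ∘ B                       ≡⟨ value S-Tr· ⟨
    S (Tr · ⟦ w ⟧)                         ∎) ⌋

  tr-C : ∀ s → Tr · C s ∷ [] ≋ θ s ∷ []
  tr-C s = atom (TrC s)

  Tr-SC-B : ∀ s → Tr ∷ S (C s) ∷ B ∷ [] ≋ S (θ s) ∷ []
  Tr-SC-B s =
    Tr ∷ S (C s) ∷ B ∷ []          ≋⟨ tr-loop (C s ∷ []) ⟩
    S (Tr · C s) ∷ []              ≋⟨ ⇑ (tr-C s) ⟩
    S (θ s) ∷ []                   ■

  -- The closed strand is made the leftmost one by crossing it with the idle strand before and after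
  -- `w`. Sliding the idle strand past all of `Tr · ⟦ w ⟧` and back through `w` leaves just these
  -- two crossings; either sign will do.
  S-Tr·-conjugate : ∀ s {w m n} → ⟦ w ⟧ ∶ suc m ⇒ suc n →
    S (Tr · ⟦ w ⟧) ∷ [] ≋ Tr · ⟦ C (opposite s) ∷ map S w ++ C s ∷ [] ⟧ ∷ []
  S-Tr·-conjugate s {w} {m} {n} f⇒ =
    S (Tr · f) ∷ []                                        ≋⟨ at 1 (c-d s n) ⟨
    S (Tr · f) ∷ c s n ∷ d s̄ n ∷ []                        ≋⟨ at 0 (c-natural s (Tr·-arity f⇒)) ⟩
    c s m ∷ Tr · f ∷ d s̄ n ∷ []                            ≋⟨ tr-pull (c s m ∷ []) (f ∷ []) (d s̄ n ∷ []) ⟨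
    Tr · ⟦ S (c s m) ∷ f ∷ S (d s̄ n) ∷ [] ⟧ ∷ []           ≋⟨ tr (
      S (c s m) ∷ f ∷ S (d s̄ n) ∷ []                           ≋⟨ at 0 (C-inverse′ s) ⟨
      C s̄ ∷ C s ∷ S (c s m) ∷ f ∷ S (d s̄ n) ∷ []               ≋⟨ at 1 ∘-fuse ⟩
      C s̄ ∷ c s (suc m) ∷ f ∷ S (d s̄ n) ∷ []                   ≋⟨ at 1 (c-natural s f⇒) ⟨
      C s̄ ∷ S f ∷ c s (suc n) ∷ S (d s̄ n) ∷ []                 ≋⟨ at 2 ∘-fuse ⟨
      C s̄ ∷ S f ∷ C s ∷ S (c s n) ∷ S (d s̄ n) ∷ []             ≋⟨ at 3 (⇑ (c-d s n)) ⟩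
      C s̄ ∷ S f ∷ C s ∷ []                                     ≋⟨ at 1 ⌊S⌋ ⟩
      C s̄ ∷ map S w ++ C s ∷ []                                ■) ⟩
    Tr · ⟦ C s̄ ∷ map S w ++ C s ∷ [] ⟧ ∷ []                ■
    where
    s̄ = opposite s
    f = ⟦ w ⟧
    ⌊S⌋ : S f ∷ [] ≋ map S w
    ⌊S⌋ = ⌊ sym (⟦⟧-map w) ⌋

  -- The eta rule and its variants

  module _ (s : Sign) where

    private
      s̄ = opposite s

    -- The eta rule λx. f x = f, where the closed strand carries x.
    eta : Tr · ⟦ C s̄ ∷ B ∷ Tr ∷ C s ∷ [] ⟧ ≡ I
    eta = ∘B-cancel
      (Tr·-arity (∘-arity (C-arity s̄) (∘-arity B-arity (∘-arity Tr-arity (C-arity s)))))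
      (I-arity 1)
      (Tr · ⟦ C s̄ ∷ B ∷ Tr ∷ C s ∷ [] ⟧ ∷ B ∷ []
         ≋⟨ tr-pull [] (C s̄ ∷ B ∷ Tr ∷ C s ∷ []) (B ∷ []) ⟨
       Tr · ⟦ C s̄ ∷ B ∷ Tr ∷ C s ∷ S B ∷ [] ⟧ ∷ []
         ≋⟨ tr (
           C s̄ ∷ B ∷ Tr ∷ C s ∷ S B ∷ []                    ≋⟨ at 3 (C-SB s) ⟩
           C s̄ ∷ B ∷ Tr ∷ S (C s̄) ∷ B ∷ C s ∷ []            ≋⟨ at 2 (Tr-SC-B s̄) ⟩
           C s̄ ∷ B ∷ S (θ s̄) ∷ C s ∷ []                     ≋⟨ at 1 B-S′ ⟩
           C s̄ ∷ S (S (θ s̄)) ∷ B ∷ C s ∷ []                 ≋⟨ at 2 (B-C s) ⟩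
           C s̄ ∷ S (S (θ s̄)) ∷ S (C s) ∷ C s ∷ S B ∷ []     ≋⟨ at 1 (⇑ (Sθ-C s s̄)) ⟩
           C s̄ ∷ S (C s) ∷ S (θ s̄) ∷ C s ∷ S B ∷ []         ≋⟨ at 2 (Sθ-C s s̄) ⟩
           C s̄ ∷ S (C s) ∷ C s ∷ θ s̄ ∷ S B ∷ []             ≋⟨ at 0 (YB-left s) ⟩
           S (C s) ∷ C s ∷ S (C s̄) ∷ θ s̄ ∷ S B ∷ []         ≋⟨ at 2 (θ-S s̄) ⟨
           S (C s) ∷ C s ∷ θ s̄ ∷ S (C s̄) ∷ S B ∷ []         ≋⟨ at 1 (Sθ-C s s̄) ⟨
           S (C s) ∷ S (θ s̄) ∷ C s ∷ S (C s̄) ∷ S B ∷ []     ■) ⟩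
       Tr · ⟦ S (C s) ∷ S (θ s̄) ∷ C s ∷ S (C s̄) ∷ S B ∷ [] ⟧ ∷ []
         ≋⟨ tr-pull (C s ∷ θ s̄ ∷ []) (C s ∷ []) (C s̄ ∷ B ∷ []) ⟩
       C s ∷ θ s̄ ∷ Tr · C s ∷ C s̄ ∷ B ∷ []    ≋⟨ at 2 (tr-C s) ⟩
       C s ∷ θ s̄ ∷ θ s ∷ C s̄ ∷ B ∷ []         ≋⟨ at 1 (θ-inverse′ s) ⟩
       C s ∷ C s̄ ∷ B ∷ []                     ≋⟨ at 0 (C-inverse s) ⟩
       B ∷ []                                 ≋⟨ at 0 I-drop ⟨
       I ∷ B ∷ []                             ■)

    -- Here the abstraction precedes the application, which is the form left over by the snake
    -- `η ∘ S ε`. The appended `B` turns the abstraction into a second closed strand, and both loops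
    -- are then resolved into twists.
    eta-outer : Tr · ⟦ Tr ∷ S (C s̄) ∷ S B ∷ C s ∷ [] ⟧ ≡ θ s
    eta-outer = ∘B-cancel
      (Tr·-arity (∘-arity (weaken 1 Tr-arity) (∘-arity (S-arity (C-arity s̄)) (∘-arity (S-arity B-arity) (C-arity s)))))
      (θ-arity s)
      (Tr · ⟦ Tr ∷ S (C s̄) ∷ S B ∷ C s ∷ [] ⟧ ∷ B ∷ []
         ≋⟨ tr-pull [] (Tr ∷ S (C s̄) ∷ S B ∷ C s ∷ []) (B ∷ []) ⟨
       Tr · ⟦ Tr ∷ S (C s̄) ∷ S B ∷ C s ∷ S B ∷ [] ⟧ ∷ []
         ≋⟨ tr (
           Tr ∷ S (C s̄) ∷ S B ∷ C s ∷ S B ∷ []              ≋⟨ at 3 (C-SB s) ⟩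
           Tr ∷ S (C s̄) ∷ S B ∷ S (C s̄) ∷ B ∷ C s ∷ []      ≋⟨ at 0 (tr-loop (C s̄ ∷ B ∷ C s̄ ∷ [])) ⟩
           S (Tr · ⟦ C s̄ ∷ B ∷ C s̄ ∷ [] ⟧) ∷ C s ∷ []       ■) ⟩
       Tr · ⟦ S (Tr · ⟦ C s̄ ∷ B ∷ C s̄ ∷ [] ⟧) ∷ C s ∷ [] ⟧ ∷ []
         ≋⟨ tr-pull (Tr · ⟦ C s̄ ∷ B ∷ C s̄ ∷ [] ⟧ ∷ []) (C s ∷ []) [] ⟩
       Tr · ⟦ C s̄ ∷ B ∷ C s̄ ∷ [] ⟧ ∷ Tr · C s ∷ []
         ≋⟨ at 1 (tr-C s) ⟩
       Tr · ⟦ C s̄ ∷ B ∷ C s̄ ∷ [] ⟧ ∷ θ s ∷ []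
         ≋⟨ at 0 (tr (
           C s̄ ∷ B ∷ C s̄ ∷ []                               ≋⟨ at 1 (B-C s̄) ⟩
           C s̄ ∷ S (C s̄) ∷ C s̄ ∷ S B ∷ []                   ≋⟨ at 0 (YB′ s̄) ⟨
           S (C s̄) ∷ C s̄ ∷ S (C s̄) ∷ S B ∷ []               ■)) ⟩
       Tr · ⟦ S (C s̄) ∷ C s̄ ∷ S (C s̄) ∷ S B ∷ [] ⟧ ∷ θ s ∷ []
         ≋⟨ at 0 (tr-pull (C s̄ ∷ []) (C s̄ ∷ []) (C s̄ ∷ B ∷ [])) ⟩
       C s̄ ∷ Tr · C s̄ ∷ C s̄ ∷ B ∷ θ s ∷ []                  ≋⟨ at 1 (tr-C s̄) ⟩
       C s̄ ∷ θ s̄ ∷ C s̄ ∷ B ∷ θ s ∷ []                       ≋⟨ at 3 (B-θ s) ⟩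
       C s̄ ∷ θ s̄ ∷ C s̄ ∷ θ s ∷ C s ∷ θ s ∷ C s ∷ B ∷ []     ≋⟨ at 3 (θ-C s s) ⟩
       C s̄ ∷ θ s̄ ∷ C s̄ ∷ C s ∷ S (θ s) ∷ θ s ∷ C s ∷ B ∷ [] ≋⟨ at 2 (C-inverse′ s) ⟩
       C s̄ ∷ θ s̄ ∷ S (θ s) ∷ θ s ∷ C s ∷ B ∷ []             ≋⟨ at 1 (θ-S s̄) ⟩
       C s̄ ∷ S (θ s) ∷ θ s̄ ∷ θ s ∷ C s ∷ B ∷ []             ≋⟨ at 2 (θ-inverse′ s) ⟩
       C s̄ ∷ S (θ s) ∷ C s ∷ B ∷ []                         ≋⟨ at 1 (Sθ-C s s) ⟩
       C s̄ ∷ C s ∷ θ s ∷ B ∷ []                             ≋⟨ at 0 (C-inverse′ s) ⟩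
       θ s ∷ B ∷ []                                         ■)

    -- The eta rule makes Tr cancellable on the left.
    Tr∘-cancel : ∀ {p q} → p ∶ 1 ⇒ 1 → q ∶ 1 ⇒ 1 → Tr ∷ p ∷ [] ≋ Tr ∷ q ∷ [] → p ∷ [] ≋ q ∷ []
    Tr∘-cancel {p} {q} p⇒ q⇒ e =
      p ∷ []                                             ≋⟨ expand p⇒ ⟩
      Tr · ⟦ C s̄ ∷ B ∷ Tr ∷ p ∷ C s ∷ [] ⟧ ∷ []          ≋⟨ tr {C s̄ ∷ B ∷ Tr ∷ p ∷ C s ∷ []} (at 2 e) ⟩
      Tr · ⟦ C s̄ ∷ B ∷ Tr ∷ q ∷ C s ∷ [] ⟧ ∷ []          ≋⟨ expand q⇒ ⟨
      q ∷ []                                             ■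
      where
      expand : ∀ {p} → p ∶ 1 ⇒ 1 → p ∷ [] ≋ Tr · ⟦ C s̄ ∷ B ∷ Tr ∷ p ∷ C s ∷ [] ⟧ ∷ []
      expand {p} p⇒ =
        p ∷ []                                           ≋⟨ at 0 I-drop ⟨
        I ∷ p ∷ []                                       ≋⟨ at 0 (atom eta) ⟨
        Tr · ⟦ C s̄ ∷ B ∷ Tr ∷ C s ∷ [] ⟧ ∷ p ∷ []        ≋⟨ tr-pull [] (C s̄ ∷ B ∷ Tr ∷ C s ∷ []) (p ∷ []) ⟨
        Tr · ⟦ C s̄ ∷ B ∷ Tr ∷ C s ∷ S p ∷ [] ⟧ ∷ []      ≋⟨ tr {C s̄ ∷ B ∷ Tr ∷ p ∷ C s ∷ []} (at 3 (1⇒1-C s p⇒)) ⟨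
        Tr · ⟦ C s̄ ∷ B ∷ Tr ∷ p ∷ C s ∷ [] ⟧ ∷ []        ■

  S-Tr-⊖ : S Tr ∷ [] ≋ C ⊕ ∷ Tr ∷ S (C ⊖) ∷ C ⊖ ∷ []
  S-Tr-⊖ =
    S Tr ∷ []                                ≋⟨ at 0 (C-inverse ⊕) ⟨
    C ⊕ ∷ C ⊖ ∷ S Tr ∷ []                    ≋⟨ at 1 (C-S[1⇒2] ⊖ Tr-arity) ⟩
    C ⊕ ∷ Tr ∷ S (C ⊖) ∷ C ⊖ ∷ []            ■

  -- The mirror of `eta-outer`, for the snake `S η ∘ ε`: the application now comes last, so a `Tr`
  -- is put in front to meet it, in place of a `B` behind.
  eta-inner : Tr · ⟦ C ⊕ ∷ S Tr ∷ S (C ⊖) ∷ B ∷ [] ⟧ ∷ [] ≋ θ ⊕ ∷ []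
  eta-inner = Tr∘-cancel ⊕
    (Tr·-arity (∘-arity (C-arity ⊕) (∘-arity (S-arity Tr-arity)
      (∘-arity (S-arity (C-arity ⊖)) (weaken 1 B-arity)))))
    (θ-arity ⊕)
    (Tr ∷ Tr · ⟦ C ⊕ ∷ S Tr ∷ S (C ⊖) ∷ B ∷ [] ⟧ ∷ []
       ≋⟨ tr-pull (Tr ∷ []) (C ⊕ ∷ S Tr ∷ S (C ⊖) ∷ B ∷ []) [] ⟨
     Tr · ⟦ S Tr ∷ C ⊕ ∷ S Tr ∷ S (C ⊖) ∷ B ∷ [] ⟧ ∷ []
       ≋⟨ tr (
         S Tr ∷ C ⊕ ∷ S Tr ∷ S (C ⊖) ∷ B ∷ []                        ≋⟨ at 0 S-Tr-⊖ ⟩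
         C ⊕ ∷ Tr ∷ S (C ⊖) ∷ C ⊖ ∷ C ⊕ ∷ S Tr ∷ S (C ⊖) ∷ B ∷ []    ≋⟨ at 3 (C-inverse ⊖) ⟩
         C ⊕ ∷ Tr ∷ S (C ⊖) ∷ S Tr ∷ S (C ⊖) ∷ B ∷ []                ≋⟨ at 1 (tr-loop (C ⊖ ∷ Tr ∷ C ⊖ ∷ [])) ⟩
         C ⊕ ∷ S (Tr · ⟦ C ⊖ ∷ Tr ∷ C ⊖ ∷ [] ⟧) ∷ []                 ■) ⟩
     Tr · ⟦ C ⊕ ∷ S (Tr · ⟦ C ⊖ ∷ Tr ∷ C ⊖ ∷ [] ⟧) ∷ [] ⟧ ∷ []
       ≋⟨ tr-pull [] (C ⊕ ∷ []) (Tr · ⟦ C ⊖ ∷ Tr ∷ C ⊖ ∷ [] ⟧ ∷ []) ⟩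
     Tr · C ⊕ ∷ Tr · ⟦ C ⊖ ∷ Tr ∷ C ⊖ ∷ [] ⟧ ∷ []
       ≋⟨ at 0 (tr-C ⊕) ⟩
     θ ⊕ ∷ Tr · ⟦ C ⊖ ∷ Tr ∷ C ⊖ ∷ [] ⟧ ∷ []
       ≋⟨ at 1 (tr (
         C ⊖ ∷ Tr ∷ C ⊖ ∷ []                         ≋⟨ at 0 (C-1⇒2 ⊖ Tr-arity) ⟩
         S Tr ∷ C ⊖ ∷ S (C ⊖) ∷ C ⊖ ∷ []             ≋⟨ at 1 (YB′ ⊖) ⟨
         S Tr ∷ S (C ⊖) ∷ C ⊖ ∷ S (C ⊖) ∷ []         ■)) ⟩
     θ ⊕ ∷ Tr · ⟦ S Tr ∷ S (C ⊖) ∷ C ⊖ ∷ S (C ⊖) ∷ [] ⟧ ∷ []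
       ≋⟨ at 1 (tr-pull (Tr ∷ C ⊖ ∷ []) (C ⊖ ∷ []) (C ⊖ ∷ [])) ⟩
     θ ⊕ ∷ Tr ∷ C ⊖ ∷ Tr · C ⊖ ∷ C ⊖ ∷ []                    ≋⟨ at 3 (tr-C ⊖) ⟩
     θ ⊕ ∷ Tr ∷ C ⊖ ∷ θ ⊖ ∷ C ⊖ ∷ []                         ≋⟨ at 0 (θ-1⇒2 ⊕ Tr-arity) ⟩
     Tr ∷ θ ⊕ ∷ C ⊕ ∷ θ ⊕ ∷ C ⊕ ∷ C ⊖ ∷ θ ⊖ ∷ C ⊖ ∷ []       ≋⟨ at 4 (C-inverse ⊕) ⟩
     Tr ∷ θ ⊕ ∷ C ⊕ ∷ θ ⊕ ∷ θ ⊖ ∷ C ⊖ ∷ []                   ≋⟨ at 3 (θ-inverse ⊕) ⟩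
     Tr ∷ θ ⊕ ∷ C ⊕ ∷ C ⊖ ∷ []                               ≋⟨ at 2 (C-inverse ⊕) ⟩
     Tr ∷ θ ⊕ ∷ []                                           ■)

  -- Duality.  Under A ⊗ A* ≅ A the object A is an algebra of endomorphisms,
  -- and ε is its trace form (x , y) ↦ tr (x ∘ y).

  ε η : Carrier
  ε = Tr · ⟦ C ⊕ ∷ S (C ⊕) ∷ S B ∷ B ∷ [] ⟧
  -- This is the word of `ε` reversed, with `Tr` for `B`. In `ε` the loop strand z passes x and y
  -- and returns as x (y z); here it is split twice and its last part returns to the loop.
  η = Tr · ⟦ Tr ∷ S Tr ∷ S (C ⊕) ∷ C ⊕ ∷ [] ⟧

  ε-body-arity : ⟦ C ⊕ ∷ S (C ⊕) ∷ S B ∷ B ∷ [] ⟧ ∶ 3 ⇒ 1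
  ε-body-arity = ∘-arity (weaken 1 (C-arity ⊕)) (∘-arity (S-arity (C-arity ⊕)) (∘-arity (S-arity B-arity) B-arity))

  η-body-arity : ⟦ Tr ∷ S Tr ∷ S (C ⊕) ∷ C ⊕ ∷ [] ⟧ ∶ 1 ⇒ 3
  η-body-arity = ∘-arity Tr-arity (∘-arity (S-arity Tr-arity) (∘-arity (S-arity (C-arity ⊕)) (weaken 1 (C-arity ⊕))))

  ε-arity : ε ∶ 2 ⇒ 0
  ε-arity = Tr·-arity ε-body-arity

  η-arity : η ∶ 0 ⇒ 2
  η-arity = Tr·-arity η-body-arity

  -- ε absorbs an abstraction: the loop of ε is moved past the idle strand, then `Tr` meets one of
  -- the two applications in ε by beta, and the other application remains.
  Tr-C-Sε : Tr ∷ C ⊕ ∷ S ε ∷ [] ≋ S (θ ⊖) ∷ C ⊖ ∷ B ∷ []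
  Tr-C-Sε =
    Tr ∷ C ⊕ ∷ S ε ∷ []
      ≋⟨ at 2 (S-Tr·-conjugate ⊖ {C ⊕ ∷ S (C ⊕) ∷ S B ∷ B ∷ []} ε-body-arity) ⟩
    Tr ∷ C ⊕ ∷ Tr · ⟦ C ⊕ ∷ S (C ⊕) ∷ S (S (C ⊕)) ∷ S (S B) ∷ S B ∷ C ⊖ ∷ [] ⟧ ∷ []
      ≋⟨ tr-pull (Tr ∷ C ⊕ ∷ []) (C ⊕ ∷ S (C ⊕) ∷ S (S (C ⊕)) ∷ S (S B) ∷ S B ∷ C ⊖ ∷ []) [] ⟨
    Tr · ⟦ S Tr ∷ S (C ⊕) ∷ C ⊕ ∷ S (C ⊕) ∷ S (S (C ⊕)) ∷ S (S B) ∷ S B ∷ C ⊖ ∷ [] ⟧ ∷ []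
      ≋⟨ tr (
        S Tr ∷ S (C ⊕) ∷ C ⊕ ∷ S (C ⊕) ∷ S (S (C ⊕)) ∷ S (S B) ∷ S B ∷ C ⊖ ∷ []
          ≋⟨ at 6 (SB-C ⊖) ⟩
        S Tr ∷ S (C ⊕) ∷ C ⊕ ∷ S (C ⊕) ∷ S (S (C ⊕)) ∷ S (S B) ∷ C ⊖ ∷ S (C ⊖) ∷ B ∷ []
          ≋⟨ at 5 (C-S² ⊖) ⟨
        S Tr ∷ S (C ⊕) ∷ C ⊕ ∷ S (C ⊕) ∷ S (S (C ⊕)) ∷ C ⊖ ∷ S (S B) ∷ S (C ⊖) ∷ B ∷ []
          ≋⟨ at 6 (⇑ (SB-C ⊖)) ⟩
        S Tr ∷ S (C ⊕) ∷ C ⊕ ∷ S (C ⊕) ∷ S (S (C ⊕)) ∷ C ⊖ ∷ S (C ⊖) ∷ S (S (C ⊖)) ∷ S B ∷ B ∷ []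
          ≋⟨ at 0 S-Tr-⊖ ⟩
        C ⊕ ∷ Tr ∷ S (C ⊖) ∷ C ⊖ ∷ S (C ⊕) ∷ C ⊕ ∷ S (C ⊕) ∷ S (S (C ⊕)) ∷ C ⊖ ∷ S (C ⊖) ∷ S (S (C ⊖)) ∷ S B ∷ B ∷ []
          ≋⟨ at 2 (YB-left ⊖) ⟨
        C ⊕ ∷ Tr ∷ C ⊕ ∷ S (C ⊖) ∷ C ⊖ ∷ C ⊕ ∷ S (C ⊕) ∷ S (S (C ⊕)) ∷ C ⊖ ∷ S (C ⊖) ∷ S (S (C ⊖)) ∷ S B ∷ B ∷ []
          ≋⟨ at 4 (C-inverse ⊖) ⟩
        C ⊕ ∷ Tr ∷ C ⊕ ∷ S (C ⊖) ∷ S (C ⊕) ∷ S (S (C ⊕)) ∷ C ⊖ ∷ S (C ⊖) ∷ S (S (C ⊖)) ∷ S B ∷ B ∷ []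
          ≋⟨ at 3 (⇑ (C-inverse ⊖)) ⟩
        C ⊕ ∷ Tr ∷ C ⊕ ∷ S (S (C ⊕)) ∷ C ⊖ ∷ S (C ⊖) ∷ S (S (C ⊖)) ∷ S B ∷ B ∷ []
          ≋⟨ at 2 (C-S² ⊕) ⟩
        C ⊕ ∷ Tr ∷ S (S (C ⊕)) ∷ C ⊕ ∷ C ⊖ ∷ S (C ⊖) ∷ S (S (C ⊖)) ∷ S B ∷ B ∷ []
          ≋⟨ at 3 (C-inverse ⊕) ⟩
        C ⊕ ∷ Tr ∷ S (S (C ⊕)) ∷ S (C ⊖) ∷ S (S (C ⊖)) ∷ S B ∷ B ∷ []
          ≋⟨ at 1 (tr-loop (S (C ⊕) ∷ C ⊖ ∷ S (C ⊖) ∷ B ∷ [])) ⟩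
        C ⊕ ∷ S (Tr · ⟦ S (C ⊕) ∷ C ⊖ ∷ S (C ⊖) ∷ B ∷ [] ⟧) ∷ []
          ≋⟨ at 1 (⇑ (tr (
            S (C ⊕) ∷ C ⊖ ∷ S (C ⊖) ∷ B ∷ []         ≋⟨ at 2 (SC-B ⊕) ⟩
            S (C ⊕) ∷ C ⊖ ∷ C ⊕ ∷ S B ∷ C ⊖ ∷ []     ≋⟨ at 1 (C-inverse ⊖) ⟩
            S (C ⊕) ∷ S B ∷ C ⊖ ∷ []                 ■))) ⟩
        C ⊕ ∷ S (Tr · ⟦ S (C ⊕) ∷ S B ∷ C ⊖ ∷ [] ⟧) ∷ []
          ■) ⟩
    Tr · ⟦ C ⊕ ∷ S (Tr · ⟦ S (C ⊕) ∷ S B ∷ C ⊖ ∷ [] ⟧) ∷ [] ⟧ ∷ []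
      ≋⟨ tr-pull [] (C ⊕ ∷ []) (Tr · ⟦ S (C ⊕) ∷ S B ∷ C ⊖ ∷ [] ⟧ ∷ []) ⟩
    Tr · C ⊕ ∷ Tr · ⟦ S (C ⊕) ∷ S B ∷ C ⊖ ∷ [] ⟧ ∷ []    ≋⟨ at 0 (tr-C ⊕) ⟩
    θ ⊕ ∷ Tr · ⟦ S (C ⊕) ∷ S B ∷ C ⊖ ∷ [] ⟧ ∷ []         ≋⟨ at 1 (tr-pull (C ⊕ ∷ B ∷ []) (C ⊖ ∷ []) []) ⟩
    θ ⊕ ∷ C ⊕ ∷ B ∷ Tr · C ⊖ ∷ []                        ≋⟨ at 3 (tr-C ⊖) ⟩
    θ ⊕ ∷ C ⊕ ∷ B ∷ θ ⊖ ∷ []                             ≋⟨ at 2 (B-θ ⊖) ⟩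
    θ ⊕ ∷ C ⊕ ∷ θ ⊖ ∷ C ⊖ ∷ θ ⊖ ∷ C ⊖ ∷ B ∷ []           ≋⟨ at 1 (Sθ-C ⊕ ⊖) ⟨
    θ ⊕ ∷ S (θ ⊖) ∷ C ⊕ ∷ C ⊖ ∷ θ ⊖ ∷ C ⊖ ∷ B ∷ []       ≋⟨ at 2 (C-inverse ⊕) ⟩
    θ ⊕ ∷ S (θ ⊖) ∷ θ ⊖ ∷ C ⊖ ∷ B ∷ []                   ≋⟨ at 0 (θ-S ⊕) ⟩
    S (θ ⊖) ∷ θ ⊕ ∷ θ ⊖ ∷ C ⊖ ∷ B ∷ []                   ≋⟨ at 1 (θ-inverse ⊕) ⟩
    S (θ ⊖) ∷ C ⊖ ∷ B ∷ []                               ■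

  -- ε absorbs the second `Tr` of η; the first `Tr` and the remaining `B` form `eta-outer`, whose
  -- twist is cancelled.
  snake-η-Sε : η ∷ S ε ∷ [] ≋ []
  snake-η-Sε =
    η ∷ S ε ∷ []
      ≋⟨ tr-pull [] (Tr ∷ S Tr ∷ S (C ⊕) ∷ C ⊕ ∷ []) (S ε ∷ []) ⟨
    Tr · ⟦ Tr ∷ S Tr ∷ S (C ⊕) ∷ C ⊕ ∷ S (S ε) ∷ [] ⟧ ∷ []
      ≋⟨ tr (
        Tr ∷ S Tr ∷ S (C ⊕) ∷ C ⊕ ∷ S (S ε) ∷ []         ≋⟨ at 3 (C-S² ⊕) ⟩
        Tr ∷ S Tr ∷ S (C ⊕) ∷ S (S ε) ∷ C ⊕ ∷ []         ≋⟨ at 1 (⇑ Tr-C-Sε) ⟩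
        Tr ∷ S (S (θ ⊖)) ∷ S (C ⊖) ∷ S B ∷ C ⊕ ∷ []      ≋⟨ at 0 Tr-S ⟩
        S (θ ⊖) ∷ Tr ∷ S (C ⊖) ∷ S B ∷ C ⊕ ∷ []          ■) ⟩
    Tr · ⟦ S (θ ⊖) ∷ Tr ∷ S (C ⊖) ∷ S B ∷ C ⊕ ∷ [] ⟧ ∷ []
      ≋⟨ tr-pull (θ ⊖ ∷ []) (Tr ∷ S (C ⊖) ∷ S B ∷ C ⊕ ∷ []) [] ⟩
    θ ⊖ ∷ Tr · ⟦ Tr ∷ S (C ⊖) ∷ S B ∷ C ⊕ ∷ [] ⟧ ∷ []    ≋⟨ at 1 (atom (eta-outer ⊕)) ⟩
    θ ⊖ ∷ θ ⊕ ∷ []                                       ≋⟨ θ-inverse ⊖ ⟩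
    []                                                   ■

  -- The counterpart of `Tr-C-Sε`: η absorbs an application and an abstraction remains.
  Sη-C-B : S η ∷ C ⊕ ∷ B ∷ [] ≋ Tr ∷ C ⊖ ∷ S (θ ⊖) ∷ []
  Sη-C-B =
    S η ∷ C ⊕ ∷ B ∷ []
      ≋⟨ at 0 (S-Tr·-conjugate ⊕ {Tr ∷ S Tr ∷ S (C ⊕) ∷ C ⊕ ∷ []} η-body-arity) ⟩
    Tr · ⟦ C ⊖ ∷ S Tr ∷ S (S Tr) ∷ S (S (C ⊕)) ∷ S (C ⊕) ∷ C ⊕ ∷ [] ⟧ ∷ C ⊕ ∷ B ∷ []
      ≋⟨ tr-pull [] (C ⊖ ∷ S Tr ∷ S (S Tr) ∷ S (S (C ⊕)) ∷ S (C ⊕) ∷ C ⊕ ∷ []) (C ⊕ ∷ B ∷ []) ⟨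
    Tr · ⟦ C ⊖ ∷ S Tr ∷ S (S Tr) ∷ S (S (C ⊕)) ∷ S (C ⊕) ∷ C ⊕ ∷ S (C ⊕) ∷ S B ∷ [] ⟧ ∷ []
      ≋⟨ tr (
        C ⊖ ∷ S Tr ∷ S (S Tr) ∷ S (S (C ⊕)) ∷ S (C ⊕) ∷ C ⊕ ∷ S (C ⊕) ∷ S B ∷ []
          ≋⟨ at 0 (C-S[1⇒2] ⊖ Tr-arity) ⟩
        Tr ∷ S (C ⊖) ∷ C ⊖ ∷ S (S Tr) ∷ S (S (C ⊕)) ∷ S (C ⊕) ∷ C ⊕ ∷ S (C ⊕) ∷ S B ∷ []
          ≋⟨ at 2 (C-S² ⊖) ⟩
        Tr ∷ S (C ⊖) ∷ S (S Tr) ∷ C ⊖ ∷ S (S (C ⊕)) ∷ S (C ⊕) ∷ C ⊕ ∷ S (C ⊕) ∷ S B ∷ []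
          ≋⟨ at 3 (C-S² ⊖) ⟩
        Tr ∷ S (C ⊖) ∷ S (S Tr) ∷ S (S (C ⊕)) ∷ C ⊖ ∷ S (C ⊕) ∷ C ⊕ ∷ S (C ⊕) ∷ S B ∷ []
          ≋⟨ at 4 (YB-left ⊕) ⟩
        Tr ∷ S (C ⊖) ∷ S (S Tr) ∷ S (S (C ⊕)) ∷ S (C ⊕) ∷ C ⊕ ∷ S (C ⊖) ∷ S (C ⊕) ∷ S B ∷ []
          ≋⟨ at 6 (⇑ (C-inverse ⊖)) ⟩
        Tr ∷ S (C ⊖) ∷ S (S Tr) ∷ S (S (C ⊕)) ∷ S (C ⊕) ∷ C ⊕ ∷ S B ∷ []
          ≋⟨ at 5 (C-SB ⊕) ⟩
        Tr ∷ S (C ⊖) ∷ S (S Tr) ∷ S (S (C ⊕)) ∷ S (C ⊕) ∷ S (C ⊖) ∷ B ∷ C ⊕ ∷ []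
          ≋⟨ at 4 (⇑ (C-inverse ⊕)) ⟩
        Tr ∷ S (C ⊖) ∷ S (S Tr) ∷ S (S (C ⊕)) ∷ B ∷ C ⊕ ∷ []
          ≋⟨ at 0 (tr-loop (C ⊖ ∷ S Tr ∷ S (C ⊕) ∷ [])) ⟩
        S (Tr · ⟦ C ⊖ ∷ S Tr ∷ S (C ⊕) ∷ [] ⟧) ∷ C ⊕ ∷ []
          ■) ⟩
    Tr · ⟦ S (Tr · ⟦ C ⊖ ∷ S Tr ∷ S (C ⊕) ∷ [] ⟧) ∷ C ⊕ ∷ [] ⟧ ∷ []
      ≋⟨ tr-pull (Tr · ⟦ C ⊖ ∷ S Tr ∷ S (C ⊕) ∷ [] ⟧ ∷ []) (C ⊕ ∷ []) [] ⟩
    Tr · ⟦ C ⊖ ∷ S Tr ∷ S (C ⊕) ∷ [] ⟧ ∷ Tr · C ⊕ ∷ []   ≋⟨ at 1 (tr-C ⊕) ⟩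
    Tr · ⟦ C ⊖ ∷ S Tr ∷ S (C ⊕) ∷ [] ⟧ ∷ θ ⊕ ∷ []        ≋⟨ at 0 (tr-pull [] (C ⊖ ∷ []) (Tr ∷ C ⊕ ∷ [])) ⟩
    Tr · C ⊖ ∷ Tr ∷ C ⊕ ∷ θ ⊕ ∷ []                       ≋⟨ at 0 (tr-C ⊖) ⟩
    θ ⊖ ∷ Tr ∷ C ⊕ ∷ θ ⊕ ∷ []                            ≋⟨ at 0 (θ-1⇒2 ⊖ Tr-arity) ⟩
    Tr ∷ θ ⊖ ∷ C ⊖ ∷ θ ⊖ ∷ C ⊖ ∷ C ⊕ ∷ θ ⊕ ∷ []          ≋⟨ at 4 (C-inverse ⊖) ⟩
    Tr ∷ θ ⊖ ∷ C ⊖ ∷ θ ⊖ ∷ θ ⊕ ∷ []                      ≋⟨ at 3 (θ-inverse ⊖) ⟩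
    Tr ∷ θ ⊖ ∷ C ⊖ ∷ []                                  ≋⟨ at 1 (θ-C ⊖ ⊖) ⟩
    Tr ∷ C ⊖ ∷ S (θ ⊖) ∷ []                              ■

  snake-Sη-ε : S η ∷ ε ∷ [] ≋ []
  snake-Sη-ε =
    S η ∷ ε ∷ []
      ≋⟨ tr-pull (S η ∷ []) (C ⊕ ∷ S (C ⊕) ∷ S B ∷ B ∷ []) [] ⟨
    Tr · ⟦ S (S η) ∷ C ⊕ ∷ S (C ⊕) ∷ S B ∷ B ∷ [] ⟧ ∷ []
      ≋⟨ tr (
        S (S η) ∷ C ⊕ ∷ S (C ⊕) ∷ S B ∷ B ∷ []           ≋⟨ at 0 (C-S² ⊕) ⟨
        C ⊕ ∷ S (S η) ∷ S (C ⊕) ∷ S B ∷ B ∷ []           ≋⟨ at 1 (⇑ Sη-C-B) ⟩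
        C ⊕ ∷ S Tr ∷ S (C ⊖) ∷ S (S (θ ⊖)) ∷ B ∷ []      ≋⟨ at 3 B-S′ ⟨
        C ⊕ ∷ S Tr ∷ S (C ⊖) ∷ B ∷ S (θ ⊖) ∷ []          ■) ⟩
    Tr · ⟦ C ⊕ ∷ S Tr ∷ S (C ⊖) ∷ B ∷ S (θ ⊖) ∷ [] ⟧ ∷ []
      ≋⟨ tr-pull [] (C ⊕ ∷ S Tr ∷ S (C ⊖) ∷ B ∷ []) (θ ⊖ ∷ []) ⟩
    Tr · ⟦ C ⊕ ∷ S Tr ∷ S (C ⊖) ∷ B ∷ [] ⟧ ∷ θ ⊖ ∷ []    ≋⟨ at 0 eta-inner ⟩
    θ ⊕ ∷ θ ⊖ ∷ []                                       ≋⟨ θ-inverse ⊕ ⟩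
    []                                                   ■

  -- The sign is free here, which forces the compatibility of η with the twist.
  Tr·-via-dual : ∀ s w → Tr · ⟦ w ⟧ ∷ [] ≋ η ∷ θ s ∷ C s ∷ map S w ++ ε ∷ []
  Tr·-via-dual s w =
    Tr · ⟦ w ⟧ ∷ []                                          ≋⟨ tr (
      f ∷ []                                                   ≋⟨ at 1 snake-η-Sε ⟨
      f ∷ η ∷ S ε ∷ []                                         ≋⟨ at 0 (interchange η-arity f) ⟨
      η ∷ S (S f) ∷ S ε ∷ []                                   ≋⟨ at 0 (S[0⇒2]-C s η-arity) ⟨
      S η ∷ C s ∷ S (C s) ∷ S (S f) ∷ S ε ∷ []                 ■) ⟩
    Tr · ⟦ S η ∷ C s ∷ S (C s) ∷ S (S f) ∷ S ε ∷ [] ⟧ ∷ []   ≋⟨ tr-pull (η ∷ []) (C s ∷ []) (C s ∷ S f ∷ ε ∷ []) ⟩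
    η ∷ Tr · C s ∷ C s ∷ S f ∷ ε ∷ []                        ≋⟨ at 1 (tr-C s) ⟩
    η ∷ θ s ∷ C s ∷ S f ∷ ε ∷ []                             ≋⟨ at 3 ⌊S⌋ ⟩
    η ∷ θ s ∷ C s ∷ map S w ++ ε ∷ []                        ■
    where
    f = ⟦ w ⟧
    ⌊S⌋ : S f ∷ [] ≋ map S w
    ⌊S⌋ = ⌊ sym (⟦⟧-map w) ⌋

  η-θC : ∀ s → Tr · η ∷ [] ≋ η ∷ θ s ∷ C s ∷ []
  η-θC s =
    Tr · η ∷ []                            ≋⟨ Tr·-via-dual s (η ∷ []) ⟩
    η ∷ θ s ∷ C s ∷ S η ∷ ε ∷ []           ≋⟨ at 3 snake-Sη-ε ⟩
    η ∷ θ s ∷ C s ∷ []                     ■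

  η-tw : ∀ s → η ∷ θ s ∷ C s ∷ θ s ∷ C s ∷ [] ≋ η ∷ []
  η-tw s =
    η ∷ θ s ∷ C s ∷ θ s ∷ C s ∷ []         ≋⟨ at 1 (tw-2 s) ⟨
    η ∷ tw s 2 ∷ []                        ≋⟨ tw-natural s η-arity ⟩
    I ∷ η ∷ []                             ≋⟨ at 0 I-drop ⟩
    η ∷ []                                 ■

  -- The twist of the dual is the dual of the twist. `η-θC` evaluates `Tr · η` once per sign;
  -- exchanging the two values inside the full twist supplied by `η-tw` carries `θ` to the other
  -- leg.
  η-θ : η ∷ θ ⊕ ∷ [] ≋ η ∷ S (θ ⊕) ∷ []
  η-θ =
    η ∷ θ ⊕ ∷ []                                 ≋⟨ at 0 (η-tw ⊕) ⟨
    η ∷ θ ⊕ ∷ C ⊕ ∷ θ ⊕ ∷ C ⊕ ∷ θ ⊕ ∷ []         ≋⟨ at 0 (η-θC ⊕) ⟨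
    Tr · η ∷ θ ⊕ ∷ C ⊕ ∷ θ ⊕ ∷ []                ≋⟨ at 0 (η-θC ⊖) ⟩
    η ∷ θ ⊖ ∷ C ⊖ ∷ θ ⊕ ∷ C ⊕ ∷ θ ⊕ ∷ []         ≋⟨ at 2 (Sθ-C ⊖ ⊕) ⟨
    η ∷ θ ⊖ ∷ S (θ ⊕) ∷ C ⊖ ∷ C ⊕ ∷ θ ⊕ ∷ []     ≋⟨ at 3 (C-inverse ⊖) ⟩
    η ∷ θ ⊖ ∷ S (θ ⊕) ∷ θ ⊕ ∷ []                 ≋⟨ at 2 (θ-S ⊕) ⟨
    η ∷ θ ⊖ ∷ θ ⊕ ∷ S (θ ⊕) ∷ []                 ≋⟨ at 1 (θ-inverse ⊖) ⟩
    η ∷ S (θ ⊕) ∷ []                             ■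

  -- The mate of `η-θ` under the two snake equations.
  θ-ε : θ ⊕ ∷ ε ∷ [] ≋ S (θ ⊕) ∷ ε ∷ []
  θ-ε =
    θ ⊕ ∷ ε ∷ []                           ≋⟨ at 0 snake-Sη-ε ⟨
    S η ∷ ε ∷ θ ⊕ ∷ ε ∷ []                 ≋⟨ at 1 (interchange ε-arity (θ ⊕)) ⟩
    S η ∷ S (S (θ ⊕)) ∷ ε ∷ ε ∷ []         ≋⟨ at 0 (⇑ η-θ) ⟨
    S η ∷ S (θ ⊕) ∷ ε ∷ ε ∷ []             ≋⟨ at 2 (interchange ε-arity ε) ⟩
    S η ∷ S (θ ⊕) ∷ S (S ε) ∷ ε ∷ []       ≋⟨ at 1 (⇑ (θ-S ⊕)) ⟩
    S η ∷ S (S ε) ∷ S (θ ⊕) ∷ ε ∷ []       ≋⟨ at 0 (⇑ snake-η-Sε) ⟩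
    S (θ ⊕) ∷ ε ∷ []                       ■

  -- `ψ` is application with its argument bent up by η, so `ψ-Sε` is a snake and gives `app = B`.
  -- `φ` is abstraction with its bound strand bent down by ε; its `C ⊕` and `θ ⊕` compensate the
  -- inverse braid and inverse dual twist in the definition of `lam`, as `Sη-φ` shows.
  φ ψ : Carrier
  φ = ⟦ Tr ∷ S (C ⊕) ∷ S (θ ⊕) ∷ S ε ∷ [] ⟧
  ψ = ⟦ S η ∷ B ∷ [] ⟧

  φ-word : φ ∷ [] ≋ Tr ∷ S (C ⊕) ∷ S (θ ⊕) ∷ S ε ∷ []
  φ-word = ⌊ refl ⌋

  ψ-word : ψ ∷ [] ≋ S η ∷ B ∷ []
  ψ-word = ⌊ refl ⌋

  φ-arity : φ ∶ 2 ⇒ 1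
  φ-arity = ∘-arity (weaken 1 Tr-arity) (∘-arity (S-arity (C-arity ⊕))
    (∘-arity (S-arity (weaken 1 (θ-arity ⊕))) (S-arity ε-arity)))

  ψ-arity : ψ ∶ 1 ⇒ 2
  ψ-arity = ∘-arity (S-arity η-arity) (weaken 1 B-arity)

  -- This half is eta: moving both ends of the dual strand around turns the composite into the trace
  -- form of `Tr·-via-dual`, whose closed body is that of `eta`.
  ψ-φ : ψ ∷ φ ∷ [] ≋ []
  ψ-φ =
    ψ ∷ φ ∷ []                                                                                  ≋⟨ at 0 ψ-word ⟩
    S η ∷ B ∷ φ ∷ []                                                                            ≋⟨ at 2 φ-word ⟩
    S η ∷ B ∷ Tr ∷ S (C ⊕) ∷ S (θ ⊕) ∷ S ε ∷ []                                                 ≋⟨ at 3 (⇑ (Sθ-C ⊕ ⊕)) ⟨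
    S η ∷ B ∷ Tr ∷ S (S (θ ⊕)) ∷ S (C ⊕) ∷ S ε ∷ []                                             ≋⟨ at 2 Tr-S ⟩
    S η ∷ B ∷ S (θ ⊕) ∷ Tr ∷ S (C ⊕) ∷ S ε ∷ []                                                 ≋⟨ at 1 B-S′ ⟩
    S η ∷ S (S (θ ⊕)) ∷ B ∷ Tr ∷ S (C ⊕) ∷ S ε ∷ []                                             ≋⟨ at 0 (⇑ η-θ) ⟨
    S η ∷ S (θ ⊕) ∷ B ∷ Tr ∷ S (C ⊕) ∷ S ε ∷ []                                                 ≋⟨ at 0 (0⇒2-C ⊖ η-arity) ⟨
    η ∷ S (C ⊖) ∷ C ⊖ ∷ S (θ ⊕) ∷ B ∷ Tr ∷ S (C ⊕) ∷ S ε ∷ []                                   ≋⟨ at 2 (θ-C ⊖ ⊕) ⟨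
    η ∷ S (C ⊖) ∷ θ ⊕ ∷ C ⊖ ∷ B ∷ Tr ∷ S (C ⊕) ∷ S ε ∷ []                                       ≋⟨ at 1 (θ-S ⊕) ⟨
    η ∷ θ ⊕ ∷ S (C ⊖) ∷ C ⊖ ∷ B ∷ Tr ∷ S (C ⊕) ∷ S ε ∷ []                                       ≋⟨ at 4 (⇑ (C-inverse ⊕)) ⟨
    η ∷ θ ⊕ ∷ S (C ⊖) ∷ C ⊖ ∷ S (C ⊕) ∷ S (C ⊖) ∷ B ∷ Tr ∷ S (C ⊕) ∷ S ε ∷ []                   ≋⟨ at 2 (YB-left ⊖) ⟨
    η ∷ θ ⊕ ∷ C ⊕ ∷ S (C ⊖) ∷ C ⊖ ∷ S (C ⊖) ∷ B ∷ Tr ∷ S (C ⊕) ∷ S ε ∷ []                       ≋⟨ at 4 (SB-C ⊖) ⟨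
    η ∷ θ ⊕ ∷ C ⊕ ∷ S (C ⊖) ∷ S B ∷ C ⊖ ∷ Tr ∷ S (C ⊕) ∷ S ε ∷ []                               ≋⟨ at 5 (C-1⇒2 ⊖ Tr-arity) ⟩
    η ∷ θ ⊕ ∷ C ⊕ ∷ S (C ⊖) ∷ S B ∷ S Tr ∷ C ⊖ ∷ S (C ⊖) ∷ S (C ⊕) ∷ S ε ∷ []                   ≋⟨ at 7 (⇑ (C-inverse ⊖)) ⟩
    η ∷ θ ⊕ ∷ C ⊕ ∷ S (C ⊖) ∷ S B ∷ S Tr ∷ C ⊖ ∷ S ε ∷ []                                       ≋⟨ at 7 (C-2⇒0 ⊕ ε-arity) ⟨
    η ∷ θ ⊕ ∷ C ⊕ ∷ S (C ⊖) ∷ S B ∷ S Tr ∷ C ⊖ ∷ C ⊕ ∷ S (C ⊕) ∷ ε ∷ []                         ≋⟨ at 6 (C-inverse ⊖) ⟩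
    η ∷ θ ⊕ ∷ C ⊕ ∷ S (C ⊖) ∷ S B ∷ S Tr ∷ S (C ⊕) ∷ ε ∷ []                                     ≋⟨ Tr·-via-dual ⊕ (C ⊖ ∷ B ∷ Tr ∷ C ⊕ ∷ []) ⟨
    Tr · ⟦ C ⊖ ∷ B ∷ Tr ∷ C ⊕ ∷ [] ⟧ ∷ []                                                       ≋⟨ at 0 (atom (eta ⊕)) ⟩
    I ∷ []                                                                                      ≋⟨ I-drop ⟩
    []                                                                                          ■

  -- This half is beta: the `Tr` of `φ` meets the `B` of `ψ`. In the resulting loop the twists
  -- cancel through `θ-ε`, and a snake remains.
  φ-ψ : φ ∷ ψ ∷ [] ≋ []
  φ-ψ =
    φ ∷ ψ ∷ []                                                             ≋⟨ at 0 φ-word ⟩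
    Tr ∷ S (C ⊕) ∷ S (θ ⊕) ∷ S ε ∷ ψ ∷ []                                  ≋⟨ at 4 ψ-word ⟩
    Tr ∷ S (C ⊕) ∷ S (θ ⊕) ∷ S ε ∷ S η ∷ B ∷ []                            ≋⟨ tr-loop (C ⊕ ∷ θ ⊕ ∷ ε ∷ η ∷ []) ⟩
    S (Tr · ⟦ C ⊕ ∷ θ ⊕ ∷ ε ∷ η ∷ [] ⟧) ∷ []                               ≋⟨ ⇑ (
      Tr · ⟦ C ⊕ ∷ θ ⊕ ∷ ε ∷ η ∷ [] ⟧ ∷ []                                   ≋⟨ Tr·-via-dual ⊖ (C ⊕ ∷ θ ⊕ ∷ ε ∷ η ∷ []) ⟩
      η ∷ θ ⊖ ∷ C ⊖ ∷ S (C ⊕) ∷ S (θ ⊕) ∷ S ε ∷ S η ∷ ε ∷ []                 ≋⟨ at 6 snake-Sη-ε ⟩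
      η ∷ θ ⊖ ∷ C ⊖ ∷ S (C ⊕) ∷ S (θ ⊕) ∷ S ε ∷ []                           ≋⟨ at 4 (⇑ θ-ε) ⟩
      η ∷ θ ⊖ ∷ C ⊖ ∷ S (C ⊕) ∷ S (S (θ ⊕)) ∷ S ε ∷ []                       ≋⟨ at 1 (θ-C ⊖ ⊖) ⟩
      η ∷ C ⊖ ∷ S (θ ⊖) ∷ S (C ⊕) ∷ S (S (θ ⊕)) ∷ S ε ∷ []                   ≋⟨ at 2 (⇑ (θ-C ⊕ ⊖)) ⟩
      η ∷ C ⊖ ∷ S (C ⊕) ∷ S (S (θ ⊖)) ∷ S (S (θ ⊕)) ∷ S ε ∷ []               ≋⟨ at 3 (⇑ (⇑ (θ-inverse ⊖))) ⟩
      η ∷ C ⊖ ∷ S (C ⊕) ∷ S ε ∷ []                                           ≋⟨ at 3 (C-2⇒0 ⊕ ε-arity) ⟨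
      η ∷ C ⊖ ∷ S (C ⊕) ∷ C ⊕ ∷ S (C ⊕) ∷ ε ∷ []                             ≋⟨ at 1 (YB-left ⊕) ⟩
      η ∷ S (C ⊕) ∷ C ⊕ ∷ S (C ⊖) ∷ S (C ⊕) ∷ ε ∷ []                         ≋⟨ at 3 (⇑ (C-inverse ⊖)) ⟩
      η ∷ S (C ⊕) ∷ C ⊕ ∷ ε ∷ []                                             ≋⟨ at 0 (0⇒2-C ⊕ η-arity) ⟩
      S η ∷ ε ∷ []                                                           ≋⟨ snake-Sη-ε ⟩
      []                                                                     ■) ⟩
    []                                                                     ■

  ψ-Sε : ψ ∷ S ε ∷ [] ≋ B ∷ []
  ψ-Sε =
    ψ ∷ S ε ∷ []                       ≋⟨ at 0 ψ-word ⟩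
    S η ∷ B ∷ S ε ∷ []                 ≋⟨ at 1 B-S′ ⟩
    S η ∷ S (S ε) ∷ B ∷ []             ≋⟨ at 0 (⇑ snake-η-Sε) ⟩
    B ∷ []                             ■

  Sη-φ : S η ∷ S (S (θ ⊖)) ∷ S (C ⊖) ∷ φ ∷ [] ≋ Tr ∷ []
  Sη-φ =
    S η ∷ S (S (θ ⊖)) ∷ S (C ⊖) ∷ φ ∷ []                                     ≋⟨ at 3 φ-word ⟩
    S η ∷ S (S (θ ⊖)) ∷ S (C ⊖) ∷ Tr ∷ S (C ⊕) ∷ S (θ ⊕) ∷ S ε ∷ []          ≋⟨ at 2 Tr-S ⟨
    S η ∷ S (S (θ ⊖)) ∷ Tr ∷ S (S (C ⊖)) ∷ S (C ⊕) ∷ S (θ ⊕) ∷ S ε ∷ []      ≋⟨ at 1 Tr-S ⟨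
    S η ∷ Tr ∷ S (S (S (θ ⊖))) ∷ S (S (C ⊖)) ∷ S (C ⊕) ∷ S (θ ⊕) ∷ S ε ∷ []  ≋⟨ at 0 Tr-S ⟨
    Tr ∷ S (S η) ∷ S (S (S (θ ⊖))) ∷ S (S (C ⊖)) ∷ S (C ⊕) ∷ S (θ ⊕) ∷ S ε ∷ []  ≋⟨ at 1 (⇑ (
      S η ∷ S (S (θ ⊖)) ∷ S (C ⊖) ∷ C ⊕ ∷ θ ⊕ ∷ ε ∷ []                         ≋⟨ at 0 (0⇒2-C ⊖ η-arity) ⟨
      η ∷ S (C ⊖) ∷ C ⊖ ∷ S (S (θ ⊖)) ∷ S (C ⊖) ∷ C ⊕ ∷ θ ⊕ ∷ ε ∷ []           ≋⟨ at 2 (C-S² ⊖) ⟩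
      η ∷ S (C ⊖) ∷ S (S (θ ⊖)) ∷ C ⊖ ∷ S (C ⊖) ∷ C ⊕ ∷ θ ⊕ ∷ ε ∷ []           ≋⟨ at 1 (⇑ (θ-C ⊖ ⊖)) ⟨
      η ∷ S (θ ⊖) ∷ S (C ⊖) ∷ C ⊖ ∷ S (C ⊖) ∷ C ⊕ ∷ θ ⊕ ∷ ε ∷ []               ≋⟨ at 3 (YB-right ⊖) ⟩
      η ∷ S (θ ⊖) ∷ S (C ⊖) ∷ S (C ⊕) ∷ C ⊖ ∷ S (C ⊖) ∷ θ ⊕ ∷ ε ∷ []           ≋⟨ at 2 (⇑ (C-inverse ⊖)) ⟩
      η ∷ S (θ ⊖) ∷ C ⊖ ∷ S (C ⊖) ∷ θ ⊕ ∷ ε ∷ []                               ≋⟨ at 3 (θ-S ⊕) ⟨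
      η ∷ S (θ ⊖) ∷ C ⊖ ∷ θ ⊕ ∷ S (C ⊖) ∷ ε ∷ []                               ≋⟨ at 2 (Sθ-C ⊖ ⊕) ⟨
      η ∷ S (θ ⊖) ∷ S (θ ⊕) ∷ C ⊖ ∷ S (C ⊖) ∷ ε ∷ []                           ≋⟨ at 1 (⇑ (θ-inverse ⊖)) ⟩
      η ∷ C ⊖ ∷ S (C ⊖) ∷ ε ∷ []                                               ≋⟨ at 1 (C-2⇒0 ⊖ ε-arity) ⟩
      η ∷ S ε ∷ []                                                             ≋⟨ snake-η-Sε ⟩
      []                                                                       ■)) ⟩
    Tr ∷ []                                                                  ■

  -- The trace of a ribbon category closes the last strand while `Tr ·` closes the first, hence the
  -- `C ⊕` behind `f`. The shape 1 → 2 is the one in which `F` takes its trace.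
  right-trace : ∀ {f} → f ∶ 1 ⇒ 2 →
    η ∷ f ∷ S (C ⊕) ∷ S (S (θ ⊕)) ∷ S ε ∷ [] ≋ Tr · ⟦ f ∷ C ⊕ ∷ [] ⟧ ∷ []
  right-trace {f} f⇒ =
    η ∷ f ∷ S (C ⊕) ∷ S (S (θ ⊕)) ∷ S ε ∷ []             ≋⟨ at 3 (⇑ θ-ε) ⟨
    η ∷ f ∷ S (C ⊕) ∷ S (θ ⊕) ∷ S ε ∷ []                 ≋⟨ at 2 (⇑ (Sθ-C ⊕ ⊕)) ⟨
    η ∷ f ∷ S (S (θ ⊕)) ∷ S (C ⊕) ∷ S ε ∷ []             ≋⟨ at 1 (interchange f⇒ (θ ⊕)) ⟩
    η ∷ S (θ ⊕) ∷ f ∷ S (C ⊕) ∷ S ε ∷ []                 ≋⟨ at 0 η-θ ⟨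
    η ∷ θ ⊕ ∷ f ∷ S (C ⊕) ∷ S ε ∷ []                     ≋⟨ at 4 (C-2⇒0 ⊕ ε-arity) ⟨
    η ∷ θ ⊕ ∷ f ∷ S (C ⊕) ∷ C ⊕ ∷ S (C ⊕) ∷ ε ∷ []       ≋⟨ at 2 (C-S[1⇒2] ⊕ f⇒) ⟨
    η ∷ θ ⊕ ∷ C ⊕ ∷ S f ∷ S (C ⊕) ∷ ε ∷ []               ≋⟨ Tr·-via-dual ⊕ (f ∷ C ⊕ ∷ []) ⟨
    Tr · ⟦ f ∷ C ⊕ ∷ [] ⟧ ∷ []                           ■

  -- Abstraction of all inputs

  trs : ℕ → Carrier → Carrier
  trs zero    g = g
  trs (suc k) g = trs k (Tr · g)

  ^-comm : ∀ a k → a ∘ (a ^ k) ≡ (a ^ k) ∘ a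
  ^-comm a zero    = trans (∘-identityʳ a) (sym (∘-identityˡ a))
  ^-comm a (suc k) = trans (cong (a ∘_) (^-comm a k)) (sym (∘-assoc a (a ^ k) a))

  tr-loops : ∀ k g → Tr ^ k ∷ S g ∷ B ^ k ∷ [] ≋ S (trs k g) ∷ []
  tr-loops zero    g =
    I ∷ S g ∷ I ∷ []                         ≋⟨ at 0 I-drop ⟩
    S g ∷ I ∷ []                             ≋⟨ at 1 I-drop ⟩
    S g ∷ []                                 ■
  tr-loops (suc k) g =
    Tr ^ suc k ∷ S g ∷ B ^ suc k ∷ []        ≋⟨ at 2 ∘-fuse ⟨
    Tr ^ suc k ∷ S g ∷ B ∷ B ^ k ∷ []        ≋⟨ at 0 (atom (^-comm Tr k)) ⟩
    Tr ^ k ∘ Tr ∷ S g ∷ B ∷ B ^ k ∷ []       ≋⟨ at 0 ∘-fuse ⟨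
    Tr ^ k ∷ Tr ∷ S g ∷ B ∷ B ^ k ∷ []       ≋⟨ at 1 (tr-loop (g ∷ [])) ⟩
    Tr ^ k ∷ S (Tr · g) ∷ B ^ k ∷ []         ≋⟨ tr-loops k (Tr · g) ⟩
    S (trs (suc k) g) ∷ []                   ■

  C-SB^ : ∀ s k → let s̄ = opposite s in C s ∷ S (B ^ k) ∷ [] ≋ S (c s̄ k) ∷ B ^ k ∷ C s ∷ []
  C-SB^ s zero    =
    C s ∷ S I ∷ []                                       ≋⟨ at 1 S-I-drop ⟩
    C s ∷ []                                             ≋⟨ at 0 S-I-drop ⟨
    S I ∷ C s ∷ []                                       ≋⟨ at 1 I-drop ⟨
    S I ∷ I ∷ C s ∷ []                                   ■
  C-SB^ s (suc k) = let s̄ = opposite s in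
    C s ∷ S (B ^ suc k) ∷ []                             ≋⟨ at 1 S-fuse ⟨
    C s ∷ S B ∷ S (B ^ k) ∷ []                           ≋⟨ at 0 (C-SB s) ⟩
    S (C s̄) ∷ B ∷ C s ∷ S (B ^ k) ∷ []                   ≋⟨ at 2 (C-SB^ s k) ⟩
    S (C s̄) ∷ B ∷ S (c s̄ k) ∷ B ^ k ∷ C s ∷ []           ≋⟨ at 1 B-S′ ⟩
    S (C s̄) ∷ S (S (c s̄ k)) ∷ B ∷ B ^ k ∷ C s ∷ []       ≋⟨ at 0 S-fuse ⟩
    S (c s̄ (suc k)) ∷ B ∷ B ^ k ∷ C s ∷ []               ≋⟨ at 1 ∘-fuse ⟩
    S (c s̄ (suc k)) ∷ B ^ suc k ∷ C s ∷ []               ■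

  c-tw-d-θ : ∀ s k → c s k ∷ tw s k ∷ d s k ∷ θ s ∷ [] ≋ tw s (suc k) ∷ []
  c-tw-d-θ s k = let s̄ = opposite s in
    c s k ∷ tw s k ∷ d s k ∷ θ s ∷ []                    ≋⟨ at 0 (θ-inverse′ s) ⟨
    θ s̄ ∷ θ s ∷ c s k ∷ tw s k ∷ d s k ∷ θ s ∷ []        ≋⟨ at 1 (tw-suc s k) ⟨
    θ s̄ ∷ tw s (suc k) ∷ θ s ∷ []                        ≋⟨ at 1 (tw-natural s (weaken k (θ-arity s))) ⟨
    θ s̄ ∷ θ s ∷ tw s (suc k) ∷ []                        ≋⟨ at 0 (θ-inverse′ s) ⟩
    tw s (suc k) ∷ []                                    ■

  -- Feeding the k strands that h leaves behind back into its first k inputs;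
  -- the extra j inputs only serve the induction.
  trs-c : ∀ s k j {h} → h ∶ k + j ⇒ 1 → trs k (h ∘ c s k) ∷ [] ≋ br s j k ∷ tw s k ∷ h ∷ []
  trs-c s zero    j {h} h⇒ =
    h ∘ I ∷ []                                               ≋⟨ at 0 (atom (∘-identityʳ h)) ⟩
    h ∷ []                                                   ≋⟨ at 0 I-drop ⟨
    I ∷ h ∷ []                                               ≋⟨ at 0 I-drop ⟨
    I ∷ I ∷ h ∷ []                                           ■
  trs-c s (suc k) j {h} h⇒ =
    -- Closing one strand is a yank: naturality pulls `h` out past the first crossing, which is left
    -- bare in the loop and becomes `θ s`. The outcome `h′` has one looped strand fewer and one
    -- spectator more, so `j` grows as `k` shrinks.
    trs k (Tr · (h ∘ c s (suc k))) ∷ []                      ≋⟨ atom (cong (trs k) (value close)) ⟩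
    trs k (h′ ∘ c s k) ∷ []                                  ≋⟨ trs-c s k (suc j) h′⇒ ⟩
    br s (suc j) k ∷ tw s k ∷ h′ ∷ []                        ≋⟨ at 2 h′-word ⟩
    br s (suc j) k ∷ tw s k ∷ d s (k + j) ∷ θ s ∷ h ∷ []     ≋⟨ at 2 (d-+ s k j) ⟩
    br s (suc j) k ∷ tw s k ∷ shift k (d s j) ∷ d s k ∷ θ s ∷ h ∷ []
      ≋⟨ at 1 (interchange (tw-arity s k) (d s j)) ⟩
    br s (suc j) k ∷ shift k (d s j) ∷ tw s k ∷ d s k ∷ θ s ∷ h ∷ []
      ≋⟨ at 0 (br-naturalˡ s k (d-arity s j)) ⟨
    d s j ∷ br s (suc j) k ∷ tw s k ∷ d s k ∷ θ s ∷ h ∷ []           ≋⟨ at 1 (br-suc s j k) ⟩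
    d s j ∷ S (br s j k) ∷ c s k ∷ tw s k ∷ d s k ∷ θ s ∷ h ∷ []     ≋⟨ at 2 (c-tw-d-θ s k) ⟩
    d s j ∷ S (br s j k) ∷ tw s (suc k) ∷ h ∷ []             ≋⟨ at 0 ∘-fuse ⟩
    br s j (suc k) ∷ tw s (suc k) ∷ h ∷ []                   ■
    where
    h′ : Carrier
    h′ = ⟦ d s (k + j) ∷ θ s ∷ h ∷ [] ⟧
    h′-word : h′ ∷ [] ≋ d s (k + j) ∷ θ s ∷ h ∷ []
    h′-word = ⌊ refl ⌋
    h′⇒ : h′ ∶ k + suc j ⇒ 1
    h′⇒ = subst (λ m → h′ ∶ m ⇒ 1) (sym (+-suc k j))
      (∘-arity (d-arity s (k + j)) (∘-arity (weaken (k + j) (θ-arity s)) h⇒))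
    close : Tr · (h ∘ c s (suc k)) ∷ [] ≋ h′ ∷ c s k ∷ []
    close =
      Tr · ⟦ h ∷ c s (suc k) ∷ [] ⟧ ∷ []                     ≋⟨ tr (
        h ∷ c s (suc k) ∷ []                                   ≋⟨ at 1 ∘-fuse ⟨
        h ∷ C s ∷ S (c s k) ∷ []                               ≋⟨ at 1 (d-1 s) ⟨
        h ∷ d s 1 ∷ S (c s k) ∷ []                             ≋⟨ at 0 (d-natural s h⇒) ⟩
        d s (suc k + j) ∷ S h ∷ S (c s k) ∷ []                 ≋⟨ at 0 ∘-fuse ⟨
        S (d s (k + j)) ∷ C s ∷ S h ∷ S (c s k) ∷ []           ■) ⟩
      Tr · ⟦ S (d s (k + j)) ∷ C s ∷ S h ∷ S (c s k) ∷ [] ⟧ ∷ []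
        ≋⟨ tr-pull (d s (k + j) ∷ []) (C s ∷ []) (h ∷ c s k ∷ []) ⟩
      d s (k + j) ∷ Tr · C s ∷ h ∷ c s k ∷ []                ≋⟨ at 1 (tr-C s) ⟩
      d s (k + j) ∷ θ s ∷ h ∷ c s k ∷ []                     ≋⟨ at 0 h′-word ⟨
      h′ ∷ c s k ∷ []                                        ■

  ^-merge : ∀ n {a} → a ∶ 2 ⇒ 1 → a ^ n ∶ suc n ⇒ 1
  ^-merge zero    a⇒ = I-arity 1
  ^-merge (suc n) a⇒ = ∘-arity (weaken n a⇒) (^-merge n a⇒)

  ^-split : ∀ n {a} → a ∶ 1 ⇒ 2 → a ^ n ∶ 1 ⇒ suc n
  ^-split zero    a⇒ = I-arity 1
  ^-split (suc n) {a} a⇒ = subst (λ x → x ∶ 1 ⇒ suc (suc n)) (sym (^-comm a n))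
    (∘-arity (^-split n a⇒) (weaken n a⇒))

  module _ {f m n} (f⇒ : f ∶ m ⇒ n) where

    abstraction-body : Carrier
    abstraction-body = Tr ^ suc m ∘ S (S f ∘ (B ^ n))

    private
      h = S f ∘ (B ^ n)

      h⇒ : h ∶ suc m ⇒ 1
      h⇒ = ∘-arity (S-arity f⇒) (^-merge n B-arity)

    abstraction-body-arity : abstraction-body ∶ 1 ⇒ 2
    abstraction-body-arity = ∘-arity (^-split (suc m) Tr-arity) (S-arity h⇒)

    -- The left side is `F` of `f` after its trace is rewritten by `right-trace`. With `B ^ k`
    -- appended every abstraction becomes a loop, `trs-c` resolves all loops into `tw ⊖ k`, and the
    -- twist from the outer closure cancels it. What remains is one side of the arity equation of
    -- `f`.
    abstraction : Tr · ⟦ abstraction-body ∷ C ⊕ ∷ [] ⟧ ≡ f •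
    abstraction = ·I-injective (Tr·-arity (∘-arity abstraction-body-arity (C-arity ⊕))) (•-arity f)
      -- Both sides have arity 0 → 1, so their values at `I` suffice, and these do not see the
      -- appended powers of `B`.
      (trans (sym (∘B^-·I _ (suc m))) (trans (app-eq (value after-B^) I) (∘B^-·I _ (suc m))))
      where
      k = suc m
      h⇒₀ : h ∶ k + 0 ⇒ 1
      h⇒₀ = subst (λ i → h ∶ i ⇒ 1) (+-comm 0 k) h⇒
      after-B^ : Tr · ⟦ abstraction-body ∷ C ⊕ ∷ [] ⟧ ∷ B ^ k ∷ [] ≋ f • ∷ B ^ k ∷ []
      after-B^ =
        Tr · ⟦ abstraction-body ∷ C ⊕ ∷ [] ⟧ ∷ B ^ k ∷ []
          ≋⟨ tr-pull [] (abstraction-body ∷ C ⊕ ∷ []) (B ^ k ∷ []) ⟨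
        Tr · ⟦ abstraction-body ∷ C ⊕ ∷ S (B ^ k) ∷ [] ⟧ ∷ []
          ≋⟨ tr (
            abstraction-body ∷ C ⊕ ∷ S (B ^ k) ∷ []              ≋⟨ at 1 (C-SB^ ⊕ k) ⟩
            abstraction-body ∷ S (c ⊖ k) ∷ B ^ k ∷ C ⊕ ∷ []      ≋⟨ at 0 ∘-fuse ⟨
            Tr ^ k ∷ S h ∷ S (c ⊖ k) ∷ B ^ k ∷ C ⊕ ∷ []          ≋⟨ at 1 S-fuse ⟩
            Tr ^ k ∷ S (h ∘ c ⊖ k) ∷ B ^ k ∷ C ⊕ ∷ []            ≋⟨ at 0 (tr-loops k (h ∘ c ⊖ k)) ⟩
            S (trs k (h ∘ c ⊖ k)) ∷ C ⊕ ∷ []                     ■) ⟩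
        Tr · ⟦ S (trs k (h ∘ c ⊖ k)) ∷ C ⊕ ∷ [] ⟧ ∷ []
          ≋⟨ tr-pull (trs k (h ∘ c ⊖ k) ∷ []) (C ⊕ ∷ []) [] ⟩
        trs k (h ∘ c ⊖ k) ∷ Tr · C ⊕ ∷ []                ≋⟨ at 1 (tr-C ⊕) ⟩
        trs k (h ∘ c ⊖ k) ∷ θ ⊕ ∷ []                     ≋⟨ at 0 (trs-c ⊖ k 0 h⇒₀) ⟩
        br ⊖ 0 k ∷ tw ⊖ k ∷ h ∷ θ ⊕ ∷ []                 ≋⟨ at 0 (br-0 ⊖ k) ⟩
        tw ⊖ k ∷ h ∷ θ ⊕ ∷ []                            ≋⟨ at 0 (tw-natural ⊖ h⇒) ⟨
        h ∷ tw ⊖ 1 ∷ θ ⊕ ∷ []                            ≋⟨ at 1 (tw-1 ⊖) ⟩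
        h ∷ θ ⊖ ∷ θ ⊕ ∷ []                               ≋⟨ at 1 (θ-inverse ⊖) ⟩
        h ∷ []                                           ≋⟨ at 0 ∘-fuse ⟨
        S f ∷ B ^ n ∷ []                                 ≋⟨ equation f⇒ ⟨
        f • ∷ B ∷ B ^ m ∷ []                             ≋⟨ at 1 ∘-fuse ⟩
        f • ∷ B ^ k ∷ []                                 ■

  -- The internal PROB

  typing : ∀ {m n} (f : Hom m n) → elt f ∶ m ⇒ n
  typing f = ⌈ ⌊ Hom.arity f ⌋ ⌉

  hom : ∀ {a m n} → a ∶ m ⇒ n → Hom m n
  hom {a} a⇒ = ⟨ a , value (equation a⇒) ⟩

  elt-cast : ∀ {m m′ n n′} (p : m ≡ m′) (q : n ≡ n′) (f : Hom m n) →
             elt (cast (InternalPROB.Hom 𝒜) p q f) ≡ elt f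
  elt-cast refl refl f = refl

  ∘-shift-I : ∀ n x → x ∘ shift n I ≡ x
  ∘-shift-I n x = trans (cong (x ∘_) (shift-I n)) (∘-identityʳ x)

  cast-⊗id : ∀ {m m′ n n′ x} (p : m ≡ m′) (q : n ≡ n′) (f : Hom m n) k →
             elt f ≡ x ∘ shift k I → elt (cast (InternalPROB.Hom 𝒜) p q f) ≡ x
  cast-⊗id p q f k e = trans (elt-cast p q f) (trans e (∘-shift-I k _))

  cast-id⊗ : ∀ {m m′ n n′ x} (p : m ≡ m′) (q : n ≡ n′) (f : Hom m n) →
             elt f ≡ I ∘ x → elt (cast (InternalPROB.Hom 𝒜) p q f) ≡ x
  cast-id⊗ p q f e = trans (elt-cast p q f) (trans e (∘-identityˡ _))

  ⊗-arity : ∀ {a b m m′ n n′} → a ∶ m ⇒ n → b ∶ m′ ⇒ n′ → a ∘ shift n b ∶ m + m′ ⇒ n + n′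
  ⊗-arity {m′ = m′} {n} a⇒ b⇒ = ∘-arity (weaken m′ a⇒) (shift-arity n b⇒)

  monoidal : StrictMonoidalCategory ℕ (InternalPROB.Hom 𝒜) (InternalPROB._≈_ 𝒜) 0 _+_
  monoidal = record
    { ≈-equiv = record { refl = refl ; sym = sym ; trans = trans }
    ; _⨾_     = λ f g → hom (∘-arity (typing f) (typing g))
    ; id      = λ {n} → hom (I-arity n)
    ; ⨾-cong  = cong₂ _∘_
    ; ⨾-assoc = λ f g h → ∘-assoc (elt f) (elt g) (elt h)
    ; id-⨾    = λ f → ∘-identityˡ (elt f)
    ; ⨾-id    = λ f → ∘-identityʳ (elt f)
    ; _⊗₁_    = λ f g → hom (⊗-arity (typing f) (typing g))
    ; ⊗-cong  = λ {b = n} → cong₂ (λ x y → x ∘ shift n y)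
    ; ⊗-id    = λ {n} → ∘-shift-I n I
    ; ⊗-⨾     = λ {b = l} {n} f g f′ g′ → value (exchange l n (typing g) (elt f) (elt f′) (elt g′))
    ; assoc₀  = +-assoc
    ; unitˡ₀  = λ _ → refl
    ; unitʳ₀  = +-identityʳ
    ; assoc₁  = λ {a} {b} {c} {a′} {b′} {c′} f g h →
        trans (elt-cast (+-assoc a b c) (+-assoc a′ b′ c′) _)
              (value (reassociate a′ b′ (elt f) (elt g) (elt h)))
    ; unitˡ₁  = λ f → ∘-identityˡ (elt f)
    ; unitʳ₁  = λ {a} {b} f → cast-⊗id (+-identityʳ a) (+-identityʳ b) _ b refl
    }
    where
    exchange : ∀ l n {g} → g ∶ l ⇒ n → ∀ f f′ g′ →
      (f ∘ g) ∘ shift n (f′ ∘ g′) ∷ [] ≋ (f ∘ shift l f′) ∘ (g ∘ shift n g′) ∷ []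
    exchange l n {g} g⇒ f f′ g′ =
      (f ∘ g) ∘ shift n (f′ ∘ g′) ∷ []               ≋⟨ ∘-fuse ⟨
      f ∘ g ∷ shift n (f′ ∘ g′) ∷ []                 ≋⟨ at 0 ∘-fuse ⟨
      f ∷ g ∷ shift n (f′ ∘ g′) ∷ []                 ≋⟨ at 2 (⇑[ n ] ∘-fuse) ⟨
      f ∷ g ∷ shift n f′ ∷ shift n g′ ∷ []           ≋⟨ at 1 (interchange g⇒ f′) ⟩
      f ∷ shift l f′ ∷ g ∷ shift n g′ ∷ []           ≋⟨ at 0 ∘-fuse ⟩
      f ∘ shift l f′ ∷ g ∷ shift n g′ ∷ []           ≋⟨ at 1 ∘-fuse ⟩
      f ∘ shift l f′ ∷ g ∘ shift n g′ ∷ []           ≋⟨ ∘-fuse ⟩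
      (f ∘ shift l f′) ∘ (g ∘ shift n g′) ∷ []       ■
    reassociate : ∀ a b f g h →
      (f ∘ shift a g) ∘ shift (a + b) h ∷ [] ≋ f ∘ shift a (g ∘ shift b h) ∷ []
    reassociate a b f g h =
      (f ∘ shift a g) ∘ shift (a + b) h ∷ []         ≋⟨ ∘-fuse ⟨
      f ∘ shift a g ∷ shift (a + b) h ∷ []           ≋⟨ at 0 ∘-fuse ⟨
      f ∷ shift a g ∷ shift (a + b) h ∷ []           ≋⟨ at 2 (atom (shift-+ a b h)) ⟩
      f ∷ shift a g ∷ shift a (shift b h) ∷ []       ≋⟨ at 1 (⇑[ a ] ∘-fuse) ⟩
      f ∷ shift a (g ∘ shift b h) ∷ []               ≋⟨ ∘-fuse ⟩
      f ∘ shift a (g ∘ shift b h) ∷ []               ■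

  -- The given braid has a separate clause for n = 1, where the recursion of `br` leaves a trailing
  -- `S I`; hence equality is propositional only.
  σᴰ-br : ∀ m n → br ⊕ m n ≡ σᴰ m n
  σᴰ-br m zero          = refl
  σᴰ-br m (suc zero)    = trans (value (br-1ʳ ⊕ m)) (d-σ₁ m)
    where
    d-σ₁ : ∀ m → d ⊕ m ≡ σ₁ᴰ m
    d-σ₁ zero    = refl
    d-σ₁ (suc m) = cong (λ x → S x ∘ C ⊕) (d-σ₁ m)
  σᴰ-br m (suc (suc n)) = cong₂ (λ x y → x ∘ S y) (trans (sym (value (br-1ʳ ⊕ m))) (σᴰ-br m 1)) (σᴰ-br m (suc n))

  θᴰ-tw : ∀ n → tw ⊕ n ≡ θᴰ n
  θᴰ-tw zero          = refl
  θᴰ-tw (suc zero)    = value (tw-1 ⊕)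
  θᴰ-tw (suc (suc n)) = cong (θ ⊕ ∘_) (cong₂ _∘_
    (trans (sym (value (br-1ˡ ⊕ (suc n)))) (σᴰ-br 1 (suc n)))
    (cong₂ _∘_ (θᴰ-tw (suc n)) (trans (sym (value (br-1ʳ ⊕ (suc n)))) (σᴰ-br (suc n) 1))))

  -- The ribbon structure

  br⇒ : ∀ s m n → br s m n ∶ m + n ⇒ n + m
  br⇒ s m n = subst (λ k → br s m n ∶ k ⇒ n + m) (+-comm n m) (br-arity s m n)

  -- All positive objects are isomorphic to 1 through powers of φ, and 1 is
  -- self-dual, so 1 serves as the dual of every positive object.
  dual : ℕ → ℕ
  dual zero    = 0
  dual (suc n) = 1

  ηₙ εₙ : ℕ → Carrier
  ηₙ zero    = I
  ηₙ (suc n) = η ∘ (ψ ^ n)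
  εₙ zero    = I
  εₙ (suc n) = S (φ ^ n) ∘ ε

  ηₙ-arity : ∀ n → ηₙ n ∶ 0 ⇒ n + dual n
  ηₙ-arity zero    = I-arity 0
  ηₙ-arity (suc n) = ∘-arity η-arity (weaken 1 (^-split n ψ-arity))

  εₙ-arity : ∀ n → εₙ n ∶ dual n + n ⇒ 0
  εₙ-arity zero    = I-arity 0
  εₙ-arity (suc n) = ∘-arity (S-arity (^-merge n φ-arity)) ε-arity

  ψ^-φ^ : ∀ n → ψ ^ n ∷ φ ^ n ∷ [] ≋ []
  ψ^-φ^ zero    = ⌊ ∘-identityˡ I ⌋
  ψ^-φ^ (suc n) =
    ψ ^ suc n ∷ φ ^ suc n ∷ []               ≋⟨ at 0 (atom (^-comm ψ n)) ⟩
    (ψ ^ n) ∘ ψ ∷ φ ^ suc n ∷ []             ≋⟨ at 0 ∘-fuse ⟨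
    ψ ^ n ∷ ψ ∷ φ ^ suc n ∷ []               ≋⟨ at 2 ∘-fuse ⟨
    ψ ^ n ∷ ψ ∷ φ ∷ φ ^ n ∷ []               ≋⟨ at 1 ψ-φ ⟩
    ψ ^ n ∷ φ ^ n ∷ []                       ≋⟨ ψ^-φ^ n ⟩
    []                                       ■

  φ^-ψ^ : ∀ n → φ ^ n ∷ ψ ^ n ∷ [] ≋ []
  φ^-ψ^ zero    = ⌊ ∘-identityˡ I ⌋
  φ^-ψ^ (suc n) =
    φ ^ suc n ∷ ψ ^ suc n ∷ []               ≋⟨ at 1 (atom (^-comm ψ n)) ⟩
    φ ^ suc n ∷ (ψ ^ n) ∘ ψ ∷ []             ≋⟨ at 1 ∘-fuse ⟨
    φ ^ suc n ∷ ψ ^ n ∷ ψ ∷ []               ≋⟨ at 0 ∘-fuse ⟨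
    φ ∷ φ ^ n ∷ ψ ^ n ∷ ψ ∷ []               ≋⟨ at 1 (φ^-ψ^ n) ⟩
    φ ∷ ψ ∷ []                               ≋⟨ φ-ψ ⟩
    []                                       ■

  ηₙ-εₙ : ∀ n → ηₙ n ∷ shift n (εₙ n) ∷ [] ≋ []
  ηₙ-εₙ zero    = ⌊ ∘-identityˡ I ⌋
  ηₙ-εₙ (suc n) =
    ηₙ (suc n) ∷ shift (suc n) (εₙ (suc n)) ∷ []       ≋⟨ at 0 ∘-fuse ⟨
    η ∷ ψ ^ n ∷ shift (suc n) (εₙ (suc n)) ∷ []        ≋⟨ at 1 (interchange (^-split n ψ-arity) (εₙ (suc n))) ⟩
    η ∷ S (εₙ (suc n)) ∷ ψ ^ n ∷ []                    ≋⟨ at 1 (⇑ ∘-fuse) ⟨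
    η ∷ S (S (φ ^ n)) ∷ S ε ∷ ψ ^ n ∷ []               ≋⟨ at 0 (interchange η-arity (φ ^ n)) ⟩
    φ ^ n ∷ η ∷ S ε ∷ ψ ^ n ∷ []                       ≋⟨ at 1 snake-η-Sε ⟩
    φ ^ n ∷ ψ ^ n ∷ []                                 ≋⟨ φ^-ψ^ n ⟩
    []                                                 ■

  -- Naturality of the twist along `ψ ^ n` reduces the claim to the object 1, where `η-θ` moves the
  -- twist to the dual leg and a snake finishes.
  Sηₙ-tw-εₙ : ∀ n → shift (dual n) (ηₙ n) ∷ shift (dual n) (tw ⊕ n) ∷ εₙ n ∷ [] ≋ tw ⊕ (dual n) ∷ []
  Sηₙ-tw-εₙ zero    = ⌊ trans (∘-identityˡ (I ∘ I)) (∘-identityˡ I) ⌋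
  Sηₙ-tw-εₙ (suc n) =
    S (ηₙ (suc n)) ∷ S (tw ⊕ (suc n)) ∷ εₙ (suc n) ∷ []                      ≋⟨ at 2 ∘-fuse ⟨
    S (ηₙ (suc n)) ∷ S (tw ⊕ (suc n)) ∷ S (φ ^ n) ∷ ε ∷ []                   ≋⟨ at 0 S-fuse ⟨
    S η ∷ S (ψ ^ n) ∷ S (tw ⊕ (suc n)) ∷ S (φ ^ n) ∷ ε ∷ []                  ≋⟨ at 1 (⇑ (tw-natural ⊕ (^-split n ψ-arity))) ⟩
    S η ∷ S (tw ⊕ 1) ∷ S (ψ ^ n) ∷ S (φ ^ n) ∷ ε ∷ []                        ≋⟨ at 2 (⇑ (ψ^-φ^ n)) ⟩
    S η ∷ S (tw ⊕ 1) ∷ ε ∷ []                                                ≋⟨ at 1 (⇑ (tw-1 ⊕)) ⟩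
    S η ∷ S (θ ⊕) ∷ ε ∷ []                                                   ≋⟨ at 0 (⇑ η-θ) ⟩
    S η ∷ S (S (θ ⊕)) ∷ ε ∷ []                                               ≋⟨ at 1 (interchange ε-arity (θ ⊕)) ⟨
    S η ∷ ε ∷ θ ⊕ ∷ []                                                       ≋⟨ at 0 snake-Sη-ε ⟩
    θ ⊕ ∷ []                                                                 ≋⟨ tw-1 ⊕ ⟨
    tw ⊕ 1 ∷ []                                                              ■

  Sηₙ-εₙ : ∀ n → shift (dual n) (ηₙ n) ∷ εₙ n ∷ [] ≋ []
  Sηₙ-εₙ zero    = ⌊ ∘-identityˡ I ⌋
  Sηₙ-εₙ (suc n) =
    S (ηₙ (suc n)) ∷ εₙ (suc n) ∷ []                   ≋⟨ at 1 ∘-fuse ⟨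
    S (ηₙ (suc n)) ∷ S (φ ^ n) ∷ ε ∷ []                ≋⟨ at 0 S-fuse ⟨
    S η ∷ S (ψ ^ n) ∷ S (φ ^ n) ∷ ε ∷ []               ≋⟨ at 1 (⇑ (ψ^-φ^ n)) ⟩
    S η ∷ ε ∷ []                                       ≋⟨ snake-Sη-ε ⟩
    []                                                 ■

  ribbon : RibbonStructure monoidal
  ribbon = record
    { σ        = λ m n → hom (br⇒ ⊕ m n)
    ; σ⁻¹      = λ m n → hom (br⇒ ⊖ n m)
    ; σ-σ⁻¹    = λ m n → value (br-inverse ⊕ m n)
    ; σ⁻¹-σ    = λ m n → value (br-inverse ⊖ n m)
    ; σ-nat    = λ f g → value (braid-natural (typing f) (typing g))
    ; hexagon₁ = λ a b n → trans (elt-cast (+-assoc a b n) (sym (+-assoc n a b)) _)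
        (trans (value (br-+ˡ ⊕ a b n))
          (cong₂ _∘_ (sym (∘-identityˡ _)) (sym (cast-⊗id (+-assoc a n b) refl _ (n + a) refl))))
    ; hexagon₂ = λ m a b → trans (elt-cast (sym (+-assoc m a b)) (+-assoc a b m) _)
        (trans (value (br-+ʳ ⊕ m a b))
          (cong₂ _∘_ (sym (∘-shift-I (a + m) _)) (sym (cast-id⊗ (sym (+-assoc a m b)) refl _ refl))))
    ; θ        = λ n → hom (tw-arity ⊕ n)
    ; θ⁻¹      = λ n → hom (tw-arity ⊖ n)
    ; θ-θ⁻¹    = λ n → value (tw-inverse ⊕ n)
    ; θ⁻¹-θ    = λ n → value (tw-inverse ⊖ n)
    ; θ-nat    = λ f → value (tw-natural ⊕ (typing f))
    ; θ-⊗      = λ a b → trans (value (tw-+ ⊕ a b)) (cong (br ⊕ a b ∘_) (sym (∘-assoc _ _ _)))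
    ; dual     = dual
    ; η        = λ n → hom (ηₙ-arity n)
    ; ε        = λ n → hom (εₙ-arity n)
    ; snake₁   = λ n → trans (elt-cast refl (+-identityʳ n) _)
        (trans (cong₂ _∘_ (∘-shift-I (n + dual n) _) (cast-id⊗ (sym (+-assoc n (dual n) n)) refl _ refl))
          (value (ηₙ-εₙ n)))
    ; snake₂   = λ n → trans (elt-cast (+-identityʳ (dual n)) refl _)
        (trans (cong₂ _∘_ (∘-identityˡ _) (cast-⊗id (+-assoc (dual n) n (dual n)) refl _ 0 refl))
          (value (Sηₙ-εₙ n)))
    ; θ-dual   = λ n → trans (elt-cast (+-identityʳ (dual n)) refl _)
        (trans (cong₂ _∘_ (∘-identityˡ _) (cong₂ _∘_
            (trans (∘-identityˡ _) (cong (shift (dual n)) (∘-shift-I n _)))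
            (cast-⊗id (+-assoc (dual n) n (dual n)) refl _ 0 refl)))
          (value (Sηₙ-tw-εₙ n)))
    }
    where
    braid-natural : ∀ {f g k l m n} → f ∶ k ⇒ m → g ∶ l ⇒ n →
      f ∘ shift m g ∷ br ⊕ m n ∷ [] ≋ br ⊕ k l ∷ g ∘ shift n f ∷ []
    braid-natural {f} {g} {k} {l} {m} {n} f⇒ g⇒ =
      f ∘ shift m g ∷ br ⊕ m n ∷ []          ≋⟨ at 0 ∘-fuse ⟨
      f ∷ shift m g ∷ br ⊕ m n ∷ []          ≋⟨ at 1 (br-naturalʳ ⊕ m g⇒) ⟩
      f ∷ br ⊕ m l ∷ g ∷ []                  ≋⟨ at 0 (br-naturalˡ ⊕ l f⇒) ⟩
      br ⊕ k l ∷ shift l f ∷ g ∷ []          ≋⟨ at 1 (interchange g⇒ f) ⟨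
      br ⊕ k l ∷ g ∷ shift n f ∷ []          ≋⟨ at 1 ∘-fuse ⟩
      br ⊕ k l ∷ g ∘ shift n f ∷ []          ■

  -- The reflexive object 1 and the algebra arising from it

  φʰ : Hom 2 1
  φʰ = hom φ-arity

  ψʰ : Hom 1 2
  ψʰ = hom ψ-arity

  open StrictMonoidalCategory monoidal using (_⨾_; _⊗₁_; id; unitˡ₀; assoc₀)
  open ReflexiveObject monoidal ribbon 1 φʰ ψʰ

  br-1-1 : ∀ s → br s 1 1 ≡ C s
  br-1-1 s = trans (value (br-1ʳ s 1)) (value (d-1 s))

  ε₁ : εₙ 1 ≡ ε
  ε₁ = trans (cong (_∘ ε) S-I) (∘-identityˡ ε)

  η₁ : ηₙ 1 ≡ η
  η₁ = ∘-identityʳ η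

  elt-app : elt app ≡ B
  elt-app = trans (cong₂ _∘_ (∘-shift-I 2 ψ) (∘-identityˡ _))
                  (trans (cong (λ x → ψ ∘ S x) ε₁) (value ψ-Sε))

  elt-lam : elt lam ≡ Tr
  elt-lam = trans
    (cong₂ _∘_ (trans (∘-identityˡ _) (cong S η₁))
      (cong₂ _∘_ (trans (∘-identityˡ _) (cong S (trans (∘-identityˡ _) (cong S (value (tw-1 ⊖))))))
        (cong₂ _∘_ (trans (∘-identityˡ _) (cong S (br-1-1 ⊖)))
                   (∘-shift-I 1 φ))))
    (value Sη-φ)

  elt-appₙ : ∀ n → elt (appₙ n) ≡ B ^ n
  elt-appₙ zero    = refl
  elt-appₙ (suc n) = cong₂ _∘_
    (trans (∘-shift-I 1 _) elt-app) (elt-appₙ n)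

  elt-lamₙ : ∀ m → elt (lamₙ m) ≡ Tr ^ m
  elt-lamₙ zero    = refl
  elt-lamₙ (suc m) = trans
    (cong₂ _∘_ (elt-lamₙ m) (trans (∘-shift-I 2 _) elt-lam))
    (sym (^-comm Tr m))

  elt-trace : ∀ {g} (f : Hom 1 2) → elt f ≡ g → g ∶ 1 ⇒ 2 →
    elt (trace 0 1 1 f) ≡ Tr · (g ∘ C ⊕)
  elt-trace {g} f e g⇒ = trans
    (cong₂ _∘_ (trans (∘-identityˡ _) η₁)
      (cong₂ _∘_ (trans (∘-shift-I 2 _) e)
        (trans (∘-identityˡ _) (cong S (cong₂ _∘_ (br-1-1 ⊕)
          (cong₂ _∘_ (trans (∘-identityˡ _) (cong S (value (tw-1 ⊕)))) ε₁))))))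
    (value (
      η ∷ g ∷ S (C ⊕ ∘ S (θ ⊕) ∘ ε) ∷ []           ≋⟨ at 2 S-fuse ⟨
      η ∷ g ∷ S (C ⊕) ∷ S (S (θ ⊕) ∘ ε) ∷ []       ≋⟨ at 3 S-fuse ⟨
      η ∷ g ∷ S (C ⊕) ∷ S (S (θ ⊕)) ∷ S ε ∷ []     ≋⟨ right-trace g⇒ ⟩
      Tr · (g ∘ C ⊕) ∷ []                          ■))

  -- On the internal PROB, `F` sends a morphism to the point of its underlying element. As `app` and
  -- `lam` are `B` and `Tr`, every constant of the arising algebra is thereby the point of the
  -- original constant.
  elt-F : ∀ {x} m n (f : Hom (pow m) (pow n)) → elt f ≡ x → x ∶ m ⇒ n → elt (F m n f) ≡ x •
  elt-F {x} m n f e x⇒ =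
    trans (elt-trace untraced body (abstraction-body-arity x⇒)) (abstraction x⇒)
    where
    untraced : Hom 1 2
    untraced = cast (InternalPROB.Hom 𝒜) (sym (unitˡ₀ 1)) refl
      (lamₙ m ⨾ cast (InternalPROB.Hom 𝒜) refl (assoc₀ 1 1 (pow n)) (lam ⊗₁ f) ⨾ (id {1} ⊗₁ appₙ n))
    body : elt untraced ≡ abstraction-body x⇒
    body = trans
      (cong₂ _∘_ (elt-lamₙ m) (cong₂ _∘_
        (cong₂ (λ y z → y ∘ S (S z)) elt-lam e)
        (trans (∘-identityˡ _) (cong S (elt-appₙ n)))))
      (value (
        (Tr ^ m) ∘ ((Tr ∘ S (S x)) ∘ S (B ^ n)) ∷ []       ≋⟨ ∘-fuse ⟨
        Tr ^ m ∷ (Tr ∘ S (S x)) ∘ S (B ^ n) ∷ []           ≋⟨ at 1 ∘-fuse ⟨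
        Tr ^ m ∷ Tr ∘ S (S x) ∷ S (B ^ n) ∷ []             ≋⟨ at 1 ∘-fuse ⟨
        Tr ^ m ∷ Tr ∷ S (S x) ∷ S (B ^ n) ∷ []             ≋⟨ at 2 S-fuse ⟩
        Tr ^ m ∷ Tr ∷ S (S x ∘ (B ^ n)) ∷ []               ≋⟨ at 0 ∘-fuse ⟩
        (Tr ^ m) ∘ Tr ∷ S (S x ∘ (B ^ n)) ∷ []             ≋⟨ at 0 (atom (^-comm Tr m)) ⟨
        Tr ^ suc m ∷ S (S x ∘ (B ^ n)) ∷ []                ≋⟨ ∘-fuse ⟩
        abstraction-body x⇒ ∷ []                           ■))

  iso : RCAIso 𝒜 (ReflexiveObject.arising monoidal ribbon 1 φʰ ψʰ) (InternalPROB._≈_ 𝒜)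
  iso = record
    { to         = λ a → hom (•-arity a)
    ; injective  = λ a b → •-injective
    ; surjective = λ y → elt y · I , name-• (typing y)
    ; pres-·     = λ a b → value (
        (a · b) • ∷ []                         ≋⟨ •-distrib-· ⟩
        -- The tensor of two points inserts `a •` first and `b •` to its right; interchange produces
        -- the opposite order of insertion used by `•-distrib-·`.
        b • ∷ a • ∷ B ∷ []                     ≋⟨ at 0 •-S ⟨
        a • ∷ S (b •) ∷ B ∷ []                 ≋⟨ at 0 ∘-fuse ⟩
        a • ∘ S (b •) ∷ B ∷ []                 ≋⟨ at 1 (atom elt-app) ⟨
        a • ∘ S (b •) ∷ elt app ∷ []           ■)
    ; pres-B     = sym (elt-F 2 1 (cast (InternalPROB.Hom 𝒜) (sym pow2) (sym pow1) app) elt-app B-arity)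
    ; pres-C     = λ s → sym (elt-F 2 2 (cast (InternalPROB.Hom 𝒜) (sym pow2) (sym pow2) (σ± s)) (elt-σ± s) (C-arity s))
    ; pres-I     = sym (elt-F 0 0 id refl (I-arity 0))
    ; pres-θ     = λ s → sym (elt-F 1 1 (cast (InternalPROB.Hom 𝒜) (sym pow1) (sym pow1) (θ± s)) (elt-θ± s) (θ-arity s))
    ; pres-Tr    = sym (elt-F 1 2 (cast (InternalPROB.Hom 𝒜) (sym pow1) (sym pow2) lam) elt-lam Tr-arity)
    }
    where
    elt-σ± : ∀ s → elt (σ± s) ≡ C s
    elt-σ± ⊕ = br-1-1 ⊕
    elt-σ± ⊖ = br-1-1 ⊖
    elt-θ± : ∀ s → elt (θ± s) ≡ θ s
    elt-θ± ⊕ = value (tw-1 ⊕)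
    elt-θ± ⊖ = value (tw-1 ⊖)

-- The theorem mentions Hom and _≈_ through local modules, which are not
-- syntactically the originals.  Identifying the two types of the isomorphism
-- is cheap while M, R, φ and φ⁻¹ are variables, but for the concrete data it
-- would unfold arising completely.
assemble : (𝒜 : RCA)
    (M : StrictMonoidalCategory ℕ (InternalPROB.Hom 𝒜) (InternalPROB._≈_ 𝒜) 0 _+_)
    (R : RibbonStructure M) →
    let open RCA 𝒜 in
    let open InternalPROB 𝒜 in
    let open StrictMonoidalCategory M using () renaming (_⨾_ to _⨟_; _⊗₁_ to _⊠_; id to idᴹ) in
    (φ : InternalPROB.Hom 𝒜 (1 + RibbonStructure.dual R 1) 1)
    (φ⁻¹ : InternalPROB.Hom 𝒜 1 (1 + RibbonStructure.dual R 1)) →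
    RCAIso 𝒜 (ReflexiveObject.arising M R 1 φ φ⁻¹) (InternalPROB._≈_ 𝒜) →
    (∀ {l m n} (f : Hom l m) (g : Hom m n) → elt (f ⨟ g) ≡ elt f ∘ elt g) →
    (∀ {n} → elt (idᴹ {n}) ≡ I) →
    (∀ {m n m' n'} (f : Hom m n) (g : Hom m' n') → elt (f ⊠ g) ≡ elt f ∘ ((B ^ n) · elt g)) →
    (∀ m n → elt (RibbonStructure.σ R m n) ≡ σ m n) →
    (∀ n → elt (RibbonStructure.θ R n) ≡ θₘ n) →
    ((φ ⨟ φ⁻¹) ≈ idᴹ) → ((φ⁻¹ ⨟ φ) ≈ idᴹ) →
    Σ (StrictMonoidalCategory ℕ Hom _≈_ 0 _+_) λ M →
    let open StrictMonoidalCategory M in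
    (∀ {l m n} (f : Hom l m) (g : Hom m n) → elt (f ⨾ g) ≡ elt f ∘ elt g) ×
    (∀ {n} → elt (id {n}) ≡ I) ×
    (∀ {m n m' n'} (f : Hom m n) (g : Hom m' n') →
    elt (f ⊗₁ g) ≡ elt f ∘ ((B ^ n) · elt g)) ×
    Σ (RibbonStructure M) λ R →
    (∀ m n → elt (RibbonStructure.σ R m n) ≡ σ m n) ×
    (∀ n → elt (RibbonStructure.θ R n) ≡ θₘ n) ×
    Σ (Hom (1 + RibbonStructure.dual R 1) 1) λ φ →
    Σ (Hom 1 (1 + RibbonStructure.dual R 1)) λ φ⁻¹ →
    ((φ ⨾ φ⁻¹) ≈ id) × ((φ⁻¹ ⨾ φ) ≈ id) ×
    RCAIso 𝒜 (ReflexiveObject.arising M R 1 φ φ⁻¹) _≈_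
assemble 𝒜 M R φ φ⁻¹ i p⨾ pid p⊗ pσ pθ e e′ =
  M , p⨾ , (λ {n} → pid {n}) , p⊗ , R , pσ , pθ , φ , φ⁻¹ , e , e′ , i

theorem6p1 : (𝒜 : RCA) →
    let open RCA 𝒜 in
    let open InternalPROB 𝒜 in
    Σ (StrictMonoidalCategory ℕ Hom _≈_ 0 _+_) λ M →
    let open StrictMonoidalCategory M in
    (∀ {l m n} (f : Hom l m) (g : Hom m n) → elt (f ⨾ g) ≡ elt f ∘ elt g) ×
    (∀ {n} → elt (id {n}) ≡ I) ×
    (∀ {m n m' n'} (f : Hom m n) (g : Hom m' n') →
    elt (f ⊗₁ g) ≡ elt f ∘ ((B ^ n) · elt g)) ×
    Σ (RibbonStructure M) λ R →
    (∀ m n → elt (RibbonStructure.σ R m n) ≡ σ m n) ×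
    (∀ n → elt (RibbonStructure.θ R n) ≡ θₘ n) ×
    Σ (Hom (1 + RibbonStructure.dual R 1) 1) λ φ →
    Σ (Hom 1 (1 + RibbonStructure.dual R 1)) λ φ⁻¹ →
    ((φ ⨾ φ⁻¹) ≈ id) × ((φ⁻¹ ⨾ φ) ≈ id) ×
    RCAIso 𝒜 (ReflexiveObject.arising M R 1 φ φ⁻¹) _≈_
theorem6p1 𝒜 =
  assemble 𝒜 (Theory.monoidal 𝒜) (Theory.ribbon 𝒜) (Theory.φʰ 𝒜) (Theory.ψʰ 𝒜) (Theory.iso 𝒜)
    (λ f g → refl) refl (λ {n = n} f g → cong (elt f ∘_) (sym (Theory.B^-· 𝒜 n (elt g))))
    (Theory.σᴰ-br 𝒜) (Theory.θᴰ-tw 𝒜) (Theory._≋_.value (Theory.φ-ψ 𝒜)) (Theory._≋_.value (Theory.ψ-φ 𝒜))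
  where
  open RCA 𝒜 using (_∘_)
  open InternalPROB 𝒜 using (elt)
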